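{- Let $\gamma=\frac{\log 2}{\log 3}$, let $\psi:\{3^n:n\in\mathbb{N}\}\to\{3^{ -r}:r\in\mathbb{Z}\}$ be a function, and let $f$ be a dimension function such that $r\mapsto r^{ -\gamma}f(r)$ is monotonic. Then $$\mathcal{H}^f(W_{\mathcal{C}}(\psi))=\begin{cases}0 & \text{if } \sum_{n=1}^{\infty} f(\psi(3^n))\,(3^n)^{\gamma}<\infty,\\ \mathcal{H}^f(\mathcal{C}) & \text{if } \sum_{n=1}^{\infty} f(\psi(3^n))\,(3^n)^{\gamma}=\infty.\end{cases}$$
   Context: $\mathbb{F}_3$ is the field with $3$ elements. $\mathbb{F}_3((X^{ -1}))$ is the field of formal Laurent series $\sum_{n=-N}^{\infty}a_{ -n}X^{ -n}$ with $a_{ -n}\in\mathbb{F}_3$, with ultrametric absolute value $|0|=0$ and $\left|\sum_{n=-N}^{\infty}a_{ -n}X^{ -n}\right|=3^N$ when $a_N\neq 0$; it is the completion of $\mathbb{F}_3(X)$ with respect to $|P|=3^{\deg P}$. Let $\mathbb{I}=\{h:|h|<1\}$, i.e. the series of the form $\sum_{n\ge1}a_{ -n}X^{ -n}$. The Cantor set is $\mathcal{C}=\{\sum_{n\ge 1}a_{ -n}X^{ -n}\in\mathbb{I}: a_{ -n}\in\{0,2\}\text{ for all }n\}$. For $N\in\mathbb{N}=\{1,2,\dots\}$, $\mathcal{F}(N)$ is the set of polynomials $g\in\mathbb{F}_3[X]$ with all coefficients in $\{0,2\}$ and $\deg g<N$ (including $g=0$). Define $$W_{\mathcal{C}}(\psi)=\left\{h\in\mathcal{C}:\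 \text{for infinitely many } N\in\mathbb{N}\text{ there is } g\in\mathcal{F}(N)\text{ with }\left|h-\tfrac{g}{X^N}\right|<\psi(3^N)\right\}.$$ A dimension function is a continuous, non-decreasing function $f:\mathbb{R}_{\ge0}\to\mathbb{R}_{\ge0}$ with $f(0)=0$. Balls are $B(x,3^k)=\{y:|y-x|<3^k\}$, $k\in\mathbb{Z}$; the radius of $B=B(x,3^k)$ is $r(B)=3^k$. For $A\subseteq\mathbb{F}_3((X^{ -1}))$, the Hausdorff $f$-measure is $\mathcal{H}^f(A)=\lim_{\rho\to0}\inf\sum_i f(r(B_i))$, the infimum being over all countable covers $\{B_i\}$ of $A$ by balls with $r(B_i)\le\rho$. -}

module Defs where

open import Data.Empty using (⊥)
open import Data.Fin using (Fin; toℕ)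
open import Data.Fin.Patterns using (0F; 2F)
open import Data.Integer as ℤ using (ℤ; +_; -[1+_])
import Data.Integer.Properties as ℤ
open import Data.Maybe using (Maybe; just; maybe′)
open import Data.Nat as ℕ using (ℕ; zero; suc; NonZero; _!)
open import Data.Nat.DivMod using (_mod_)
import Data.Nat.Properties as ℕ
open import Data.Product using (Σ; Σ-syntax; ∃; ∃-syntax; _×_; _,_; proj₁; proj₂)
open import Data.Rational as ℚ using (ℚ; 0ℚ; 1ℚ; ½; Positive; NonNegative)
import Data.Rational.Properties as ℚ
open import Data.Rational.Solver using (module +-*-Solver)
open import Data.Sum using (_⊎_)
open import Data.Unit using (⊤)
open import Relation.Binary.PropositionalEquality
  using (_≡_; _≢_; refl; sym; trans; cong; cong₂; subst)

-- The reals form a setoid: equality is _≈_, not _≡_.  A function on them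
-- that is continuous in the ε-δ sense respects _≈_ automatically.
IsCauchy : (ℕ → ℚ) → Set
IsCauchy x = ∀ ε → 0ℚ ℚ.< ε →
  ∃[ N ] (∀ m n → N ℕ.≤ m → N ℕ.≤ n → ℚ.∣ x m ℚ.- x n ∣ ℚ.< ε)

record ℝ : Set where
  constructor mkℝ
  field
    seq    : ℕ → ℚ
    cauchy : IsCauchy seq

open ℝ public

infix 4 _≈_ _≤_ _<_

_≈_ : ℝ → ℝ → Set
x ≈ y = ∀ ε → 0ℚ ℚ.< ε →
  ∃[ N ] (∀ n → N ℕ.≤ n → ℚ.∣ seq x n ℚ.- seq y n ∣ ℚ.< ε)

_≤_ : ℝ → ℝ → Set
x ≤ y = ∀ ε → 0ℚ ℚ.< ε →
  ∃[ N ] (∀ n → N ℕ.≤ n → seq x n ℚ.≤ seq y n ℚ.+ ε)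

_<_ : ℝ → ℝ → Set
x < y = ∃[ ε ] 0ℚ ℚ.< ε ×
  ∃[ N ] (∀ n → N ℕ.≤ n → seq x n ℚ.+ ε ℚ.≤ seq y n)

private
  half-pos : ∀ ε → 0ℚ ℚ.< ε → 0ℚ ℚ.< ½ ℚ.* ε
  half-pos ε 0<ε = subst (ℚ._< ½ ℚ.* ε) (ℚ.*-zeroʳ ½) (ℚ.*-monoʳ-<-pos ½ 0<ε)

  halves : ∀ ε → ½ ℚ.* ε ℚ.+ ½ ℚ.* ε ≡ ε
  halves ε = trans (sym (ℚ.*-distribʳ-+ ε ½ ½)) (ℚ.*-identityˡ ε)

  ⊔≤ˡ : ∀ {a b n} → a ℕ.⊔ b ℕ.≤ n → a ℕ.≤ n
  ⊔≤ˡ {a} {b} = ℕ.≤-trans (ℕ.m≤m⊔n a b)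

  ⊔≤ʳ : ∀ {a b n} → a ℕ.⊔ b ℕ.≤ n → b ℕ.≤ n
  ⊔≤ʳ {a} {b} = ℕ.≤-trans (ℕ.m≤n⊔m a b)

  p≤p+q : ∀ p q → 0ℚ ℚ.≤ q → p ℚ.≤ p ℚ.+ q
  p≤p+q p q 0≤q = subst (ℚ._≤ p ℚ.+ q) (ℚ.+-identityʳ p) (ℚ.+-monoʳ-≤ p 0≤q)

  const-cauchy : ∀ q → IsCauchy (λ _ → q)
  const-cauchy q ε 0<ε = 0 , λ _ _ _ _ →
    subst (ℚ._< ε) (sym (cong ℚ.∣_∣ (ℚ.+-inverseʳ q))) 0<ε

  +-cauchy : ∀ {x y} → IsCauchy x → IsCauchy y → IsCauchy (λ n → x n ℚ.+ y n)
  +-cauchy {x} {y} cx cy ε 0<ε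
    with cx (½ ℚ.* ε) (half-pos ε 0<ε) | cy (½ ℚ.* ε) (half-pos ε 0<ε)
  ... | M , p | N , q = M ℕ.⊔ N , λ m n m≥ n≥ → begin-strict
      ℚ.∣ (x m ℚ.+ y m) ℚ.- (x n ℚ.+ y n) ∣
        ≡⟨ cong ℚ.∣_∣ (regroup (x m) (y m) (x n) (y n)) ⟩
      ℚ.∣ (x m ℚ.- x n) ℚ.+ (y m ℚ.- y n) ∣
        ≤⟨ ℚ.∣p+q∣≤∣p∣+∣q∣ (x m ℚ.- x n) (y m ℚ.- y n) ⟩
      ℚ.∣ x m ℚ.- x n ∣ ℚ.+ ℚ.∣ y m ℚ.- y n ∣
        <⟨ ℚ.+-mono-< (p m n (⊔≤ˡ m≥) (⊔≤ˡ n≥)) (q m n (⊔≤ʳ {M} m≥) (⊔≤ʳ {M} n≥)) ⟩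
      ½ ℚ.* ε ℚ.+ ½ ℚ.* ε
        ≡⟨ halves ε ⟩
      ε ∎
    where
    open ℚ.≤-Reasoning
    open +-*-Solver
    regroup : ∀ a b c d → (a ℚ.+ b) ℚ.- (c ℚ.+ d) ≡ (a ℚ.- c) ℚ.+ (b ℚ.- d)
    regroup = solve 4 (λ a b c d →
      (a :+ b) :- (c :+ d) := (a :- c) :+ (b :- d)) refl

  neg-cauchy : ∀ {x} → IsCauchy x → IsCauchy (λ n → ℚ.- x n)
  neg-cauchy {x} cx ε 0<ε with cx ε 0<ε
  ... | N , p = N , λ m n m≥ n≥ →
      subst (ℚ._< ε) (sym (flip (x m) (x n))) (p m n m≥ n≥)
    where
    open +-*-Solver
    flip : ∀ a b → ℚ.∣ (ℚ.- a) ℚ.- (ℚ.- b) ∣ ≡ ℚ.∣ a ℚ.- b ∣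
    flip a b = trans
      (cong ℚ.∣_∣ (solve 2 (λ a b → (:- a) :- (:- b) := :- (a :- b)) refl a b))
      (ℚ.∣-p∣≡∣p∣ (a ℚ.- b))

  ∣∣-triangle : ∀ a b → ℚ.∣ a ∣ ℚ.≤ ℚ.∣ b ∣ ℚ.+ ℚ.∣ a ℚ.- b ∣
  ∣∣-triangle a b = subst (λ t → ℚ.∣ t ∣ ℚ.≤ ℚ.∣ b ∣ ℚ.+ ℚ.∣ a ℚ.- b ∣)
      (solve 2 (λ a b → b :+ (a :- b) := a) refl a b)
      (ℚ.∣p+q∣≤∣p∣+∣q∣ b (a ℚ.- b))
    where open +-*-Solver

  ∣∣-cauchy : ∀ {x} → IsCauchy x → IsCauchy (λ n → ℚ.∣ x n ∣)
  ∣∣-cauchy {x} cx ε 0<ε with cx ε 0<ε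
  ... | N , p = N , λ m n m≥ n≥ →
      close (x m) (x n) (p m n m≥ n≥) (p n m n≥ m≥)
    where
    shift : ∀ a b → ℚ.∣ a ℚ.- b ∣ ℚ.< ε → ℚ.∣ a ∣ ℚ.- ℚ.∣ b ∣ ℚ.< ε
    shift a b h = ℚ.≤-<-trans
      (subst (ℚ.∣ a ∣ ℚ.- ℚ.∣ b ∣ ℚ.≤_)
        (solve 2 (λ s t → (s :+ t) :- s := t) refl ℚ.∣ b ∣ ℚ.∣ a ℚ.- b ∣)
        (ℚ.+-monoˡ-≤ (ℚ.- ℚ.∣ b ∣) (∣∣-triangle a b))) h
      where open +-*-Solver
    close : ∀ a b → ℚ.∣ a ℚ.- b ∣ ℚ.< ε → ℚ.∣ b ℚ.- a ∣ ℚ.< ε →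
            ℚ.∣ ℚ.∣ a ∣ ℚ.- ℚ.∣ b ∣ ∣ ℚ.< ε
    close a b h k with ℚ.∣p∣≡p∨∣p∣≡-p (ℚ.∣ a ∣ ℚ.- ℚ.∣ b ∣)
    ... | _⊎_.inj₁ e = subst (ℚ._< ε) (sym e) (shift a b h)
    ... | _⊎_.inj₂ e = subst (ℚ._< ε)
        (sym (trans e (solve 2 (λ s t → :- (s :- t) := t :- s) refl ℚ.∣ a ∣ ℚ.∣ b ∣)))
        (shift b a k)
      where open +-*-Solver

  *-cauchy : ∀ {x y} → IsCauchy x → IsCauchy y → IsCauchy (λ n → x n ℚ.* y n)
  *-cauchy {x} {y} cx cy ε 0<ε = N , λ m n m≥ n≥ → begin-strict
      ℚ.∣ x m ℚ.* y m ℚ.- x n ℚ.* y n ∣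
        ≡⟨ cong ℚ.∣_∣ (regroup (x m) (y m) (x n) (y n)) ⟩
      ℚ.∣ (x m ℚ.- x n) ℚ.* y m ℚ.+ (y m ℚ.- y n) ℚ.* x n ∣
        ≤⟨ ℚ.∣p+q∣≤∣p∣+∣q∣ ((x m ℚ.- x n) ℚ.* y m) ((y m ℚ.- y n) ℚ.* x n) ⟩
      ℚ.∣ (x m ℚ.- x n) ℚ.* y m ∣ ℚ.+ ℚ.∣ (y m ℚ.- y n) ℚ.* x n ∣
        <⟨ ℚ.+-mono-<
             (small (x m ℚ.- x n) (y m)
               (proj₂ X m n (⊔≤ˡ (⊔≤ˡ m≥)) (⊔≤ˡ (⊔≤ˡ n≥)))
               (bound-y m (⊔≤ʳ {proj₁ X₁} (⊔≤ʳ {proj₁ X ℕ.⊔ proj₁ Y} m≥))))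
             (small (y m ℚ.- y n) (x n)
               (proj₂ Y m n (⊔≤ʳ {proj₁ X} (⊔≤ˡ m≥)) (⊔≤ʳ {proj₁ X} (⊔≤ˡ n≥)))
               (bound-x n (⊔≤ˡ (⊔≤ʳ {proj₁ X ℕ.⊔ proj₁ Y} n≥)))) ⟩
      ½ ℚ.* ε ℚ.+ ½ ℚ.* ε
        ≡⟨ halves ε ⟩
      ε ∎
    where
    open ℚ.≤-Reasoning
    regroup : ∀ a b c d → a ℚ.* b ℚ.- c ℚ.* d ≡ (a ℚ.- c) ℚ.* b ℚ.+ (b ℚ.- d) ℚ.* c
    regroup = solve 4 (λ a b c d →
      a :* b :- c :* d := (a :- c) :* b :+ (b :- d) :* c) refl
      where open +-*-Solver
    X₁ = cx 1ℚ (ℚ.positive⁻¹ 1ℚ)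
    Y₁ = cy 1ℚ (ℚ.positive⁻¹ 1ℚ)
    bx = ℚ.∣ x (proj₁ X₁) ∣
    by = ℚ.∣ y (proj₁ Y₁) ∣
    B : ℚ
    B = (bx ℚ.+ by) ℚ.+ 1ℚ
    instance
      bx≥0 : NonNegative bx
      bx≥0 = ℚ.∣-∣-nonNeg (x (proj₁ X₁))
      by≥0 : NonNegative by
      by≥0 = ℚ.∣-∣-nonNeg (y (proj₁ Y₁))
      bx+by≥0 : NonNegative (bx ℚ.+ by)
      bx+by≥0 = ℚ.nonNeg+nonNeg⇒nonNeg bx by
      B>0 : Positive B
      B>0 = ℚ.nonNeg+pos⇒pos (bx ℚ.+ by) 1ℚ
      B≢0 : ℚ.NonZero B
      B≢0 = ℚ.pos⇒nonZero B
    1/B : ℚ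
    1/B = ℚ.1/ B
    instance
      1/B>0 : Positive 1/B
      1/B>0 = ℚ.1/pos⇒pos B
    δ : ℚ
    δ = (½ ℚ.* ε) ℚ.* 1/B
    0<δ : 0ℚ ℚ.< δ
    0<δ = subst (ℚ._< δ) (ℚ.*-zeroˡ 1/B) (ℚ.*-monoˡ-<-pos 1/B (half-pos ε 0<ε))
    δ*B : δ ℚ.* B ≡ ½ ℚ.* ε
    δ*B = trans (ℚ.*-assoc (½ ℚ.* ε) 1/B B)
      (trans (cong ((½ ℚ.* ε) ℚ.*_) (ℚ.*-inverseˡ B)) (ℚ.*-identityʳ (½ ℚ.* ε)))
    X = cx δ 0<δ
    Y = cy δ 0<δ
    N = (proj₁ X ℕ.⊔ proj₁ Y) ℕ.⊔ (proj₁ X₁ ℕ.⊔ proj₁ Y₁)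
    x≤B : bx ℚ.+ 1ℚ ℚ.≤ B
    x≤B = ℚ.+-monoˡ-≤ 1ℚ (p≤p+q bx by (ℚ.0≤∣p∣ (y (proj₁ Y₁))))
    y≤B : by ℚ.+ 1ℚ ℚ.≤ B
    y≤B = ℚ.+-monoˡ-≤ 1ℚ
      (subst (by ℚ.≤_) (ℚ.+-comm by bx) (p≤p+q by bx (ℚ.0≤∣p∣ (x (proj₁ X₁)))))
    bound-x : ∀ n → proj₁ X₁ ℕ.≤ n → ℚ.∣ x n ∣ ℚ.≤ B
    bound-x n n≥ = ℚ.≤-trans (∣∣-triangle (x n) (x (proj₁ X₁)))
      (ℚ.≤-trans (ℚ.+-monoʳ-≤ bx (ℚ.<⇒≤ (proj₂ X₁ n (proj₁ X₁) n≥ ℕ.≤-refl))) x≤B)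
    bound-y : ∀ n → proj₁ Y₁ ℕ.≤ n → ℚ.∣ y n ∣ ℚ.≤ B
    bound-y n n≥ = ℚ.≤-trans (∣∣-triangle (y n) (y (proj₁ Y₁)))
      (ℚ.≤-trans (ℚ.+-monoʳ-≤ by (ℚ.<⇒≤ (proj₂ Y₁ n (proj₁ Y₁) n≥ ℕ.≤-refl))) y≤B)
    small : ∀ u v → ℚ.∣ u ∣ ℚ.< δ → ℚ.∣ v ∣ ℚ.≤ B → ℚ.∣ u ℚ.* v ∣ ℚ.< ½ ℚ.* ε
    small u v u<δ v≤B = begin-strict
      ℚ.∣ u ℚ.* v ∣        ≡⟨ ℚ.∣p*q∣≡∣p∣*∣q∣ u v ⟩
      ℚ.∣ u ∣ ℚ.* ℚ.∣ v ∣  ≤⟨ ℚ.*-monoˡ-≤-nonNeg ℚ.∣ u ∣ {{ℚ.∣-∣-nonNeg u}} v≤B ⟩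
      ℚ.∣ u ∣ ℚ.* B        <⟨ ℚ.*-monoˡ-<-pos B u<δ ⟩
      δ ℚ.* B              ≡⟨ δ*B ⟩
      ½ ℚ.* ε              ∎

ι : ℚ → ℝ
ι q = mkℝ (λ _ → q) (const-cauchy q)

0ℝ 1ℝ 2ℝ 3ℝ : ℝ
0ℝ = ι 0ℚ
1ℝ = ι 1ℚ
2ℝ = ι (+ 2 ℚ./ 1)
3ℝ = ι (+ 3 ℚ./ 1)

infixl 6 _+_ _-_
infixl 7 _*_
infix  8 -_
infixr 8 _^_

_+_ _*_ : ℝ → ℝ → ℝ
x + y = mkℝ (λ n → seq x n ℚ.+ seq y n)
            (+-cauchy {seq x} {seq y} (cauchy x) (cauchy y))
x * y = mkℝ (λ n → seq x n ℚ.* seq y n)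
            (*-cauchy {seq x} {seq y} (cauchy x) (cauchy y))

-_ ∣_∣ : ℝ → ℝ
-_ x  = mkℝ (λ n → ℚ.- seq x n) (neg-cauchy {seq x} (cauchy x))
∣ x ∣ = mkℝ (λ n → ℚ.∣ seq x n ∣) (∣∣-cauchy {seq x} (cauchy x))

_-_ : ℝ → ℝ → ℝ
x - y = x + (- y)

_^_ : ℝ → ℕ → ℝ
x ^ zero  = 1ℝ
x ^ suc n = x * x ^ n

sumTo : ℕ → (ℕ → ℝ) → ℝ
sumTo zero    t = 0ℝ
sumTo (suc n) t = sumTo n t + t n

ℝ>0 ℝ≥0 : Set
ℝ>0 = Σ[ x ∈ ℝ ] 0ℝ < x
ℝ≥0 = Σ[ x ∈ ℝ ] 0ℝ ≤ x

data ℝ∞ : Set where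
  fin : ℝ → ℝ∞
  ∞   : ℝ∞

infix 4 _≤∞_

_≤∞_ : ℝ∞ → ℝ∞ → Set
fin x ≤∞ fin y = x ≤ y
_     ≤∞ ∞     = ⊤
∞     ≤∞ fin _ = ⊥

IsInfimum : (ℝ∞ → Set) → ℝ∞ → Set
IsInfimum S m =
  (∀ s → S s → m ≤∞ s) × (∀ l → (∀ s → S s → l ≤∞ s) → l ≤∞ m)

-- Near l ε y: y lies in the basic neighbourhood of l with parameter ε.
-- At a finite l this is the ε-ball; at ∞ it is the ray (ε, ∞], so there
-- it is the large ε that matter.
Near : ℝ∞ → ℝ>0 → ℝ∞ → Set
Near (fin l) (ε , _) (fin x) = ∣ x - l ∣ < ε
Near (fin l) (ε , _) ∞       = ⊥
Near ∞       (ε , _) (fin x) = ε < x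
Near ∞       (ε , _) ∞       = ⊤

HasSum : (ℕ → ℝ) → ℝ∞ → Set
HasSum t s = ∀ (ε : ℝ>0) →
  ∃[ N ] (∀ n → N ℕ.≤ n → Near s ε (fin (sumTo n t)))

LimitAt0⁺ : (ℝ>0 → ℝ∞) → ℝ∞ → Set
LimitAt0⁺ g l = ∀ (ε : ℝ>0) →
  Σ[ δ ∈ ℝ>0 ] (∀ (ρ : ℝ>0) → proj₁ ρ < proj₁ δ → Near l ε (g ρ))

-- exp, log and real powers are given by their graphs, which avoids building
-- the limits; x ^ s is exp (s log x).
1/_! : ℕ → ℚ
1/ n ! = ℚ._/_ (+ 1) (n !) {{n ℕ.!≢0}}

IsExp : ℝ → ℝ → Set
IsExp y z = HasSum (λ n → ι (1/ n !) * y ^ n) (fin z)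

IsLog : ℝ → ℝ → Set
IsLog x l = IsExp l x

-- z = x ^ s, for x > 0
IsPow : ℝ → ℝ → ℝ → Set
IsPow x s z = ∃[ l ] IsLog x l × IsExp (s * l) z

-- γ = log a / log b
IsLogRatio : ℝ → ℝ → ℝ → Set
IsLogRatio a b γ = ∃[ l ] ∃[ k ] IsLog a l × IsLog b k × γ * k ≈ l

-- The sets {3 ^ n : n ≥ 1} and {3 ^ k : k ∈ ℤ}, represented by exponents.
record 3^ℕ : Set where
  constructor 3^_
  field
    exponent    : ℕ
    {{nonZero}} : NonZero exponent

record 3^ℤ : Set where
  constructor 3^_
  field
    exponent : ℤ

3^ℤ⇒ℚ : 3^ℤ → ℚ
3^ℤ⇒ℚ (3^ (+ n))    = + (3 ℕ.^ n) ℚ./ 1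
3^ℤ⇒ℚ (3^ -[1+ n ]) = ℚ._/_ (+ 1) (3 ℕ.^ suc n) {{ℕ.m^n≢0 3 (suc n)}}

private
  3^ℤ⇒ℚ-nonNeg : ∀ r → NonNegative (3^ℤ⇒ℚ r)
  3^ℤ⇒ℚ-nonNeg (3^ (+ n)) = ℚ.normalize-nonNeg (3 ℕ.^ n) 1
  3^ℤ⇒ℚ-nonNeg (3^ -[1+ n ]) =
    ℚ.normalize-nonNeg 1 (3 ℕ.^ suc n) {{ℕ.m^n≢0 3 (suc n)}}

  ι-nonNeg : ∀ q → NonNegative q → 0ℝ ≤ ι q
  ι-nonNeg q q≥0 ε 0<ε = 0 , λ _ _ →
    ℚ.≤-trans (ℚ.nonNegative⁻¹ q {{q≥0}})
      (p≤p+q q ε (ℚ.<⇒≤ 0<ε))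

⟦_⟧ : 3^ℤ → ℝ
⟦ r ⟧ = ι (3^ℤ⇒ℚ r)

⟦_⟧≥0 : 3^ℤ → ℝ≥0
⟦ r ⟧≥0 = ⟦ r ⟧ , ι-nonNeg (3^ℤ⇒ℚ r) (3^ℤ⇒ℚ-nonNeg r)

3^ℕ⇒ℝ : 3^ℕ → ℝ
3^ℕ⇒ℝ (3^ n) = ⟦ 3^ (+ n) ⟧

𝔽₃ : Set
𝔽₃ = Fin 3

infixl 6 _-₃_

_-₃_ : 𝔽₃ → 𝔽₃ → 𝔽₃
a -₃ b = (toℕ a ℕ.+ (3 ℕ.∸ toℕ b)) mod 3

-- coeff i is the coefficient of X ^ i
record 𝔽₃⟨⟨X⁻¹⟩⟩ : Set where
  field
    coeff   : ℤ → 𝔽₃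
    bounded : ∃[ N ] (∀ i → N ℤ.< i → coeff i ≡ 0F)

open 𝔽₃⟨⟨X⁻¹⟩⟩ public

infixl 6 _⊖_
infixl 7 _/X^_

_⊖_ : 𝔽₃⟨⟨X⁻¹⟩⟩ → 𝔽₃⟨⟨X⁻¹⟩⟩ → 𝔽₃⟨⟨X⁻¹⟩⟩
g ⊖ h = record
  { coeff   = λ i → coeff g i -₃ coeff h i
  ; bounded = M ℤ.⊔ N , λ i i> → cong₂ _-₃_
      (proj₂ (bounded g) i (ℤ.≤-<-trans (ℤ.i≤i⊔j M N) i>))
      (proj₂ (bounded h) i (ℤ.≤-<-trans (ℤ.i≤j⊔i M N) i>))
  }
  where
  M = proj₁ (bounded g)
  N = proj₁ (bounded h)

-- Multiplying by the monomial X ^ (- N) shifts the coefficients.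
_/X^_ : 𝔽₃⟨⟨X⁻¹⟩⟩ → ℕ → 𝔽₃⟨⟨X⁻¹⟩⟩
g /X^ N = record
  { coeff   = λ i → coeff g (i ℤ.+ + N)
  ; bounded = proj₁ (bounded g) , λ i i> → proj₂ (bounded g) (i ℤ.+ + N)
      (ℤ.<-≤-trans i> (ℤ.i≤i+j i (+ N)))
  }

-- r = |h|
IsAbs : 𝔽₃⟨⟨X⁻¹⟩⟩ → ℝ → Set
IsAbs h r =
    ((∀ i → coeff h i ≡ 0F) × r ≈ 0ℝ)
  ⊎ (∃[ N ] coeff h N ≢ 0F × (∀ i → N ℤ.< i → coeff h i ≡ 0F) × r ≈ ⟦ 3^ N ⟧)

infix 4 ∥_∥<_

∥_∥<_ : 𝔽₃⟨⟨X⁻¹⟩⟩ → ℝ → Set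
∥ h ∥< v = ∃[ r ] IsAbs h r × r < v

𝕀 : 𝔽₃⟨⟨X⁻¹⟩⟩ → Set
𝕀 h = ∥ h ∥< 1ℝ

CantorDigit : 𝔽₃ → Set
CantorDigit a = a ≡ 0F ⊎ a ≡ 2F

𝒞 : 𝔽₃⟨⟨X⁻¹⟩⟩ → Set
𝒞 h = 𝕀 h × (∀ n → 1 ℕ.≤ n → CantorDigit (coeff h (ℤ.- (+ n))))

-- 𝔽₃[X] as a subset of 𝔽₃((X⁻¹))
IsPolynomial : 𝔽₃⟨⟨X⁻¹⟩⟩ → Set
IsPolynomial g = ∀ i → i ℤ.< + 0 → coeff g i ≡ 0F

DegreeBelow : ℕ → 𝔽₃⟨⟨X⁻¹⟩⟩ → Set
DegreeBelow N g = ∀ i → + N ℤ.≤ i → coeff g i ≡ 0F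

ℱ : ℕ → 𝔽₃⟨⟨X⁻¹⟩⟩ → Set
ℱ N g = IsPolynomial g × (∀ i → CantorDigit (coeff g i)) × DegreeBelow N g

W𝒞 : (3^ℕ → 3^ℤ) → 𝔽₃⟨⟨X⁻¹⟩⟩ → Set
W𝒞 ψ h = 𝒞 h ×
  (∀ M → ∃[ n ] let N = suc n in M ℕ.< N ×
    ∃[ g ] ℱ N g × ∥ h ⊖ (g /X^ N) ∥< ⟦ ψ (3^ N) ⟧)

Continuous : (ℝ≥0 → ℝ≥0) → Set
Continuous f = ∀ (x : ℝ≥0) (ε : ℝ>0) → Σ[ δ ∈ ℝ>0 ] (∀ (y : ℝ≥0) →
  ∣ proj₁ y - proj₁ x ∣ < proj₁ δ → ∣ proj₁ (f y) - proj₁ (f x) ∣ < proj₁ ε)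

record IsDimensionFunction (f : ℝ≥0 → ℝ≥0) : Set where
  field
    continuous    : Continuous f
    nondecreasing : ∀ x y → proj₁ x ≤ proj₁ y → proj₁ (f x) ≤ proj₁ (f y)
    vanishes-at-0 : ∀ x → proj₁ x ≈ 0ℝ → proj₁ (f x) ≈ 0ℝ

-- v = r ^ (- γ) f(r), for r > 0
IsRescaling : ℝ → (ℝ≥0 → ℝ≥0) → ℝ≥0 → ℝ → Set
IsRescaling γ f r v =
  0ℝ < proj₁ r × ∃[ p ] IsPow (proj₁ r) (- γ) p × v ≈ p * proj₁ (f r)

RescalingMonotonic : ℝ → (ℝ≥0 → ℝ≥0) → Set
RescalingMonotonic γ f =
    (∀ r s v w → IsRescaling γ f r v → IsRescaling γ f s w →
      proj₁ r ≤ proj₁ s → v ≤ w)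
  ⊎ (∀ r s v w → IsRescaling γ f r v → IsRescaling γ f s w →
      proj₁ r ≤ proj₁ s → w ≤ v)

record Ball : Set where
  field
    centre : 𝔽₃⟨⟨X⁻¹⟩⟩
    radius : 3^ℤ

open Ball public

_∈ᴮ_ : 𝔽₃⟨⟨X⁻¹⟩⟩ → Ball → Set
y ∈ᴮ B = ∥ y ⊖ centre B ∥< ⟦ radius B ⟧

-- Missing entries make finite (and empty) families countable ones.
CountableFamily : Set
CountableFamily = ℕ → Maybe Ball

Covers : CountableFamily → (𝔽₃⟨⟨X⁻¹⟩⟩ → Set) → Set
Covers B A = ∀ y → A y → ∃[ i ] ∃[ b ] B i ≡ just b × y ∈ᴮ b

IsCoverSum : (ℝ≥0 → ℝ≥0) → (𝔽₃⟨⟨X⁻¹⟩⟩ → Set) → ℝ>0 → ℝ∞ → Set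
IsCoverSum f A (ρ , _) s = Σ[ B ∈ CountableFamily ]
    Covers B A
  × (∀ i b → B i ≡ just b → ⟦ radius b ⟧ ≤ ρ)
  × HasSum (λ i → maybe′ (λ b → proj₁ (f ⟦ radius b ⟧≥0)) 0ℝ (B i)) s

-- v = ℋᶠ(A)
IsHausdorffMeasure : (ℝ≥0 → ℝ≥0) → (𝔽₃⟨⟨X⁻¹⟩⟩ → Set) → ℝ∞ → Set
IsHausdorffMeasure f A v = Σ[ g ∈ (ℝ>0 → ℝ∞) ]
  (∀ ρ → IsInfimum (IsCoverSum f A ρ) (g ρ)) × LimitAt0⁺ g v

-- s = Σ_{n ≥ 1} f(ψ(3 ^ n)) (3 ^ n) ^ γ
IsSeriesSum : ℝ → (3^ℕ → 3^ℤ) → (ℝ≥0 → ℝ≥0) → ℝ∞ → Set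
IsSeriesSum γ ψ f s = Σ[ t ∈ (ℕ → ℝ) ]
    (∀ m → let r = 3^ suc m in
      ∃[ p ] IsPow (3^ℕ⇒ℝ r) γ p × t m ≈ proj₁ (f ⟦ ψ r ⟧≥0) * p)
  × HasSum t s

{-# OPTIONS --safe #-}

-- Write φ(n) = 2ⁿ f(3⁻ⁿ), the value of r^(-γ) f(r) at r = 3⁻ⁿ, and ψ(3ᴺ) = 3^(-r(N)).
-- Points of 𝒞 are sequences of digits 0 and 2, and a point lies in W_𝒞(ψ) iff for
-- infinitely many N its digits at the places N + 1, …, r(N) vanish.
--
-- If the series converges, its tails bound the cost of the covers by the balls about g/Xᴺ.
--
-- If it diverges, both measures equal lim φ(n).  The upper bound comes from the cylinders
-- of level n.  For the lower bound let φ be nondecreasing; we must find a point of W_𝒞(ψ)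
-- outside given balls of radius ≤ 3⁻ⁿ and total cost < φ(n).  Let G(σ) be 2ᵏ times the
-- cost that falls into the cylinder σ of level k, a supermartingale.  Starting from a
-- cylinder with G < φ, look for an extension inside the set of some later N that again
-- has G < φ, and iterate.  If there is none, let V_N ≤ φ(n) be the largest value of
-- φ(n) - G at level N; it is nondecreasing in N.  Let S_N be the average of V over the
-- place of the next digit 2 after N.  A run of zeros must meet a node with G ≥ φ, which
-- forces S_N - V_N to be at least a fixed multiple of 2ᴺ f(ψ(3ᴺ)), whereas
-- Σ (S_N - V_N) ≤ 2 φ(n) by telescoping: this contradicts the divergence.
-- If φ is nonincreasing, the same applies to (lim φ) r^γ ≤ f in place of f.
module Submission where

open import Algebra.Bundles using (CommutativeRing)
open import Algebra.Structures using (IsCommutativeRing)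
import Algebra.Solver.Ring
import Algebra.Solver.Ring.AlmostCommutativeRing as ACR
open import Axiom.ExcludedMiddle using (ExcludedMiddle)
open import Data.Bool using (Bool; true; false)
open import Data.Empty using (⊥; ⊥-elim)
import Data.Integer as ℤ
import Data.Integer.Properties as ℤ
open import Data.List using (List; []; _∷_; length)
open import Data.Maybe using (Maybe; just; nothing; maybe′)
open import Data.Nat as ℕ using (ℕ; zero; suc; z≤n; s≤s; _⊓_; _⊔_; _∸_; _!)
import Data.Nat.Properties as ℕ
open import Data.Product using (Σ-syntax; ∃-syntax; _×_; _,_; proj₁; proj₂)
open import Data.Rational as ℚ using (ℚ; 0ℚ; 1ℚ; ½)
import Data.Rational.Properties as ℚ
open import Data.Rational.Solver using () renaming (module +-*-Solver to ℚ-Solver)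
open import Data.Sum using (_⊎_; inj₁; inj₂)
open import Level using (0ℓ)
open import Relation.Binary.PropositionalEquality as ≡ using (_≡_; _≢_)
open import Relation.Nullary using (¬_; Dec; yes; no)

-- The obstacle is that a cover has balls of all sizes, so that no finite level sees the whole of
-- it; G charges all later balls at once, which lets the search look at one node at a time. The gain
-- 2ᴺ f(ψ(3ᴺ)) has the following origin. From a best node of level N, tossing a fair coin for every
-- digit gives zeros up to level j with probability 2^(N - j). If G ≥ φ at the node reached there,
-- its φ(n) - G is at most φ(n) - φ(j), where φ(j) = 2ʲ f(3⁻ʲ). Since φ(n) ≤ φ(j), this falls short
-- of v by at least (v / φ(n)) φ(j), where v > 0 is φ(n) - G at the node without a successor. Times
-- the probability, the shortfall is (v / φ(n)) 2ᴺ f(3⁻ʲ), and 3⁻ʲ ≥ ψ(3ᴺ). The 2 in the telescoping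
-- sum comes from 2 (S_N - V_N) = (S' - V') + 2 (V' - V_N), where S' and V' belong to level N + 1.
-- In the code the average is stopped at a finite level, and the estimate along the run of zeros is
-- multiplied by φ(n) to avoid division.

ℚ-<⇒≱ : ∀ {p q} → p ℚ.< q → ¬ (q ℚ.≤ p)
ℚ-<⇒≱ p q = ℚ.<-irrefl ≡.refl (ℚ.<-≤-trans p q)

p≤∣p∣ : ∀ p → p ℚ.≤ ℚ.∣ p ∣
p≤∣p∣ p with ℚ.≤-total 0ℚ p
... | inj₁ 0≤p = ℚ.≤-reflexive (≡.sym (ℚ.0≤p⇒∣p∣≡p 0≤p))
... | inj₂ p≤0 = ℚ.≤-trans p≤0 (ℚ.0≤∣p∣ p)

½-pos : ∀ {ε} → 0ℚ ℚ.< ε → 0ℚ ℚ.< ½ ℚ.* ε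
½-pos {ε} h = ≡.subst (ℚ._< ½ ℚ.* ε) (ℚ.*-zeroʳ ½) (ℚ.*-monoʳ-<-pos ½ h)

divide : ∀ b → 0ℚ ℚ.< b → ∀ ε → 0ℚ ℚ.< ε → ∃[ δ ] 0ℚ ℚ.< δ × δ ℚ.* b ≡ ε
divide b b>0 ε ε>0 = ε ℚ.* ℚ.1/ b
  , ≡.subst (ℚ._< ε ℚ.* ℚ.1/ b) (ℚ.*-zeroˡ (ℚ.1/ b)) (ℚ.*-monoˡ-<-pos (ℚ.1/ b) ε>0)
  , ≡.trans (ℚ.*-assoc ε (ℚ.1/ b) b)
      (≡.trans (≡.cong (ε ℚ.*_) (ℚ.*-inverseˡ b)) (ℚ.*-identityʳ ε))
  where
  instance
    b-pos : ℚ.Positive b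
    b-pos = ℚ.positive b>0
    b≢0 : ℚ.NonZero b
    b≢0 = ℚ.pos⇒nonZero b
    1/b>0 : ℚ.Positive (ℚ.1/ b)
    1/b>0 = ℚ.1/pos⇒pos b

Eventually : (ℕ → Set) → Set
Eventually P = ∃[ N ] (∀ n → N ℕ.≤ n → P n)

ev-map : {P Q : ℕ → Set} → (∀ n → P n → Q n) → Eventually P → Eventually Q
ev-map f (N , p) = N , λ n h → f n (p n h)

ev-map₂ : {P Q S : ℕ → Set} → (∀ n → P n → Q n → S n) →
  Eventually P → Eventually Q → Eventually S
ev-map₂ f (M , p) (N , q) = M ℕ.⊔ N , λ n h →
  f n (p n (ℕ.≤-trans (ℕ.m≤m⊔n M N) h)) (q n (ℕ.≤-trans (ℕ.m≤n⊔m M N) h))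

-- An opaque interface keeps the operations from unfolding: on Cauchy sequences `_≈_` and `_≤_`
-- reduce to ε-statements about `seq`, from which the arguments cannot be inferred. `bounded` and
-- `closed` express the Archimedean property and, with rational bounds, take the place of division.
record RealField : Set₁ where
  infix 4 _≈_ _≤_
  infixl 6 _+_
  infixl 7 _*_
  infix 8 -_
  field
    Carrier : Set
    _≈_ _≤_ : Carrier → Carrier → Set
    _+_ _*_ : Carrier → Carrier → Carrier
    -_      : Carrier → Carrier
    ι       : ℚ → Carrier
    isCommutativeRing : IsCommutativeRing _≈_ _+_ _*_ -_ (ι 0ℚ) (ι 1ℚ)
    ι-+ : ∀ p q → ι (p ℚ.+ q) ≈ ι p + ι q
    ι-* : ∀ p q → ι (p ℚ.* q) ≈ ι p * ι q
    ι-neg : ∀ p → ι (ℚ.- p) ≈ - ι p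
    ι-mono : ∀ {p q} → p ℚ.≤ q → ι p ≤ ι q
    ι-cancel : ∀ {p q} → ι p ≤ ι q → p ℚ.≤ q
    ≤-reflexive : ∀ {x y} → x ≈ y → x ≤ y
    ≤-trans : ∀ {x y z} → x ≤ y → y ≤ z → x ≤ z
    ≤-antisym : ∀ {x y} → x ≤ y → y ≤ x → x ≈ y
    ≤-total : ∀ x y → x ≤ y ⊎ y ≤ x
    +-mono-≤ : ∀ {x y z w} → x ≤ y → z ≤ w → x + z ≤ y + w
    *-nonNeg : ∀ {x y} → ι 0ℚ ≤ x → ι 0ℚ ≤ y → ι 0ℚ ≤ x * y
    bounded : ∀ x → ∃[ q ] x ≤ ι q
    closed : ∀ {x y} → (∀ ε → 0ℚ ℚ.< ε → x ≤ y + ι ε) → x ≤ y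

-- Order, powers and finite sums in an Archimedean field

module Field (R : RealField) (em : ExcludedMiddle 0ℓ) where
  open RealField R public
  commutativeRing : CommutativeRing 0ℓ 0ℓ
  commutativeRing = record { isCommutativeRing = isCommutativeRing }
  open CommutativeRing commutativeRing public
    using (refl; sym; trans; +-cong; *-cong; -‿cong; reflexive; setoid;
           +-assoc; +-comm; +-identityˡ; +-identityʳ; *-comm; *-assoc; *-identityˡ;
           *-identityʳ; zeroˡ; zeroʳ)

  infix 4 _<_
  infixl 6 _-_

  _-_ : Carrier → Carrier → Carrier
  x - y = x + (- y)

  _<_ : Carrier → Carrier → Set
  x < y = ¬ (y ≤ x)

  0# 1# 2# ½# : Carrier
  0# = ι 0ℚ
  1# = ι 1ℚ
  2# = 1# + 1#
  ½# = ι ½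

  private
    ι-≟ : ∀ p q → Maybe (ι p ≈ ι q)
    ι-≟ p q with p ℚ.≟ q
    ... | yes e = just (reflexive (≡.cong ι e))
    ... | no _  = nothing

    ι-morphism : CommutativeRing.rawRing ℚ.+-*-commutativeRing
      ACR.-Raw-AlmostCommutative⟶ ACR.fromCommutativeRing commutativeRing
    ι-morphism = record
      { ⟦_⟧ = ι ; +-homo = ι-+ ; *-homo = ι-* ; -‿homo = ι-neg ; 0-homo = refl ; 1-homo = refl }

  open Algebra.Solver.Ring
    (CommutativeRing.rawRing ℚ.+-*-commutativeRing)
    (ACR.fromCommutativeRing commutativeRing)
    ι-morphism
    ι-≟ public
    using (solve; con; _:+_; _:*_; _:-_; :-_; _:=_; Polynomial)

  ≤-refl : ∀ {x} → x ≤ x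
  ≤-refl = ≤-reflexive refl

  ≤-respʳ : ∀ {x y z} → y ≈ z → x ≤ y → x ≤ z
  ≤-respʳ e p = ≤-trans p (≤-reflexive e)

  ≤-respˡ : ∀ {x y z} → x ≈ y → x ≤ z → y ≤ z
  ≤-respˡ e p = ≤-trans (≤-reflexive (sym e)) p

  -- Linear inequalities are proved by adding up hypotheses to p ≤ q; what remains is
  -- an identity for the ring solver.
  ≤-by : ∀ {a b p q} → p ≤ q → q - p ≈ b - a → a ≤ b
  ≤-by {a} {b} {p} {q} p≤q e =
    ≤-respˡ (solve 2 (λ a p → p :+ (a :- p) := a) refl a p)
    (≤-respʳ (trans (solve 3 (λ a p q → q :+ (a :- p) := (q :- p) :+ a) refl a p q)
      (trans (+-cong e refl) (solve 2 (λ a b → (b :- a) :+ a := b) refl a b)))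
    (+-mono-≤ p≤q ≤-refl))

  ≤-byˡ : ∀ {a b d} → 0# ≤ d → d ≈ b - a → a ≤ b
  ≤-byˡ {d = d} h e = ≤-by h (trans (solve 1 (λ d → d :- con 0ℚ := d) refl d) e)

  diff-nonNeg : ∀ {a b} → a ≤ b → 0# ≤ b - a
  diff-nonNeg {a} {b} h = ≤-by h (solve 2 (λ a b → b :- a := (b :- a) :- con 0ℚ) refl a b)

  *-monoˡ-≤ : ∀ {c a b} → 0# ≤ c → a ≤ b → c * a ≤ c * b
  *-monoˡ-≤ {c} {a} {b} c≥0 h = ≤-byˡ (*-nonNeg c≥0 (diff-nonNeg h))
    (solve 3 (λ a b c → c :* (b :- a) := c :* b :- c :* a) refl a b c)

  *-mono-≤ : ∀ {a b c d} → 0# ≤ a → 0# ≤ c → a ≤ b → c ≤ d → a * c ≤ b * d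
  *-mono-≤ {a} {b} {c} {d} a≥0 c≥0 p q = ≤-trans (*-monoˡ-≤ a≥0 q)
    (≤-respˡ (*-comm d a) (≤-respʳ (*-comm d b) (*-monoˡ-≤ (≤-trans c≥0 q) p)))

  +-nonNeg : ∀ {x y} → 0# ≤ x → 0# ≤ y → 0# ≤ x + y
  +-nonNeg p q = ≤-respˡ (+-identityˡ 0#) (+-mono-≤ p q)

  neg-mono-≤ : ∀ {x y} → x ≤ y → - y ≤ - x
  neg-mono-≤ {x} {y} h = ≤-by h (solve 2 (λ x y → y :- x := :- x :- :- y) refl x y)

  x≤x+y : ∀ {x y} → 0# ≤ y → x ≤ x + y
  x≤x+y {x} {y} h = ≤-byˡ h (solve 2 (λ x y → y := (x :+ y) :- x) refl x y)

  y≤x+y : ∀ {x y} → 0# ≤ x → y ≤ x + y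
  y≤x+y {x} {y} h = ≤-byˡ h (solve 2 (λ x y → x := (x :+ y) :- y) refl x y)

  ≤-dec : ∀ x y → Dec (x ≤ y)
  ≤-dec x y = em

  ≮⇒≥ : ∀ {x y} → ¬ (x < y) → y ≤ x
  ≮⇒≥ {x} {y} h with ≤-dec y x
  ... | yes p = p
  ... | no ¬p = ⊥-elim (h ¬p)

  <⇒≤ : ∀ {x y} → x < y → x ≤ y
  <⇒≤ {x} {y} h with ≤-total x y
  ... | inj₁ p = p
  ... | inj₂ p = ⊥-elim (h p)

  <-≤-trans : ∀ {x y z} → x < y → y ≤ z → x < z
  <-≤-trans h p q = h (≤-trans p q)

  ≤-<-trans : ∀ {x y z} → x ≤ y → y < z → x < z
  ≤-<-trans p h q = h (≤-trans q p)

  0≤1 : 0# ≤ 1#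
  0≤1 = ι-mono (ℚ.nonNegative⁻¹ 1ℚ)

  0≤½ : 0# ≤ ½#
  0≤½ = ι-mono (ℚ.nonNegative⁻¹ ½)

  0≤2 : 0# ≤ 2#
  0≤2 = +-nonNeg 0≤1 0≤1

  -- If no positive rational lay below x, totality would put x below every positive rational, and
  -- `closed` would give x ≤ 0. The rational witness can be inverted in ℚ.
  positive-bound : ∀ {x} → 0# < x → ∃[ q ] 0ℚ ℚ.< q × ι q ≤ x
  positive-bound {x} h with em {∃[ q ] 0ℚ ℚ.< q × ι q ≤ x}
  ... | yes p = p
  ... | no ¬p = ⊥-elim (h (closed λ ε ε>0 → <⇒≤ λ g →
    ¬p (ε , ε>0 , ≤-trans (≤-reflexive (sym (+-identityˡ (ι ε)))) g)))

  -- The interface gives nonnegative products only; strictness comes from rational lower bounds of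
  -- both factors, whose product is compared in ℚ.
  *-pos : ∀ {x y} → 0# < x → 0# < y → 0# < x * y
  *-pos {x} {y} p q h with positive-bound p | positive-bound q
  ... | a , a>0 , a≤x | b , b>0 , b≤y = ℚ-<⇒≱ ab>0 (ι-cancel (≤-trans
      (≤-respˡ (sym (ι-* a b)) (*-mono-≤ (ι-mono (ℚ.<⇒≤ a>0)) (ι-mono (ℚ.<⇒≤ b>0)) a≤x b≤y)) h))
    where
    ab>0 : 0ℚ ℚ.< a ℚ.* b
    ab>0 = ≡.subst (ℚ._< a ℚ.* b) (ℚ.*-zeroˡ b)
      (ℚ.*-monoˡ-<-pos b {{ℚ.positive b>0}} a>0)

  *-cancel-≤ : ∀ {c x y} → 0# < c → c * x ≤ c * y → x ≤ y
  *-cancel-≤ {c} {x} {y} c>0 h = ≮⇒≥ λ y<x → *-pos c>0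
      (λ g → y<x (≤-by g (solve 2 (λ x y → con 0ℚ :- (x :- y) := y :- x) refl x y)))
      (≤-by h (solve 3 (λ c x y → c :* y :- c :* x := con 0ℚ :- c :* (x :- y)) refl c x y))

  *-cancel : ∀ {c x y} → 0# < c → c * x ≈ c * y → x ≈ y
  *-cancel c>0 e = ≤-antisym (*-cancel-≤ c>0 (≤-reflexive e)) (*-cancel-≤ c>0 (≤-reflexive (sym e)))

  ι-pos : ∀ {q} → 0ℚ ℚ.< q → 0# < ι q
  ι-pos q>0 h = ℚ-<⇒≱ q>0 (ι-cancel h)

  infixr 8 _^_
  _^_ : Carrier → ℕ → Carrier
  x ^ zero  = 1#
  x ^ suc n = x * x ^ n

  ^-nonNeg : ∀ {x} → 0# ≤ x → ∀ n → 0# ≤ x ^ n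
  ^-nonNeg h zero = 0≤1
  ^-nonNeg h (suc n) = *-nonNeg h (^-nonNeg h n)

  ^-pos : ∀ {x} → 0# < x → ∀ n → 0# < x ^ n
  ^-pos h zero    = ι-pos (ℚ.positive⁻¹ 1ℚ)
  ^-pos h (suc n) = *-pos h (^-pos h n)

  2^-pos : ∀ n → 0# < 2# ^ n
  2^-pos = ^-pos λ h → ι-pos (ℚ.positive⁻¹ 1ℚ) (≤-trans (x≤x+y 0≤1) h)

  2^-nonNeg : ∀ n → 0# ≤ 2# ^ n
  2^-nonNeg n = <⇒≤ (2^-pos n)

  ascending : ∀ {a : ℕ → Carrier} → (∀ n → a n ≤ a (suc n)) → ∀ {m n} → m ℕ.≤ n → a m ≤ a n
  ascending {a} step {m} m≤n = go (ℕ.≤⇒≤′ m≤n)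
    where
    go : ∀ {n} → m ℕ.≤′ n → a m ≤ a n
    go (ℕ.≤′-reflexive ≡.refl) = ≤-refl
    go (ℕ.≤′-step p)           = ≤-trans (go p) (step _)

  descending : ∀ {a : ℕ → Carrier} → (∀ n → a (suc n) ≤ a n) → ∀ {m n} → m ℕ.≤ n → a n ≤ a m
  descending {a} step {m} m≤n = go (ℕ.≤⇒≤′ m≤n)
    where
    go : ∀ {n} → m ℕ.≤′ n → a n ≤ a m
    go (ℕ.≤′-reflexive ≡.refl) = ≤-refl
    go (ℕ.≤′-step p)           = ≤-trans (step _) (go p)

  2^-≤ : ∀ {m n} → m ℕ.≤ n → 2# ^ m ≤ 2# ^ n
  2^-≤ = ascending λ n → ≤-byˡ (2^-nonNeg n)
    (solve 1 (λ x → x := (con 1ℚ :+ con 1ℚ) :* x :- x) refl (2# ^ n))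

  ∑ : ℕ → (ℕ → Carrier) → Carrier
  ∑ zero    a = 0#
  ∑ (suc n) a = ∑ n a + a n

  ∑-cong : ∀ n {a b} → (∀ i → i ℕ.< n → a i ≈ b i) → ∑ n a ≈ ∑ n b
  ∑-cong zero e = refl
  ∑-cong (suc n) e =
    +-cong (∑-cong n (λ i i<n → e i (ℕ.m<n⇒m<1+n i<n))) (e n (ℕ.n<1+n n))

  ∑-mono : ∀ n {a b} → (∀ i → i ℕ.< n → a i ≤ b i) → ∑ n a ≤ ∑ n b
  ∑-mono zero e = ≤-refl
  ∑-mono (suc n) e =
    +-mono-≤ (∑-mono n (λ i i<n → e i (ℕ.m<n⇒m<1+n i<n))) (e n (ℕ.n<1+n n))

  ∑-nonNeg : ∀ n {a} → (∀ i → i ℕ.< n → 0# ≤ a i) → 0# ≤ ∑ n a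
  ∑-nonNeg zero e = ≤-refl
  ∑-nonNeg (suc n) e =
    +-nonNeg (∑-nonNeg n (λ i i<n → e i (ℕ.m<n⇒m<1+n i<n))) (e n (ℕ.n<1+n n))

  ∑-+ : ∀ n a b → ∑ n (λ i → a i + b i) ≈ ∑ n a + ∑ n b
  ∑-+ zero a b = sym (+-identityˡ 0#)
  ∑-+ (suc n) a b = trans (+-cong (∑-+ n a b) refl)
    (solve 4 (λ s t x y → (s :+ t) :+ (x :+ y) := (s :+ x) :+ (t :+ y)) refl
      (∑ n a) (∑ n b) (a n) (b n))

  ∑-*ˡ : ∀ n c a → ∑ n (λ i → c * a i) ≈ c * ∑ n a
  ∑-*ˡ zero c a = sym (zeroʳ c)
  ∑-*ˡ (suc n) c a = trans (+-cong (∑-*ˡ n c a) refl)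
    (solve 3 (λ c s x → c :* s :+ c :* x := c :* (s :+ x)) refl c (∑ n a) (a n))

  ∑-split : ∀ m n a → ∑ (m ℕ.+ n) a ≈ ∑ m a + ∑ n (λ i → a (m ℕ.+ i))
  ∑-split m zero a = trans (reflexive (≡.cong (λ k → ∑ k a) (ℕ.+-identityʳ m))) (sym (+-identityʳ (∑ m a)))
  ∑-split m (suc n) a = trans (reflexive (≡.cong (λ k → ∑ k a) (ℕ.+-suc m n)))
    (trans (+-cong (∑-split m n a) refl)
      (+-assoc (∑ m a) (∑ n (λ i → a (m ℕ.+ i))) (a (m ℕ.+ n))))

  ∑-extend : ∀ {m n} → m ℕ.≤ n → ∀ {a} → (∀ i → 0# ≤ a i) → ∑ m a ≤ ∑ n a
  ∑-extend {m} {n} m≤n {a} a≥0 = ≤-respʳ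
    (trans (sym (∑-split m (n ℕ.∸ m) a)) (reflexive (≡.cong (λ k → ∑ k a) (ℕ.m+[n∸m]≡n m≤n))))
    (x≤x+y (∑-nonNeg (n ℕ.∸ m) (λ i _ → a≥0 (m ℕ.+ i))))

  -- A substitute for the quotient c / v: a rational above c is divided by a positive rational below
  -- v. Adding 1 to ∣ p ∣ makes the inequality strict.
  unbounded : ∀ {v} → 0# < v → ∀ c → ∃[ b ] c < v * b
  unbounded {v} v>0 c with positive-bound v>0 | bounded c
  ... | q , q>0 , q≤v | p , c≤p with divide q q>0 (ℚ.∣ p ∣ ℚ.+ 1ℚ) (ℚ.+-mono-≤-< (ℚ.0≤∣p∣ p) (ℚ.positive⁻¹ 1ℚ))
  ... | b , b>0 , bq≡ = ι b , ≤-<-trans c≤p (<-≤-trans p<qb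
      (≤-respʳ (*-comm (ι b) v) (*-monoˡ-≤ (ι-mono (ℚ.<⇒≤ b>0)) q≤v)))
    where
    p<∣p∣+1 : p ℚ.< ℚ.∣ p ∣ ℚ.+ 1ℚ
    p<∣p∣+1 = ℚ.≤-<-trans (p≤∣p∣ p) (≡.subst (ℚ._< ℚ.∣ p ∣ ℚ.+ 1ℚ) (ℚ.+-identityʳ ℚ.∣ p ∣)
      (ℚ.+-monoʳ-< ℚ.∣ p ∣ (ℚ.positive⁻¹ 1ℚ)))
    p<qb : ι p < ι b * ι q
    p<qb h = ℚ-<⇒≱ p<∣p∣+1 (≡.subst (ℚ._≤ p) bq≡ (ι-cancel (≤-trans (≤-reflexive (ι-* b q)) h)))

  ∑-head : ∀ n a → ∑ (suc n) a ≈ a 0 + ∑ n (λ i → a (suc i))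
  ∑-head n a = trans (∑-split 1 n a) (+-cong (+-identityˡ (a 0)) refl)

  infix 4 ∣_∣≤_
  ∣_∣≤_ : Carrier → Carrier → Set
  ∣ x ∣≤ b = x ≤ b × - x ≤ b

  infix 4 _⟶_
  _⟶_ : (ℕ → Carrier) → Carrier → Set
  x ⟶ l = ∀ ε → 0ℚ ℚ.< ε → Eventually λ n → ∣ x n - l ∣≤ ι ε

  -- Suprema of sequences suffice: G is a supremum of partial sums, and lim φ is a supremum or an
  -- infimum over ℕ.
  Complete : Set
  Complete = ∀ (x : ℕ → Carrier) b → (∀ n → x n ≤ b) →
    ∃[ s ] (∀ n → x n ≤ s) × (∀ c → (∀ n → x n ≤ c) → s ≤ c)

-- Enumeration of binary words, and sums over them

module Words where

  -- Bijective base 2, least significant digit first, lists the words by length.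
  increment : List Bool → List Bool
  increment []          = false ∷ []
  increment (false ∷ w) = true ∷ w
  increment (true ∷ w)  = false ∷ increment w

  word : ℕ → List Bool
  word zero    = []
  word (suc n) = increment (word n)

  word-odd : ∀ n → word (suc (n ℕ.+ n)) ≡ false ∷ word n
  word-odd zero = ≡.refl
  word-odd (suc n) = ≡.trans (≡.cong (λ m → increment (increment (word m))) (ℕ.+-suc n n))
    (≡.cong (λ w → increment (increment w)) (word-odd n))

  word-even : ∀ n → word (suc (suc (n ℕ.+ n))) ≡ true ∷ word n
  word-even n = ≡.cong increment (word-odd n)

  word-surjective : ∀ w → ∃[ n ] word n ≡ w
  word-surjective [] = 0 , ≡.refl
  word-surjective (false ∷ w) = let n , e = word-surjective w in
    suc (n ℕ.+ n) , ≡.trans (word-odd n) (≡.cong (false ∷_) e)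
  word-surjective (true ∷ w) = let n , e = word-surjective w in
    suc (suc (n ℕ.+ n)) , ≡.trans (word-even n) (≡.cong (true ∷_) e)

  -- 2ᵏ - 1, the number of words with fewer than k letters; these are the first ones in the list.
  shorter : ℕ → ℕ
  shorter zero    = 0
  shorter (suc k) = suc (shorter k ℕ.+ shorter k)

  k≤shorter : ∀ k → k ℕ.≤ shorter k
  k≤shorter zero = z≤n
  k≤shorter (suc k) = s≤s (ℕ.≤-trans (k≤shorter k) (ℕ.m≤m+n (shorter k) (shorter k)))

  module _ (R : RealField) (em : ExcludedMiddle 0ℓ) where
    open Field R em

    -- After the empty word the list runs through the pairs `false ∷ word i`, `true ∷ word i`, so
    -- each of the first n words yields two words that are one letter longer.
    ∑-double : ∀ n (a : ℕ → Carrier) → ∑ (suc (n ℕ.+ n)) (λ i → a (length (word i))) ≈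
      a 0 + 2# * ∑ n (λ i → a (suc (length (word i))))
    ∑-double zero a = solve 1 (λ x → con 0ℚ :+ x := x :+ (con 1ℚ :+ con 1ℚ) :* con 0ℚ) refl (a 0)
    ∑-double (suc n) a = trans (reflexive (≡.cong (λ m → ∑ (suc (suc m)) b) (ℕ.+-suc n n)))
        (trans (+-cong (+-cong (∑-double n a)
            (reflexive (≡.cong (λ w → a (length w)) (word-odd n))))
            (reflexive (≡.cong (λ w → a (length w)) (word-even n))))
          (solve 3 (λ x s y → ((x :+ (con 1ℚ :+ con 1ℚ) :* s) :+ y) :+ y := x :+ (con 1ℚ :+ con 1ℚ) :* (s :+ y)) refl
            (a 0) (∑ n (λ i → a (suc (length (word i))))) (a (suc (length (word n))))))
      where
      b : ℕ → Carrier
      b i = a (length (word i))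

    ∑-words : ∀ k (a : ℕ → Carrier) →
      ∑ (shorter k) (λ i → a (length (word i))) ≈ ∑ k (λ n → 2# ^ n * a n)
    ∑-words zero a = refl
    ∑-words (suc k) a = trans (∑-double (shorter k) a) (trans
      (+-cong (sym (*-identityˡ (a 0))) (trans (*-cong refl (∑-words k (λ n → a (suc n))))
        (trans (sym (∑-*ˡ k 2# (λ n → 2# ^ n * a (suc n)))) (∑-cong k (λ n _ → sym (*-assoc 2# (2# ^ n) (a (suc n))))))))
      (sym (∑-head k (λ n → 2# ^ n * a n))))

    -- Partial sums of nonnegative terms increase, so for n ≥ `shorter N` the sum over the first n
    -- words lies between the sums grouped by length up to N and up to n.
    ∑-words-limit : ∀ (a : ℕ → Carrier) {s} → (∀ n → 0# ≤ a n) →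
      (λ k → ∑ k (λ n → 2# ^ n * a n)) ⟶ s → (λ k → ∑ k (λ i → a (length (word i)))) ⟶ s
    ∑-words-limit a {s} a≥0 lim ε ε>0 =
      let N , h = lim ε ε>0
      in N ⊔ shorter N , λ n le →
        let N≤n = ℕ.≤-trans (ℕ.m≤m⊔n N (shorter N)) le
            S≤n = ℕ.≤-trans (ℕ.m≤n⊔m N (shorter N)) le
        in ≤-trans (+-mono-≤ (≤-respʳ (∑-words n a) (∑-extend (k≤shorter n) (λ i → a≥0 (length (word i))))) ≤-refl)
             (proj₁ (h n N≤n))
         , ≤-trans (neg-mono-≤ (+-mono-≤ (≤-respˡ (∑-words N a) (∑-extend S≤n (λ i → a≥0 (length (word i))))) ≤-refl))
             (proj₂ (h N ℕ.≤-refl))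

-- The search for a path that avoids a given cover

module Avoidance (R : RealField) (em : ExcludedMiddle 0ℓ)
                 (complete : Field.Complete R em) where
  open Field R em

  Path : Set
  Path = ℕ → Bool

  infix 4 _≗[_]_
  _≗[_]_ : Path → ℕ → Path → Set
  σ ≗[ n ] τ = ∀ j → j ℕ.< n → σ j ≡ τ j

  ≗-sym : ∀ {σ τ n} → σ ≗[ n ] τ → τ ≗[ n ] σ
  ≗-sym e j j<n = ≡.sym (e j j<n)

  ≗-trans : ∀ {σ τ ρ n} → σ ≗[ n ] τ → τ ≗[ n ] ρ → σ ≗[ n ] ρ
  ≗-trans d e j j<n = ≡.trans (d j j<n) (e j j<n)

  ≗-≤ : ∀ {σ τ m n} → m ℕ.≤ n → σ ≗[ n ] τ → σ ≗[ m ] τ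
  ≗-≤ m≤n e j j<m = e j (ℕ.<-≤-trans j<m m≤n)

  select : {P A : Set} → Dec P → A → A → A
  select (yes _) x y = x
  select (no _)  x y = y

  select-yes : {P A : Set} (d : Dec P) {x y : A} → P → select d x y ≡ x
  select-yes (yes _) p = ≡.refl
  select-yes (no ¬p) p = ⊥-elim (¬p p)

  select-no : {P A : Set} (d : Dec P) {x y : A} → ¬ P → select d x y ≡ y
  select-no (yes p) ¬p = ⊥-elim (¬p p)
  select-no (no _)  ¬p = ≡.refl

  _[_≔_] : Path → ℕ → Bool → Path
  (σ [ n ≔ b ]) j = select (j ℕ.≟ n) b (σ j)

  ≔-same : ∀ σ n b → (σ [ n ≔ b ]) n ≡ b
  ≔-same σ n b = select-yes (n ℕ.≟ n) ≡.refl

  ≔-below : ∀ σ n b → (σ [ n ≔ b ]) ≗[ n ] σ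
  ≔-below σ n b j j<n = select-no (j ℕ.≟ n) (ℕ.<⇒≢ j<n)

  ≔-suc : ∀ {σ τ n} → τ ≗[ n ] σ → τ ≗[ suc n ] (σ [ n ≔ τ n ])
  ≔-suc {σ} {τ} {n} e j j<1+n = go (j ℕ.≟ n)
    where
    go : Dec (j ≡ n) → τ j ≡ (σ [ n ≔ τ n ]) j
    go (yes ≡.refl) = ≡.sym (≔-same σ n (τ n))
    go (no j≢n) = ≡.trans (e j j<n) (≡.sym (≔-below σ n (τ n) j j<n))
      where j<n = ℕ.≤∧≢⇒< (ℕ.≤-pred j<1+n) j≢n

  cut : ℕ → Path → Path
  cut n σ j = select (j ℕ.<? n) (σ j) false

  cut-below : ∀ n σ → cut n σ ≗[ n ] σ
  cut-below n σ j j<n = select-yes (j ℕ.<? n) j<n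

  cut-above : ∀ n σ j → n ℕ.≤ j → cut n σ j ≡ false
  cut-above n σ j n≤j = select-no (j ℕ.<? n) (λ p → ℕ.<⇒≱ p n≤j)

  finite-bound : ∀ k (q : ℕ → ℕ) → ∃[ h ] (∀ i → i ℕ.< k → q i ℕ.≤ h)
  finite-bound zero q = 0 , λ _ ()
  finite-bound (suc k) q with finite-bound k q
  ... | h , p = h ⊔ q k , bound
    where
    bound : ∀ i → i ℕ.< suc k → q i ℕ.≤ h ⊔ q k
    bound i i<1+k with i ℕ.≟ k
    ... | yes ≡.refl = ℕ.m≤n⊔m h (q k)
    ... | no i≢k = ℕ.≤-trans (p i (ℕ.≤∧≢⇒< (ℕ.≤-pred i<1+k) i≢k)) (ℕ.m≤m⊔n h (q k))

  -- Balls enter only through their digits: `Active i` means that the i-th member exists, `size i`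
  -- counts the digits it fixes, and `Fits i j b` says that it allows b at place j. Divergence is
  -- assumed only when r N > N for all N > n: otherwise a successor is immediate, and a depth cut
  -- off at 0 would not determine the term of the series.
  module Uncovered
    (F : ℕ → Carrier) (F-nonNeg : ∀ n → 0# ≤ F n) (F-anti : ∀ n → F (suc n) ≤ F n)
    (φ-mono : ∀ n → 2# ^ n * F n ≤ 2# ^ suc n * F (suc n))
    (r : ℕ → ℕ)
    (diverges : ∀ n → (∀ N → n ℕ.< N → N ℕ.< r N) → ∀ b →
      ∃[ k ] b ≤ ∑ k (λ i → 2# ^ suc (i ℕ.+ n) * F (r (suc (i ℕ.+ n)))))
    (Active : ℕ → Set) (size : ℕ → ℕ) (Fits : ℕ → ℕ → Bool → Set)
    (fits-unique : ∀ i j → Fits i j true → Fits i j false → ⊥)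
    (cost : ℕ → Carrier) (cost-nonNeg : ∀ i → 0# ≤ cost i)
    (F≤cost : ∀ i → Active i → F (size i) ≤ cost i)
    (total : Carrier) (cost-bound : ∀ k → ∑ k cost ≤ total)
    where

    φ : ℕ → Carrier
    φ n = 2# ^ n * F n

    φ-≤ : ∀ {m n} → m ℕ.≤ n → φ m ≤ φ n
    φ-≤ = ascending φ-mono

    F-≤ : ∀ {m n} → m ℕ.≤ n → F n ≤ F m
    F-≤ = descending F-anti

    Agree : ℕ → ℕ → Path → Set
    Agree i n σ = Active i × (∀ j → j ℕ.< n → Fits i j (σ j))

    agree-cong : ∀ {i n σ τ} → σ ≗[ n ] τ → Agree i n σ → Agree i n τ
    agree-cong {i} e (a , f) = a , λ j j<n → ≡.subst (Fits i j) (e j j<n) (f j j<n)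

    agree-≤ : ∀ {i m n σ} → m ℕ.≤ n → Agree i n σ → Agree i m σ
    agree-≤ m≤n (a , f) = a , λ j j<m → f j (ℕ.<-≤-trans j<m m≤n)

    -- Write m for `size i`. If n ≤ m, the ball lies inside the cylinder and counts with 2ⁿ F(m). If
    -- n ≥ m, it contains the cylinder, whose share of it is 2^(m - n), and 2ⁿ times that share of
    -- F(m) is 2ᵐ F(m).
    load : ℕ → ℕ → Path → Carrier
    load i n σ = select (em {Agree i (n ⊓ size i) σ}) (2# ^ (n ⊓ size i) * F (size i)) 0#

    private
      weight-nonNeg : ∀ n m → 0# ≤ 2# ^ n * F m
      weight-nonNeg n m = *-nonNeg (2^-nonNeg n) (F-nonNeg m)

    load-nonNeg : ∀ i n σ → 0# ≤ load i n σ
    load-nonNeg i n σ with em {Agree i (n ⊓ size i) σ}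
    ... | yes _ = weight-nonNeg (n ⊓ size i) (size i)
    ... | no _  = ≤-refl

    load≤weight : ∀ i n σ → load i n σ ≤ 2# ^ (n ⊓ size i) * F (size i)
    load≤weight i n σ with em {Agree i (n ⊓ size i) σ}
    ... | yes _ = ≤-refl
    ... | no _  = weight-nonNeg (n ⊓ size i) (size i)

    weight≤load : ∀ {i n σ} → Agree i (n ⊓ size i) σ → 2# ^ (n ⊓ size i) * F (size i) ≤ load i n σ
    weight≤load {i} {n} {σ} a with em {Agree i (n ⊓ size i) σ}
    ... | yes _ = ≤-refl
    ... | no ¬a = ⊥-elim (¬a a)

    load-zero : ∀ {i n σ} → ¬ Agree i (n ⊓ size i) σ → load i n σ ≤ 0#
    load-zero {i} {n} {σ} ¬a with em {Agree i (n ⊓ size i) σ}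
    ... | yes a = ⊥-elim (¬a a)
    ... | no _  = ≤-refl

    load-cong : ∀ {i n σ τ} → σ ≗[ n ] τ → load i n σ ≤ load i n τ
    load-cong {i} {n} {σ} {τ} e = case em
      where
      case : Dec (Agree i (n ⊓ size i) σ) → load i n σ ≤ load i n τ
      case (yes a) = ≤-trans (load≤weight i n σ)
        (weight≤load (agree-cong (≗-≤ (ℕ.m⊓n≤m n (size i)) e) a))
      case (no ¬a) = ≤-trans (load-zero ¬a) (load-nonNeg i n τ)

    load≤cost : ∀ i n σ → load i n σ ≤ 2# ^ n * cost i
    load≤cost i n σ with em {Agree i (n ⊓ size i) σ}
    ... | yes (a , _) = *-mono-≤ (2^-nonNeg (n ⊓ size i)) (F-nonNeg (size i))
                          (2^-≤ (ℕ.m⊓n≤m n (size i))) (F≤cost i a)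
    ... | no _ = *-nonNeg (2^-nonNeg n) (cost-nonNeg i)

    φ≤load : ∀ {i n σ} → size i ℕ.≤ n → Agree i (size i) σ → φ (size i) ≤ load i n σ
    φ≤load {i} {n} {σ} p a = ≡.subst (λ k → 2# ^ k * F (size i) ≤ load i n σ) (ℕ.m≥n⇒m⊓n≡n p)
      (weight≤load (≡.subst (λ k → Agree i k σ) (≡.sym (ℕ.m≥n⇒m⊓n≡n p)) a))

    private
      double : ∀ x → x + x ≈ 2# * x
      double = solve 1 (λ x → x :+ x := (con 1ℚ :+ con 1ℚ) :* x) refl

    -- From the size of the ball on, each child carries at most the load of the parent. Before it,
    -- the ball fixes the next digit, so by `fits-unique` at most one child agrees, and its load is
    -- at most doubled.
    load-split : ∀ i n σ →
      load i (suc n) (σ [ n ≔ true ]) + load i (suc n) (σ [ n ≔ false ]) ≤ 2# * load i n σ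
    load-split i n σ with size i ℕ.≤? n
    ... | yes m≤n = ≤-respʳ (double (load i n σ)) (+-mono-≤ (below true) (below false))
      where
      e₁ : suc n ⊓ size i ≡ size i
      e₁ = ℕ.m≥n⇒m⊓n≡n (ℕ.m≤n⇒m≤1+n m≤n)
      e₀ : n ⊓ size i ≡ size i
      e₀ = ℕ.m≥n⇒m⊓n≡n m≤n
      below : ∀ b → load i (suc n) (σ [ n ≔ b ]) ≤ load i n σ
      below b = case em
        where
        case : Dec (Agree i (suc n ⊓ size i) (σ [ n ≔ b ])) → load i (suc n) (σ [ n ≔ b ]) ≤ load i n σ
        case (no ¬a) = ≤-trans (load-zero ¬a) (load-nonNeg i n σ)
        case (yes a) = ≤-trans (load≤weight i (suc n) (σ [ n ≔ b ]))
          (≡.subst (λ k → 2# ^ k * F (size i) ≤ load i n σ) (≡.trans e₀ (≡.sym e₁))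
            (weight≤load (agree-cong (≗-≤ (ℕ.m⊓n≤m n (size i)) (≔-below σ n b))
              (≡.subst (λ k → Agree i k (σ [ n ≔ b ])) (≡.trans e₁ (≡.sym e₀)) a))))
    ... | no m≰n = case em em
      where
      n<m : n ℕ.< size i
      n<m = ℕ.≰⇒> m≰n
      e₁ : suc n ⊓ size i ≡ suc n
      e₁ = ℕ.m≤n⇒m⊓n≡m n<m
      e₀ : n ⊓ size i ≡ n
      e₀ = ℕ.m≤n⇒m⊓n≡m (ℕ.<⇒≤ n<m)
      A : Bool → Set
      A b = Agree i (suc n ⊓ size i) (σ [ n ≔ b ])
      fits : ∀ b → A b → Fits i n b
      fits b a = ≡.subst (Fits i n) (≔-same σ n b)
        (proj₂ (≡.subst (λ k → Agree i k (σ [ n ≔ b ])) e₁ a) n (ℕ.n<1+n n))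
      up : ∀ b → A b → load i (suc n) (σ [ n ≔ b ]) ≤ 2# * load i n σ
      up b a = ≤-trans (load≤weight i (suc n) (σ [ n ≔ b ]))
        (≡.subst (λ k → 2# ^ k * F (size i) ≤ 2# * load i n σ) (≡.sym e₁)
          (≤-respˡ (sym (*-assoc 2# (2# ^ n) (F (size i))))
            (*-monoˡ-≤ 0≤2 (≡.subst (λ k → 2# ^ k * F (size i) ≤ load i n σ) e₀
              (weight≤load (≡.subst (λ k → Agree i k σ) (≡.sym e₀)
                (agree-cong (≔-below σ n b) (agree-≤ (ℕ.n≤1+n n)
                  (≡.subst (λ k → Agree i k (σ [ n ≔ b ])) e₁ a)))))))))
      case : Dec (A true) → Dec (A false) →
        load i (suc n) (σ [ n ≔ true ]) + load i (suc n) (σ [ n ≔ false ]) ≤ 2# * load i n σ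
      case (yes a) (yes b) = ⊥-elim (fits-unique i n (fits true a) (fits false b))
      case (yes a) (no ¬b) = ≤-respʳ (+-identityʳ _) (+-mono-≤ (up true a) (load-zero ¬b))
      case (no ¬a) (yes b) = ≤-respʳ (+-identityˡ _) (+-mono-≤ (load-zero ¬a) (up false b))
      case (no ¬a) (no ¬b) = ≤-trans (≤-respʳ (+-identityˡ 0#) (+-mono-≤ (load-zero ¬a) (load-zero ¬b)))
        (*-nonNeg 0≤2 (load-nonNeg i n σ))

    -- Twice to the level times the total cost of the balls meeting the cylinder
    -- of σ at level n, a ball that contains the cylinder counting in proportion.
    abstract
     private
      G-sup : ∀ n σ → ∃[ s ] (∀ k → ∑ k (λ i → load i n σ) ≤ s) ×
                             (∀ c → (∀ k → ∑ k (λ i → load i n σ) ≤ c) → s ≤ c)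
      G-sup n σ = complete (λ k → ∑ k (λ i → load i n σ)) (2# ^ n * total) λ k →
        ≤-trans (∑-mono k (λ i _ → load≤cost i n σ))
          (≤-respˡ (sym (∑-*ˡ k (2# ^ n) cost)) (*-monoˡ-≤ (2^-nonNeg n) (cost-bound k)))

     G : ℕ → Path → Carrier
     G n σ = proj₁ (G-sup n σ)

     G-upper : ∀ n σ k → ∑ k (λ i → load i n σ) ≤ G n σ
     G-upper n σ = proj₁ (proj₂ (G-sup n σ))

     G-least : ∀ n σ {c} → (∀ k → ∑ k (λ i → load i n σ) ≤ c) → G n σ ≤ c
     G-least n σ = proj₂ (proj₂ (G-sup n σ)) _

    G-nonNeg : ∀ n σ → 0# ≤ G n σ
    G-nonNeg n σ = G-upper n σ 0

    load≤G : ∀ i n σ → load i n σ ≤ G n σ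
    load≤G i n σ = ≤-trans (y≤x+y (∑-nonNeg i (λ j _ → load-nonNeg j n σ))) (G-upper n σ (suc i))

    G-cong : ∀ {n σ τ} → σ ≗[ n ] τ → G n σ ≤ G n τ
    G-cong {n} {σ} {τ} e = G-least n σ λ k →
      ≤-trans (∑-mono k (λ i _ → load-cong e)) (G-upper n τ k)

    -- The two suprema are taken one after the other: partial sums are compared at the common length
    -- `k ⊔ l`, and `move` exchanges the sides so that `G-least` applies a second time.
    G-split : ∀ n σ → G (suc n) (σ [ n ≔ true ]) + G (suc n) (σ [ n ≔ false ]) ≤ 2# * G n σ
    G-split n σ = move' (G-least (suc n) _ λ k → move k (G-least (suc n) _ λ l → partial k l))
      where
      S₁ S₀ : ℕ → Carrier
      S₁ k = ∑ k (λ i → load i (suc n) (σ [ n ≔ true ]))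
      S₀ k = ∑ k (λ i → load i (suc n) (σ [ n ≔ false ]))
      c : Carrier
      c = 2# * G n σ
      partial : ∀ k l → S₀ l ≤ c - S₁ k
      partial k l = ≤-by
        (≤-trans (+-mono-≤ (∑-extend (ℕ.m≤m⊔n k l) (λ i → load-nonNeg i (suc n) (σ [ n ≔ true ])))
                           (∑-extend (ℕ.m≤n⊔m k l) (λ i → load-nonNeg i (suc n) (σ [ n ≔ false ]))))
          (≤-respˡ (∑-+ (k ⊔ l) _ _) (≤-trans (∑-mono (k ⊔ l) (λ i _ → load-split i n σ))
            (≤-respˡ (sym (∑-*ˡ (k ⊔ l) 2# (λ i → load i n σ)))
              (*-monoˡ-≤ 0≤2 (G-upper n σ (k ⊔ l)))))))
        (solve 3 (λ c x y → c :- (x :+ y) := (c :- x) :- y) refl c (S₁ k) (S₀ l))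
      move : ∀ k {x} → x ≤ c - S₁ k → S₁ k ≤ c - x
      move k {x} h = ≤-by h (solve 3 (λ c x y → (c :- x) :- y := (c :- y) :- x) refl c (S₁ k) x)
      move' : ∀ {x y} → x ≤ c - y → x + y ≤ c
      move' {x} {y} h = ≤-by h (solve 3 (λ c x y → (c :- y) :- x := c :- (x :+ y)) refl c x y)

    -- The second clause does not follow from the first: a ball of small size contributes only φ at
    -- its size to G, which may be far below φ n although the ball contains the whole cylinder.
    Open : ℕ → Path → Set
    Open n σ = G n σ < φ n × (∀ i → size i ℕ.≤ n → ¬ Agree i (size i) σ)

    -- (n', σ') is an extension of (n, σ) inside the set of some N > n.
    Successor : ℕ → Path → Set
    Successor n σ = ∃[ N ] ∃[ n' ] Σ[ σ' ∈ Path ]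
      n ℕ.< N × N ℕ.≤ n' × r N ℕ.≤ n' × σ' ≗[ n ] σ ×
      (∀ j → N ℕ.≤ j → j ℕ.< r N → σ' j ≡ false) × Open n' σ'

    -- Contradiction at a node without successor

    module Stuck (n : ℕ) (σ : Path) (G<φ : G n σ < φ n)
                 (unhit : ∀ i → size i ℕ.≤ n → ¬ Agree i (size i) σ)
                 (stuck : ¬ Successor n σ) where

      -- The threshold is φ at the starting level. A ball of size between n and k that contained the
      -- cylinder would load it with φ at its size, hence with at least φ n; smaller balls already
      -- fail to contain σ.
      open-below : ∀ {k τ} → n ℕ.≤ k → τ ≗[ n ] σ → G k τ < φ n → Open k τ
      open-below {k} {τ} n≤k e g = <-≤-trans g (φ-≤ n≤k) , λ i i≤k a → case (ℕ.≤-total (size i) n) i≤k a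
        where
        case : ∀ {i} → size i ℕ.≤ n ⊎ n ℕ.≤ size i → size i ℕ.≤ k → ¬ Agree i (size i) τ
        case {i} (inj₁ i≤n) _ a = unhit i i≤n (agree-cong (≗-≤ i≤n e) a)
        case {i} (inj₂ n≤i) i≤k a = g (≤-trans (φ-≤ n≤i) (≤-trans (φ≤load i≤k a) (load≤G i k τ)))

      Best : ℕ → ℕ → Path → Set
      Best l m ρ = Σ[ τ ∈ Path ] τ ≗[ m ] ρ × (∀ υ → υ ≗[ m ] ρ → G l τ ≤ G l υ)

      -- G depends on the cylinder alone, by `G-cong`, and there are finitely many cylinders to
      -- compare: the better of the optima in the two branches is optimal.
      best : ∀ k m ρ → Best (k ℕ.+ m) m ρ
      best zero m ρ = ρ , (λ _ _ → ≡.refl) , λ υ e → G-cong (≗-sym e)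
      best (suc k) m ρ = ≡.subst (λ l → Best l m ρ) (ℕ.+-suc k m)
          (case (best k (suc m) (ρ [ m ≔ true ])) (best k (suc m) (ρ [ m ≔ false ])))
        where
        l = k ℕ.+ suc m
        case : Best l (suc m) (ρ [ m ≔ true ]) → Best l (suc m) (ρ [ m ≔ false ]) → Best l m ρ
        case (τ , e , p) (τ' , e' , p') with ≤-total (G l τ) (G l τ')
        ... | inj₁ h = τ , ≗-trans (≗-≤ (ℕ.n≤1+n m) e) (≔-below ρ m true) , least
          where
          least : ∀ υ → υ ≗[ m ] ρ → G l τ ≤ G l υ
          least υ d with υ m in eq | ≔-suc d
          ... | true  | d' = p υ d'
          ... | false | d' = ≤-trans h (p' υ d')
        ... | inj₂ h = τ' , ≗-trans (≗-≤ (ℕ.n≤1+n m) e') (≔-below ρ m false) , least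
          where
          least : ∀ υ → υ ≗[ m ] ρ → G l τ' ≤ G l υ
          least υ d with υ m in eq | ≔-suc d
          ... | true  | d' = ≤-trans h (p υ d')
          ... | false | d' = p' υ d'

      u : ℕ → Path → Carrier
      u k τ = φ n - G k τ

      bestPath : ℕ → Path
      bestPath k = proj₁ (best k n σ)

      bestPath-≗ : ∀ k → bestPath k ≗[ n ] σ
      bestPath-≗ k = proj₁ (proj₂ (best k n σ))

      V : ℕ → Carrier
      V k = u (k ℕ.+ n) (bestPath k)

      u≤V : ∀ k {τ} → τ ≗[ n ] σ → u (k ℕ.+ n) τ ≤ V k
      u≤V k {τ} e = +-mono-≤ ≤-refl (neg-mono-≤ (proj₂ (proj₂ (best k n σ)) τ e))

      -- The supermartingale property of G with its sign changed; the constant φ n is its own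
      -- average.
      u-split : ∀ k τ → u k τ ≤ ½# * (u (suc k) (τ [ k ≔ true ]) + u (suc k) (τ [ k ≔ false ]))
      u-split k τ = ≤-by (*-monoˡ-≤ 0≤½ (G-split k τ))
        (solve 4 (λ p g a b → con ½ :* ((con 1ℚ :+ con 1ℚ) :* g) :- con ½ :* (a :+ b)
            := con ½ :* ((p :- a) :+ (p :- b)) :- (p :- g)) refl
          (φ n) (G k τ) (G (suc k) (τ [ k ≔ true ])) (G (suc k) (τ [ k ≔ false ])))

      half-sum : ∀ {x y z w} → x ≤ z → y ≤ w → ½# * (x + y) ≤ ½# * (z + w)
      half-sum p q = *-monoˡ-≤ 0≤½ (+-mono-≤ p q)

      halves : ∀ x → ½# * (x + x) ≈ x
      halves = solve 1 (λ x → con ½ :* (x :+ x) := x) refl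

      child-≗ : ∀ k {τ} b → τ ≗[ n ] σ → (τ [ k ℕ.+ n ≔ b ]) ≗[ n ] σ
      child-≗ k {τ} b e = ≗-trans (≗-≤ (ℕ.m≤n+m n k) (≔-below τ (k ℕ.+ n) b)) e

      V-mono : ∀ k → V k ≤ V (suc k)
      V-mono k = ≤-trans (u-split (k ℕ.+ n) (bestPath k))
        (≤-respʳ (halves (V (suc k))) (half-sum (u≤V (suc k) (child-≗ k true (bestPath-≗ k)))
                                                (u≤V (suc k) (child-≗ k false (bestPath-≗ k)))))

      -- The margin of the starting node. It bounds every `V k` from below, and v / φ n is the
      -- factor between a term of the series and its gain.
      v : Carrier
      v = φ n - G n σ

      v-pos : 0# < v
      v-pos h = G<φ (≤-by h (solve 2 (λ p g → con 0ℚ :- (p :- g) := g :- p) refl (φ n) (G n σ)))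

      v≤V : ∀ k → v ≤ V k
      v≤V zero = u≤V 0 (λ _ _ → ≡.refl)
      v≤V (suc k) = ≤-trans (v≤V k) (V-mono k)

      V≤φ : ∀ k → V k ≤ φ n
      V≤φ k = ≤-byˡ (G-nonNeg (k ℕ.+ n) (bestPath k))
        (solve 2 (λ p g → g := p :- (p :- g)) refl (φ n) (G (k ℕ.+ n) (bestPath k)))

      bestPath-G : ∀ k → G (k ℕ.+ n) (bestPath k) < φ n
      bestPath-G k h = v-pos (≤-trans (v≤V k)
        (≤-by h (solve 2 (λ p g → g :- p := con 0ℚ :- (p :- g)) refl (φ n) (G (k ℕ.+ n) (bestPath k)))))

      -- Average of V over the position of the next digit 2 after level k,
      -- positions being capped at level h + k.
      S : ℕ → ℕ → Carrier
      S zero    k = V k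
      S (suc h) k = ½# * (V (suc k) + S h (suc k))

      V≤S : ∀ h k → V k ≤ S h k
      V≤S zero k = ≤-refl
      V≤S (suc h) k = ≤-respˡ (halves (V k))
        (half-sum (V-mono k) (≤-trans (V-mono k) (V≤S h (suc k))))

      D : ℕ → ℕ → Carrier
      D h k = S h k - V k

      D-nonNeg : ∀ h k → 0# ≤ D h k
      D-nonNeg h k = diff-nonNeg (V≤S h k)

      -- By the definition of S, 2 D(h + 1, k) = D(h, k + 1) + 2 (V(k + 1) - V(k)). The extra
      -- summand `D h k` provides the second copy of the head term that this identity consumes in
      -- the induction.
      D-telescope : ∀ h k →
        ∑ h (λ i → D (h ℕ.∸ i) (i ℕ.+ k)) + D h k ≤ 2# * (V (h ℕ.+ k) - V k)
      D-telescope zero k = ≤-reflexive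
        (solve 1 (λ x → con 0ℚ :+ (x :- x) := (con 1ℚ :+ con 1ℚ) :* (x :- x)) refl (V k))
      D-telescope (suc h) k = ≤-respˡ (+-cong (sym (∑-head h _)) refl)
        (≤-by (≤-respˡ (+-cong (∑-cong h (λ i _ → reflexive (≡.cong (D (h ℕ.∸ i)) (ℕ.+-suc i k)))) refl)
            (≤-respʳ (*-cong refl (+-cong (reflexive (≡.cong V (ℕ.+-suc h k))) refl)) (D-telescope h (suc k))))
          (solve 5 (λ x y z s t →
            (con 1ℚ :+ con 1ℚ) :* (z :- y) :- (t :+ (s :- y))
            := (con 1ℚ :+ con 1ℚ) :* (z :- x)
               :- (((con ½ :* (y :+ s) :- x) :+ t) :+ (con ½ :* (y :+ s) :- x))) refl
            (V k) (V (suc k)) (V (suc (h ℕ.+ k))) (S h (suc k))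
            (∑ h (λ i → D (h ℕ.∸ i) (suc (i ℕ.+ k))))))

      -- Backwards along a run of zeros that ends at a node with G ≥ φ: at each step the
      -- branch with digit 2 contributes at most V.
      zero-run : ∀ {j} e h k {τ} → e ℕ.≤ h → e ℕ.+ (k ℕ.+ n) ≡ j → τ ≗[ n ] σ →
        (∀ l → k ℕ.+ n ℕ.≤ l → τ l ≡ false) → φ j ≤ G j τ →
        φ n * u (k ℕ.+ n) τ ≤ φ n * S h k - v * (2# ^ (k ℕ.+ n) * F j)
      zero-run {j} zero h k {τ} _ ≡.refl e z g =
        -- At the blocked node it remains to see that (φ n - v) (φ n - φ j) ≤ 0. The first factor is
        -- G at the starting node, and φ n ≤ φ j.
        ≤-by (+-mono-≤ (*-nonNeg φ≥0 (diff-nonNeg g))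
               (+-mono-≤ (*-nonNeg φ≥0 (diff-nonNeg (≤-trans (v≤V k) (V≤S h k))))
                         (*-nonNeg (G-nonNeg n σ) (diff-nonNeg (φ-≤ (ℕ.m≤n+m n k))))))
          (solve 5 (λ p q g s d →
             (p :* (g :- q) :+ (p :* (s :- (p :- d)) :+ d :* (q :- p))) :- (con 0ℚ :+ (con 0ℚ :+ con 0ℚ))
             := (p :* s :- (p :- d) :* q) :- p :* (p :- g)) refl
             (φ n) (φ j) (G j τ) (S h k) (G n σ))
        where φ≥0 = weight-nonNeg n n
      zero-run {j} (suc e) (suc h) k {τ} (s≤s e≤h) eq d z g =
        -- Averaging halves the shortfall found one level deeper, and half of 2^(k + 1 + n) is 2^(k
        -- + n), so the bound keeps its form.
        ≤-trans (*-monoˡ-≤ φ≥0 (u-split (k ℕ.+ n) τ))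
        (≤-by (*-monoˡ-≤ 0≤½ (+-mono-≤ (*-monoˡ-≤ φ≥0 (u≤V (suc k) (child-≗ k true d)))
                (≤-trans (*-monoˡ-≤ φ≥0 keep)
                  (≤-respʳ (+-cong refl (-‿cong double-weight))
                    (zero-run e h (suc k) e≤h (≡.trans (ℕ.+-suc e (k ℕ.+ n)) eq) d
                      (λ l p → z l (ℕ.<⇒≤ p)) g)))))
          (solve 6 (λ p x y w s q →
             con ½ :* (p :* w :+ (p :* s :- (q :+ q))) :- con ½ :* (p :* x :+ p :* y)
             := (p :* (con ½ :* (w :+ s)) :- q) :- p :* (con ½ :* (x :+ y))) refl
             (φ n) (u (suc k ℕ.+ n) (τ [ k ℕ.+ n ≔ true ]))
             (u (suc k ℕ.+ n) (τ [ k ℕ.+ n ≔ false ])) (V (suc k)) (S h (suc k))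
             (v * (2# ^ (k ℕ.+ n) * F j))))
        where
        φ≥0 = weight-nonNeg n n
        double-weight : v * (2# ^ (suc k ℕ.+ n) * F j) ≈ v * (2# ^ (k ℕ.+ n) * F j) + v * (2# ^ (k ℕ.+ n) * F j)
        double-weight = solve 3 (λ v t f → v :* (((con 1ℚ :+ con 1ℚ) :* t) :* f)
          := v :* (t :* f) :+ v :* (t :* f)) refl v (2# ^ (k ℕ.+ n)) (F j)
        same : τ ≗[ suc (k ℕ.+ n) ] (τ [ k ℕ.+ n ≔ false ])
        same = ≡.subst (λ b → τ ≗[ suc (k ℕ.+ n) ] (τ [ k ℕ.+ n ≔ b ])) (z _ ℕ.≤-refl)
          (≔-suc {τ} {τ} (λ _ _ → ≡.refl))
        keep : u (suc k ℕ.+ n) (τ [ k ℕ.+ n ≔ false ]) ≤ u (suc k ℕ.+ n) τ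
        keep = +-mono-≤ ≤-refl (neg-mono-≤ (G-cong same))

      -- If r N ≤ N, no zeros are demanded and a best node of level N is itself a successor. The
      -- result is also the premise under which divergence is available.
      r-large : ∀ N → n ℕ.< N → N ℕ.< r N
      r-large N n<N = ℕ.≰⇒> λ r≤N → stuck
        (N , N , τ , n<N , ℕ.≤-refl , r≤N , τ≗ , (λ j p q → ⊥-elim (ℕ.<⇒≱ q (ℕ.≤-trans r≤N p))) ,
         open-below (ℕ.<⇒≤ n<N) τ≗ (≡.subst (λ l → G l τ < φ n) (ℕ.m∸n+n≡m (ℕ.<⇒≤ n<N)) (bestPath-G (N ℕ.∸ n))))
        where
        τ = bestPath (N ℕ.∸ n)
        τ≗ = bestPath-≗ (N ℕ.∸ n)

      -- A best node of level N is continued by zeros. Were G below φ at all levels from N to r N,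
      -- the node of level r N would be a successor. So some j ≤ r N is blocked, and `zero-run`
      -- applies with F j ≥ F (r N); the hypothesis keeps j within the horizon of S.
      gain : ∀ h k → r (suc k ℕ.+ n) ℕ.≤ h ℕ.+ (suc k ℕ.+ n) →
        v * (2# ^ (suc k ℕ.+ n) * F (r (suc k ℕ.+ n))) ≤ φ n * D h (suc k)
      gain h k rN≤ = case em
        where
        N = suc k ℕ.+ n
        τ = cut N (bestPath (suc k))
        n≤N : n ℕ.≤ N
        n≤N = ℕ.m≤n+m n (suc k)
        τ≗ : τ ≗[ n ] σ
        τ≗ = ≗-trans (≗-≤ n≤N (cut-below N (bestPath (suc k)))) (bestPath-≗ (suc k))
        N≤r : N ℕ.≤ r N
        N≤r = ℕ.<⇒≤ (r-large N (s≤s (ℕ.m≤n+m n k)))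
        Gτ : G N τ < φ n
        Gτ = ≤-<-trans (G-cong (cut-below N (bestPath (suc k)))) (bestPath-G (suc k))
        Blocked : Set
        Blocked = ∃[ j ] N ℕ.≤ j × j ℕ.≤ r N × φ j ≤ G j τ
        case : Dec Blocked → v * (2# ^ N * F (r N)) ≤ φ n * D h (suc k)
        case (yes (j , N≤j , j≤r , g)) =
          ≤-trans (*-monoˡ-≤ (<⇒≤ v-pos) (*-monoˡ-≤ (2^-nonNeg N) (F-≤ j≤r)))
            (≤-by (+-mono-≤
              (zero-run (j ℕ.∸ N) h (suc k) {τ} j∸N≤h (ℕ.m∸n+n≡m N≤j) τ≗ (cut-above N (bestPath (suc k))) g)
              (*-monoˡ-≤ (weight-nonNeg n n) V≤uτ))
              (solve 5 (λ p u s x w → ((p :* s :- x) :+ p :* u) :- (p :* u :+ p :* w) := p :* (s :- w) :- x) refl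
                (φ n) (u N τ) (S h (suc k)) (v * (2# ^ N * F j)) (V (suc k))))
          where
          j∸N≤h : j ℕ.∸ N ℕ.≤ h
          j∸N≤h = ℕ.≤-trans (ℕ.∸-monoˡ-≤ N (ℕ.≤-trans j≤r rN≤)) (ℕ.≤-reflexive (ℕ.m+n∸n≡m h N))
          V≤uτ : V (suc k) ≤ u N τ
          V≤uτ = +-mono-≤ ≤-refl (neg-mono-≤ (G-cong (cut-below N (bestPath (suc k)))))
        case (no ¬b) = ⊥-elim (stuck (N , r N , τ , s≤s (ℕ.m≤n+m n k) , N≤r , ℕ.≤-refl , τ≗ ,
            (λ j N≤j _ → cut-above N (bestPath (suc k)) j N≤j) ,
            (λ h → ¬b (r N , N≤r , ℕ.≤-refl , h)) , unhit'))
          where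
          unhit' : ∀ i → size i ℕ.≤ r N → ¬ Agree i (size i) τ
          unhit' i i≤r a with ℕ.≤-total (size i) N
          ... | inj₁ i≤N = proj₂ (open-below n≤N τ≗ Gτ) i i≤N a
          -- A ball of size at least N that contains the node would block the run at the level of
          -- its own size.
          ... | inj₂ N≤i = ¬b (size i , N≤i , i≤r , ≤-trans (φ≤load ℕ.≤-refl a) (load≤G i (size i) τ))

      gains : ℕ → Carrier
      gains i = 2# ^ suc (i ℕ.+ n) * F (r (suc (i ℕ.+ n)))

      module _ (K H : ℕ) (r≤H : ∀ i → i ℕ.< K → r (suc i ℕ.+ n) ℕ.≤ H) where
        private
          h : ℕ
          h = K ℕ.+ H

          -- The horizon shrinks as the level grows, so that all averages are capped at one level
          -- and fit `D-telescope` at k = 1. Since h = K + H, every horizon with i < K is still at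
          -- least H.
          d : ℕ → Carrier
          d i = D (h ℕ.∸ i) (i ℕ.+ 1)

          step : ∀ i → i ℕ.< K → v * gains i ≤ φ n * d i
          step i i<K = ≤-respʳ (*-cong refl (reflexive (≡.cong (D (h ℕ.∸ i)) (ℕ.+-comm 1 i))))
            (gain (h ℕ.∸ i) i (ℕ.≤-trans (r≤H i i<K) (ℕ.≤-trans (ℕ.m≤n+m H (K ℕ.∸ i)) (ℕ.≤-trans
              (ℕ.≤-reflexive (≡.sym (ℕ.+-∸-comm H (ℕ.<⇒≤ i<K)))) (ℕ.m≤m+n (h ℕ.∸ i) (suc i ℕ.+ n))))))

          ∑d≤2φ : ∑ h d ≤ 2# * φ n
          ∑d≤2φ = ≤-trans (x≤x+y (D-nonNeg h 1)) (≤-trans (D-telescope h 1)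
            (*-monoˡ-≤ 0≤2 (≤-by (+-mono-≤ (V≤φ (h ℕ.+ 1)) (≤-trans (<⇒≤ v-pos) (v≤V 1)))
              (solve 3 (λ p x y → (p :+ y) :- (x :+ con 0ℚ) := p :- (x :- y)) refl
                (φ n) (V (h ℕ.+ 1)) (V 1)))))

        total-gain : v * ∑ K gains ≤ φ n * (2# * φ n)
        total-gain = ≤-respˡ (∑-*ˡ K v gains) (≤-trans (∑-mono K step)
          (≤-respˡ (sym (∑-*ˡ K (φ n) d)) (*-monoˡ-≤ (weight-nonNeg n n)
            (≤-trans (∑-extend (ℕ.m≤m+n K H) (λ i → D-nonNeg (h ℕ.∸ i) (i ℕ.+ 1))) ∑d≤2φ))))

      -- The number K of terms is taken from the divergence first; then the horizon H can bound the
      -- finitely many depths involved. The bound on the gains is the same for all K and H.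
      absurd : ⊥
      absurd =
        let b , large = unbounded v-pos (φ n * (2# * φ n))
            K , b≤∑ = diverges n r-large b
            H , r≤H = finite-bound K (λ i → r (suc i ℕ.+ n))
        in large (≤-trans (*-monoˡ-≤ (<⇒≤ v-pos) b≤∑) (total-gain K H r≤H))

    successor : ∀ {n σ} → Open n σ → Successor n σ
    successor {n} {σ} (g , unhit) = case em
      where
      case : Dec (Successor n σ) → Successor n σ
      case (yes s) = s
      case (no ¬s) = ⊥-elim (Stuck.absurd n σ g unhit ¬s)

    -- Iteration of successors and the limit path

    Node : Set
    Node = Σ[ n ∈ ℕ ] Σ[ σ ∈ Path ] Open n σ

    next : (x : Node) → Successor (proj₁ x) (proj₁ (proj₂ x))
    next (n , σ , o) = successor o

    play : Node → ℕ → Node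
    play x zero    = x
    play x (suc k) with next (play x k)
    ... | N , n' , σ' , _ , _ , _ , _ , _ , o = n' , σ' , o

    module Limit (x : Node) where
      level : ℕ → ℕ
      level k = proj₁ (play x k)

      path : ℕ → Path
      path k = proj₁ (proj₂ (play x k))

      -- The level at stage k is at least k, so `path (suc j)` has already settled place j.
      limit : Path
      limit j = path (suc j) j

      level-< : ∀ k → level k ℕ.< level (suc k)
      level-< k with next (play x k)
      ... | N , n' , σ' , n<N , N≤n' , _ = ℕ.<-≤-trans n<N N≤n'

      level-≥ : ∀ k → k ℕ.≤ level k
      level-≥ zero = z≤n
      level-≥ (suc k) = ℕ.≤-trans (s≤s (level-≥ k)) (level-< k)

      path-suc : ∀ k → path (suc k) ≗[ level k ] path k
      path-suc k with next (play x k)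
      ... | N , n' , σ' , _ , _ , _ , e , _ = e

      path-+ : ∀ l k → path (l ℕ.+ k) ≗[ level k ] path k
      path-+ zero k _ _ = ≡.refl
      path-+ (suc l) k = ≗-trans (≗-≤ (level-+ l) (path-suc (l ℕ.+ k))) (path-+ l k)
        where
        level-+ : ∀ l → level k ℕ.≤ level (l ℕ.+ k)
        level-+ zero = ℕ.≤-refl
        level-+ (suc l) = ℕ.≤-trans (level-+ l) (ℕ.<⇒≤ (level-< (l ℕ.+ k)))

      path-≤ : ∀ {k l} → k ℕ.≤ l → path l ≗[ level k ] path k
      path-≤ {k} {l} k≤l = ≡.subst (λ m → path m ≗[ level k ] path k) (ℕ.m∸n+n≡m k≤l) (path-+ (l ℕ.∸ k) k)

      limit-≗ : ∀ k → limit ≗[ level k ] path k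
      limit-≗ k j j< with ℕ.≤-total k (suc j)
      ... | inj₁ p = path-≤ p j j<
      ... | inj₂ p = ≡.sym (path-≤ p j (level-≥ (suc j)))

      limit-zeros : ∀ k → ∃[ N ] k ℕ.< N × (∀ j → N ℕ.≤ j → j ℕ.< r N → limit j ≡ false)
      limit-zeros k with next (play x k) | level-≥ k | limit-≗ (suc k)
      ... | N , n' , σ' , n<N , _ , r≤n' , _ , z , _ | k≤ | e =
        N , ℕ.≤-<-trans k≤ n<N , λ j p q → ≡.trans (e j (ℕ.<-≤-trans q r≤n')) (z j p q)

      -- At stage `size i` the level has reached the size of the ball, and the second clause of
      -- `Open` excludes it.
      limit-unhit : ∀ i → ¬ Agree i (size i) limit
      limit-unhit i a = proj₂ (proj₂ (proj₂ (play x (size i)))) i (level-≥ (size i))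
        (agree-cong (≗-≤ (level-≥ (size i)) (limit-≗ (size i))) a)

    -- At the root G is at most `total`, and some child never exceeds this bound. Since all sizes
    -- are at least n, only a ball of size exactly n could contain the cylinder, and it would load
    -- it with φ n.
    start : ∀ n → total < φ n → (∀ i → Active i → n ℕ.≤ size i) → Node
    start n total<φ size≥n = n , τ , ≤-<-trans Gτ total<φ , unhit
      where
      descend : ∀ k → Σ[ τ ∈ Path ] G k τ ≤ total
      descend zero = (λ _ → false) , G-least 0 _ λ k → ≤-trans
        (∑-mono k (λ i _ → ≤-respʳ (*-identityˡ (cost i)) (load≤cost i 0 _))) (cost-bound k)
      descend (suc k) with descend k
      ... | τ , h = case (≤-dec _ _) (≤-dec _ _)
        where
        G' : Bool → Carrier
        G' b = G (suc k) (τ [ k ≔ b ])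
        case : Dec (G' true ≤ total) → Dec (G' false ≤ total) → Σ[ τ ∈ Path ] G (suc k) τ ≤ total
        case (yes p) _ = _ , p
        case _ (yes p) = _ , p
        case (no p) (no q) = ⊥-elim (p (≤-by (+-mono-≤ (G-split k τ) (+-mono-≤ (*-monoˡ-≤ 0≤2 h) (<⇒≤ q)))
          (solve 4 (λ x y g t → ((con 1ℚ :+ con 1ℚ) :* g :+ ((con 1ℚ :+ con 1ℚ) :* t :+ y))
              :- ((x :+ y) :+ ((con 1ℚ :+ con 1ℚ) :* g :+ t)) := t :- x) refl
            (G' true) (G' false) (G k τ) total)))
      τ = proj₁ (descend n)
      Gτ = proj₂ (descend n)
      unhit : ∀ i → size i ℕ.≤ n → ¬ Agree i (size i) τ
      unhit i i≤n a = total<φ (≤-trans (≡.subst (λ m → φ m ≤ G n τ) (ℕ.≤-antisym i≤n (size≥n i (proj₁ a)))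
        (≤-trans (φ≤load i≤n a) (load≤G i n τ))) Gτ)

    uncovered : ∀ n → total < φ n → (∀ i → Active i → n ℕ.≤ size i) →
      Σ[ σ ∈ Path ] (∀ M → ∃[ N ] M ℕ.< N × (∀ j → N ℕ.≤ j → j ℕ.< r N → σ j ≡ false))
        × (∀ i → ¬ Agree i (size i) σ)
    uncovered n total<φ size≥n = limit , limit-zeros , limit-unhit
      where open Limit (start n total<φ size≥n)

-- Rational numerals: naturals, factorials, powers of 3

module Numerals where
  open import Defs using (1/_!; 3^ℤ⇒ℚ; 3^_)
  open import Data.Integer using (ℤ; +_; -[1+_])
  open import Data.Rational.Unnormalised as ℚᵘ using (mkℚᵘ; *≡*; *≤*)
  import Data.Rational.Unnormalised.Properties as ℚᵘ
  open ≡ using (refl; sym; trans; cong; subst)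

  toℚᵘ-/ : ∀ a b → ℚ.toℚᵘ ((+ a) ℚ./ suc b) ℚᵘ.≃ mkℚᵘ (+ a) b
  toℚᵘ-/ a b = ℚ.toℚᵘ-fromℚᵘ (mkℚᵘ (+ a) b)

  /-*-/ : ∀ a b c d → (+ a ℚ./ suc b) ℚ.* (+ c ℚ./ suc d) ≡ + (a ℕ.* c) ℚ./ (suc b ℕ.* suc d)
  /-*-/ a b c d = ℚ.toℚᵘ-injective (begin
    ℚ.toℚᵘ ((+ a ℚ./ suc b) ℚ.* (+ c ℚ./ suc d))            ≈⟨ ℚ.toℚᵘ-homo-* (+ a ℚ./ suc b) (+ c ℚ./ suc d) ⟩
    ℚ.toℚᵘ (+ a ℚ./ suc b) ℚᵘ.* ℚ.toℚᵘ (+ c ℚ./ suc d)      ≈⟨ ℚᵘ.*-cong (toℚᵘ-/ a b) (toℚᵘ-/ c d) ⟩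
    mkℚᵘ (+ a) b ℚᵘ.* mkℚᵘ (+ c) d                          ≡⟨ cong (λ z → mkℚᵘ z (d ℕ.+ b ℕ.* suc d)) (sym (ℤ.pos-* a c)) ⟩
    mkℚᵘ (+ (a ℕ.* c)) (d ℕ.+ b ℕ.* suc d)                  ≈⟨ ℚᵘ.≃-sym (toℚᵘ-/ (a ℕ.* c) (d ℕ.+ b ℕ.* suc d)) ⟩
    ℚ.toℚᵘ (+ (a ℕ.* c) ℚ./ (suc b ℕ.* suc d))              ∎)
    where open ℚᵘ.≃-Reasoning

  /-≡ : ∀ a b c d → a ℕ.* suc d ≡ c ℕ.* suc b → (+ a) ℚ./ suc b ≡ (+ c) ℚ./ suc d
  /-≡ a b c d e = ℚ.fromℚᵘ-cong {mkℚᵘ (+ a) b} {mkℚᵘ (+ c) d}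
    (*≡* (trans (sym (ℤ.pos-* a (suc d))) (trans (cong +_ e) (ℤ.pos-* c (suc b)))))

  -- Adding 1 repeatedly makes induction in ℚ immediate; `nat-/` leads back to the quotients in
  -- which factorials and powers of 3 are written.
  nat : ℕ → ℚ
  nat zero    = 0ℚ
  nat (suc n) = nat n ℚ.+ 1ℚ

  nat-/ : ∀ n → nat n ≡ + n ℚ./ 1
  nat-/ zero = refl
  nat-/ (suc n) = ℚ.toℚᵘ-injective (begin
    ℚ.toℚᵘ (nat n ℚ.+ 1ℚ)               ≈⟨ ℚ.toℚᵘ-homo-+ (nat n) 1ℚ ⟩
    ℚ.toℚᵘ (nat n) ℚᵘ.+ ℚ.toℚᵘ 1ℚ       ≈⟨ ℚᵘ.+-cong {ℚ.toℚᵘ (nat n)} {mkℚᵘ (+ n) 0} {ℚ.toℚᵘ 1ℚ} {mkℚᵘ (+ 1) 0}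
                                             (ℚᵘ.≃-trans (ℚ.toℚᵘ-cong (nat-/ n)) (toℚᵘ-/ n 0)) ℚᵘ.≃-refl ⟩
    mkℚᵘ (+ n) 0 ℚᵘ.+ mkℚᵘ (+ 1) 0      ≡⟨ cong (λ z → mkℚᵘ z 0) (trans (cong (ℤ._+ + 1) (ℤ.*-identityʳ (+ n))) (cong +_ (ℕ.+-comm n 1))) ⟩
    mkℚᵘ (+ suc n) 0                    ≈⟨ ℚᵘ.≃-sym (toℚᵘ-/ (suc n) 0) ⟩
    ℚ.toℚᵘ (+ suc n ℚ./ 1)              ∎)
    where open ℚᵘ.≃-Reasoning

  ≤-nat : ∀ q → ∃[ n ] q ℚ.≤ nat n
  ≤-nat q@(ℚ.mkℚ a d _) = ℤ.∣ a ∣ , subst (q ℚ.≤_) (sym (nat-/ ℤ.∣ a ∣))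
    (ℚ.toℚᵘ-cancel-≤ (ℚᵘ.≤-respʳ-≃ (ℚᵘ.≃-sym (toℚᵘ-/ ℤ.∣ a ∣ 0)) (*≤* (le a))))
    where
    le : ∀ a → a ℤ.* + 1 ℤ.≤ + ℤ.∣ a ∣ ℤ.* + suc d
    le (+ n) = ≡.subst₂ ℤ._≤_ (sym (ℤ.*-identityʳ (+ n))) (ℤ.pos-* n (suc d)) (ℤ.+≤+ (ℕ.m≤m*n n (suc d)))
    le -[1+ n ] = ℤ.≤-trans (ℤ.≤-reflexive (ℤ.*-identityʳ -[1+ n ])) (ℤ.≤-trans (ℤ.-≤+ {n} {0})
      (≡.subst (+ 0 ℤ.≤_) (ℤ.pos-* (suc n) (suc d)) (ℤ.+≤+ ℕ.z≤n)))

  1/!-suc : ∀ n → nat (suc n) ℚ.* (1/ suc n !) ≡ 1/ n !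
  1/!-suc n = trans (cong (ℚ._* (1/ suc n !)) (nat-/ (suc n))) (go (n !) {{ℕ._!≢0 n}})
    where
    go : ∀ f .{{_ : ℕ.NonZero f}} → (+ suc n ℚ./ 1) ℚ.* ℚ._/_ (+ 1) (suc n ℕ.* f) {{ℕ.m*n≢0 (suc n) f}} ≡ + 1 ℚ./ f
    go (suc f) = trans (/-*-/ (suc n) 0 1 (f ℕ.+ n ℕ.* suc f))
      (/-≡ (suc n ℕ.* 1) _ 1 f (trans (cong (ℕ._* suc f) (ℕ.*-identityʳ (suc n)))
         (sym (trans (ℕ.+-identityʳ _) (ℕ.+-identityʳ _)))))

  3ℚ : ℚ
  3ℚ = + 3 ℚ./ 1

  3^-suc : ∀ n → 3^ℤ⇒ℚ (3^ (+ suc n)) ≡ 3ℚ ℚ.* 3^ℤ⇒ℚ (3^ (+ n))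
  3^-suc n = sym (/-*-/ 3 0 (3 ℕ.^ n) 0)

  3^-pred : ∀ n → 3ℚ ℚ.* 3^ℤ⇒ℚ (3^ (ℤ.- + suc n)) ≡ 3^ℤ⇒ℚ (3^ (ℤ.- + n))
  3^-pred zero = refl
  3^-pred (suc n) = go (3 ℕ.^ suc n) {{ℕ.m^n≢0 3 (suc n)}}
    where
    go : ∀ f .{{_ : ℕ.NonZero f}} → 3ℚ ℚ.* ℚ._/_ (+ 1) (3 ℕ.* f) {{ℕ.m*n≢0 3 f}} ≡ + 1 ℚ./ f
    go (suc f) = trans (/-*-/ 3 0 1 (f ℕ.+ 2 ℕ.* suc f))
      (/-≡ 3 _ 1 f (sym (trans (ℕ.+-identityʳ _) (ℕ.+-identityʳ _))))

-- Limits, the exponential series, and powers of 2 and 3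

module Exponential (R : RealField) (em : ExcludedMiddle 0ℓ) where
  open Field R em
  open Numerals
  open import Defs using (1/_!)

  abs⇒nonNeg : ∀ {x b} → ∣ x ∣≤ b → 0# ≤ b
  abs⇒nonNeg {x} {b} (p , q) = *-cancel-≤ (ι-pos (ℚ.positive⁻¹ (1ℚ ℚ.+ 1ℚ)))
    (≤-by (+-mono-≤ p q) (solve 2 (λ x b → (b :+ b) :- (x :+ :- x)
      := con (1ℚ ℚ.+ 1ℚ) :* b :- con (1ℚ ℚ.+ 1ℚ) :* con 0ℚ) refl x b))

  abs-≤ : ∀ {x b c} → b ≤ c → ∣ x ∣≤ b → ∣ x ∣≤ c
  abs-≤ h (p , q) = ≤-trans p h , ≤-trans q h

  abs-cong : ∀ {x y b} → x ≈ y → ∣ x ∣≤ b → ∣ y ∣≤ b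
  abs-cong e (p , q) = ≤-respˡ e p , ≤-respˡ (-‿cong e) q

  abs-neg : ∀ {x b} → ∣ x ∣≤ b → ∣ - x ∣≤ b
  abs-neg {x} (p , q) = q , ≤-respˡ (solve 1 (λ x → x := :- :- x) refl x) p

  abs-nonNeg : ∀ {x} → 0# ≤ x → ∣ x ∣≤ x
  abs-nonNeg {x} h = ≤-refl , ≤-by (+-mono-≤ h h)
    (solve 1 (λ x → (x :+ x) :- (con 0ℚ :+ con 0ℚ) := x :- :- x) refl x)

  abs-+ : ∀ {x y b c} → ∣ x ∣≤ b → ∣ y ∣≤ c → ∣ x + y ∣≤ b + c
  abs-+ {x} {y} (p , q) (p' , q') = +-mono-≤ p p' ,
    ≤-respˡ (solve 2 (λ x y → :- x :+ :- y := :- (x :+ y)) refl x y) (+-mono-≤ q q')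

  -- (b - x) (c + y) + (b + x) (c - y) = 2 (b c - x y) is a sum of products of nonnegative factors;
  -- the other sign follows with - y for y.
  abs-* : ∀ {x y b c} → ∣ x ∣≤ b → ∣ y ∣≤ c → ∣ x * y ∣≤ b * c
  abs-* {x} {y} {b} {c} (p , q) (p' , q') =
      half (≤-by (+-nonNeg (*-nonNeg (diff-nonNeg p) (diff-nonNeg q')) (*-nonNeg (diff-nonNeg q) (diff-nonNeg p')))
        (solve 4 (λ x y b c → ((b :- x) :* (c :- (:- y)) :+ (b :- (:- x)) :* (c :- y)) :- con 0ℚ
          := con (1ℚ ℚ.+ 1ℚ) :* (b :* c) :- con (1ℚ ℚ.+ 1ℚ) :* (x :* y)) refl x y b c))
    , half (≤-by (+-nonNeg (*-nonNeg (diff-nonNeg p) (diff-nonNeg p')) (*-nonNeg (diff-nonNeg q) (diff-nonNeg q')))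
        (solve 4 (λ x y b c → ((b :- x) :* (c :- y) :+ (b :- (:- x)) :* (c :- (:- y))) :- con 0ℚ
          := con (1ℚ ℚ.+ 1ℚ) :* (b :* c) :- con (1ℚ ℚ.+ 1ℚ) :* (:- (x :* y))) refl x y b c))
    where
    half : ∀ {s t} → ι (1ℚ ℚ.+ 1ℚ) * s ≤ ι (1ℚ ℚ.+ 1ℚ) * t → s ≤ t
    half = *-cancel-≤ (ι-pos (ℚ.positive⁻¹ (1ℚ ℚ.+ 1ℚ)))

  abs-∑ : ∀ n {a b} → (∀ i → i ℕ.< n → ∣ a i ∣≤ b i) → ∣ ∑ n a ∣≤ ∑ n b
  abs-∑ zero h = abs-nonNeg ≤-refl
  abs-∑ (suc n) h = abs-+ (abs-∑ n (λ i i<n → h i (ℕ.m<n⇒m<1+n i<n))) (h n (ℕ.n<1+n n))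

  ι-½ : ∀ ε → ι (½ ℚ.* ε) + ι (½ ℚ.* ε) ≈ ι ε
  ι-½ ε = trans (sym (ι-+ (½ ℚ.* ε) (½ ℚ.* ε))) (reflexive (≡.cong ι
    (≡.trans (≡.sym (ℚ.*-distribʳ-+ ε ½ ½)) (ℚ.*-identityˡ ε))))

  ⟶-cong : ∀ {x y l m} → (∀ n → x n ≈ y n) → l ≈ m → x ⟶ l → y ⟶ m
  ⟶-cong e f h ε ε>0 = ev-map (λ n → abs-cong (+-cong (e n) (-‿cong f))) (h ε ε>0)

  ⟶-const : ∀ l → (λ _ → l) ⟶ l
  ⟶-const l ε ε>0 = 0 , λ n _ → abs-cong (solve 1 (λ l → con 0ℚ := l :- l) refl l)
    (abs-≤ (ι-mono (ℚ.<⇒≤ ε>0)) (abs-nonNeg ≤-refl))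

  ⟶-+ : ∀ {x y l m} → x ⟶ l → y ⟶ m → (λ n → x n + y n) ⟶ l + m
  ⟶-+ {x} {y} {l} {m} p q ε ε>0 = ev-map₂
    (λ n a b → abs-cong (solve 4 (λ x y l m → (x :- l) :+ (y :- m) := (x :+ y) :- (l :+ m)) refl (x n) (y n) l m)
      (abs-≤ (≤-reflexive (ι-½ ε)) (abs-+ a b)))
    (p (½ ℚ.* ε) (½-pos ε>0)) (q (½ ℚ.* ε) (½-pos ε>0))

  ⟶-neg : ∀ {x l} → x ⟶ l → (λ n → - x n) ⟶ - l
  ⟶-neg {x} {l} p ε ε>0 = ev-map
    (λ n a → abs-cong (solve 2 (λ x l → :- (x :- l) := :- x :- :- l) refl (x n) l) (abs-neg a)) (p ε ε>0)

  ⟶-≤ : ∀ {x y l m} → Eventually (λ n → x n ≤ y n) → x ⟶ l → y ⟶ m → l ≤ m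
  ⟶-≤ {x} {y} {l} {m} (N , le) p q = closed λ ε ε>0 →
    let (A , a) = p (½ ℚ.* ε) (½-pos ε>0)
        (B , b) = q (½ ℚ.* ε) (½-pos ε>0)
        n = N ⊔ (A ⊔ B)
        A≤n = ℕ.≤-trans (ℕ.m≤m⊔n A B) (ℕ.m≤n⊔m N (A ⊔ B))
        B≤n = ℕ.≤-trans (ℕ.m≤n⊔m A B) (ℕ.m≤n⊔m N (A ⊔ B))
    in ≤-respʳ (+-cong refl (ι-½ ε))
       (≤-by (+-mono-≤ (le n (ℕ.m≤m⊔n N (A ⊔ B))) (+-mono-≤ (proj₂ (a n A≤n)) (proj₁ (b n B≤n))))
        (solve 6 (λ x y l m e f → (y :+ (e :+ f)) :- (x :+ (:- (x :- l) :+ (y :- m))) := (m :+ (e :+ f)) :- l) refl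
          (x n) (y n) l m (ι (½ ℚ.* ε)) (ι (½ ℚ.* ε))))

  ⟶-unique : ∀ {x l m} → x ⟶ l → x ⟶ m → l ≈ m
  ⟶-unique p q = ≤-antisym (⟶-≤ (0 , λ _ _ → ≤-refl) p q) (⟶-≤ (0 , λ _ _ → ≤-refl) q p)

  BoundedSeq : (ℕ → Carrier) → Set
  BoundedSeq y = ∃[ b ] 0ℚ ℚ.< b × Eventually (λ n → ∣ y n ∣≤ ι b)

  abs-bound : ∀ x → ∃[ b ] 0ℚ ℚ.< b × ∣ x ∣≤ ι b
  abs-bound x =
    let p , x≤p = bounded x
        q , -x≤q = bounded (- x)
        b = (ℚ.∣ p ∣ ℚ.+ ℚ.∣ q ∣) ℚ.+ 1ℚ
        p+q≤b : ℚ.∣ p ∣ ℚ.+ ℚ.∣ q ∣ ℚ.≤ b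
        p+q≤b = ≡.subst (ℚ._≤ b) (ℚ.+-identityʳ (ℚ.∣ p ∣ ℚ.+ ℚ.∣ q ∣))
          (ℚ.+-monoʳ-≤ (ℚ.∣ p ∣ ℚ.+ ℚ.∣ q ∣) (ℚ.nonNegative⁻¹ 1ℚ))
        p≤ : p ℚ.≤ ℚ.∣ p ∣ ℚ.+ ℚ.∣ q ∣
        p≤ = ℚ.≤-trans (p≤∣p∣ p) (≡.subst (ℚ._≤ ℚ.∣ p ∣ ℚ.+ ℚ.∣ q ∣) (ℚ.+-identityʳ ℚ.∣ p ∣)
          (ℚ.+-monoʳ-≤ ℚ.∣ p ∣ (ℚ.0≤∣p∣ q)))
        q≤ : q ℚ.≤ ℚ.∣ p ∣ ℚ.+ ℚ.∣ q ∣
        q≤ = ℚ.≤-trans (p≤∣p∣ q) (≡.subst (ℚ._≤ ℚ.∣ p ∣ ℚ.+ ℚ.∣ q ∣) (ℚ.+-identityˡ ℚ.∣ q ∣)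
          (ℚ.+-monoˡ-≤ ℚ.∣ q ∣ (ℚ.0≤∣p∣ p)))
    in b , ℚ.+-mono-≤-< (ℚ.+-mono-≤ (ℚ.0≤∣p∣ p) (ℚ.0≤∣p∣ q)) (ℚ.positive⁻¹ 1ℚ)
     , ≤-trans x≤p (ι-mono (ℚ.≤-trans p≤ p+q≤b)) , ≤-trans -x≤q (ι-mono (ℚ.≤-trans q≤ p+q≤b))

  ⟶⇒bounded : ∀ {x l} → x ⟶ l → BoundedSeq x
  ⟶⇒bounded {x} {l} p =
    let b , b>0 , h = abs-bound l
    in 1ℚ ℚ.+ b , ℚ.+-mono-< (ℚ.positive⁻¹ 1ℚ) b>0 ,
       ev-map (λ n a → abs-cong (solve 2 (λ x l → (x :- l) :+ l := x) refl (x n) l)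
         (abs-≤ (≤-reflexive (sym (ι-+ 1ℚ b))) (abs-+ a h))) (p 1ℚ (ℚ.positive⁻¹ 1ℚ))

  null-* : ∀ {z y} → z ⟶ 0# → BoundedSeq y → (λ n → z n * y n) ⟶ 0#
  null-* {z} {y} p (b , b>0 , h) ε ε>0 =
    let δ , δ>0 , δb≡ε = divide b b>0 ε ε>0
    in ev-map₂ (λ n u w → abs-cong (solve 2 (λ z y → (z :- con 0ℚ) :* y := z :* y :- con 0ℚ) refl (z n) (y n))
         (abs-≤ (≤-reflexive (trans (sym (ι-* δ b)) (reflexive (≡.cong ι δb≡ε)))) (abs-* u w))) (p δ δ>0) h

  const-bounded : ∀ x → BoundedSeq (λ _ → x)
  const-bounded x = let b , b>0 , h = abs-bound x in b , b>0 , 0 , λ _ _ → h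

  ⟶-diff : ∀ {x l} → x ⟶ l → (λ n → x n - l) ⟶ 0#
  ⟶-diff {x} {l} p = ⟶-cong (λ _ → refl) (solve 1 (λ l → l :- l := con 0ℚ) refl l) (⟶-+ p (⟶-const (- l)))

  ⟶-* : ∀ {x y l m} → x ⟶ l → y ⟶ m → (λ n → x n * y n) ⟶ l * m
  ⟶-* {x} {y} {l} {m} p q = ⟶-cong
    (λ n → solve 4 (λ x y l m → ((x :- l) :* y :+ (y :- m) :* l) :+ l :* m := x :* y) refl (x n) (y n) l m)
    (solve 2 (λ l m → (con 0ℚ :+ con 0ℚ) :+ l :* m := l :* m) refl l m)
    (⟶-+ (⟶-+ (null-* (⟶-diff p) (⟶⇒bounded q)) (null-* (⟶-diff q) (const-bounded l))) (⟶-const (l * m)))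

  ♯ : ℕ → Carrier
  ♯ n = ι (nat n)

  ♯-suc : ∀ n → ♯ (suc n) ≈ ♯ n + 1#
  ♯-suc n = ι-+ (nat n) 1ℚ

  ♯-nonNeg : ∀ n → 0# ≤ ♯ n
  ♯-nonNeg zero = ≤-refl
  ♯-nonNeg (suc n) = ≤-respʳ (sym (♯-suc n)) (+-nonNeg (♯-nonNeg n) 0≤1)

  ♯-pos : ∀ n → 0# < ♯ (suc n)
  ♯-pos n = ι-pos (ℚ.+-mono-≤-< (ι-cancel (♯-nonNeg n)) (ℚ.positive⁻¹ 1ℚ))

  ♯-+ : ∀ m n → ♯ (m ℕ.+ n) ≈ ♯ m + ♯ n
  ♯-+ zero n = sym (+-identityˡ (♯ n))
  ♯-+ (suc m) n = trans (♯-suc (m ℕ.+ n)) (trans (+-cong (♯-+ m n) refl)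
    (trans (solve 2 (λ a b → (a :+ b) :+ con 1ℚ := (a :+ con 1ℚ) :+ b) refl (♯ m) (♯ n)) (+-cong (sym (♯-suc m)) refl)))

  ♯-≤ : ∀ {m n} → m ℕ.≤ n → ♯ m ≤ ♯ n
  ♯-≤ {m} {n} h = ≤-respʳ (trans (sym (♯-+ m (n ∸ m))) (reflexive (≡.cong ♯ (ℕ.m+[n∸m]≡n h))))
    (x≤x+y (♯-nonNeg (n ∸ m)))

  e : ℕ → Carrier → Carrier
  e k x = ι (1/ k !) * x ^ k

  E : ℕ → Carrier → Carrier
  E n x = ∑ n (λ k → e k x)

  e-suc : ∀ k x → ♯ (suc k) * e (suc k) x ≈ x * e k x
  e-suc k x = trans (solve 4 (λ a b c d → a :* (b :* (c :* d)) := c :* ((a :* b) :* d)) refl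
      (♯ (suc k)) (ι (1/ suc k !)) x (x ^ k))
    (*-cong refl (*-cong (trans (sym (ι-* (nat (suc k)) (1/ suc k !))) (reflexive (≡.cong ι (1/!-suc k)))) refl))

  ^-cong : ∀ n {x y} → x ≈ y → x ^ n ≈ y ^ n
  ^-cong zero h = refl
  ^-cong (suc n) h = *-cong h (^-cong n h)

  e-cong : ∀ k {x y} → x ≈ y → e k x ≈ e k y
  e-cong k h = *-cong refl (^-cong k h)

  E-cong : ∀ n {x y} → x ≈ y → E n x ≈ E n y
  E-cong n h = ∑-cong n (λ k _ → e-cong k h)

  1/!-nonNeg : ∀ k → 0# ≤ ι (1/ k !)
  1/!-nonNeg zero = 0≤1
  1/!-nonNeg (suc k) = *-cancel-≤ (♯-pos k) (≤-respˡ (sym (zeroʳ (♯ (suc k)))) (≤-respʳ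
    (sym (trans (sym (ι-* (nat (suc k)) (1/ suc k !))) (reflexive (≡.cong ι (1/!-suc k))))) (1/!-nonNeg k)))

  e-nonNeg : ∀ k {x} → 0# ≤ x → 0# ≤ e k x
  e-nonNeg k h = *-nonNeg (1/!-nonNeg k) (^-nonNeg h k)

  E-nonNeg : ∀ n {x} → 0# ≤ x → 0# ≤ E n x
  E-nonNeg n h = ∑-nonNeg n (λ k _ → e-nonNeg k h)

  e-abs : ∀ k {x b} → ∣ x ∣≤ b → ∣ e k x ∣≤ e k b
  e-abs k {x} {b} h = abs-* (abs-nonNeg (1/!-nonNeg k)) (go k)
    where
    go : ∀ k → ∣ x ^ k ∣≤ b ^ k
    go zero = abs-nonNeg 0≤1
    go (suc k) = abs-* h (go k)

  E-abs : ∀ n {x b} → ∣ x ∣≤ b → ∣ E n x ∣≤ E n b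
  E-abs n h = abs-∑ n (λ k _ → e-abs k h)

  E-diff-abs : ∀ {m n} → m ℕ.≤ n → ∀ {x b} → ∣ x ∣≤ b → ∣ E n x - E m x ∣≤ E n b - E m b
  E-diff-abs {m} {n} m≤n {x} {b} h = abs-cong (sym (tail x))
      (abs-≤ (≤-reflexive (sym (tail b))) (abs-∑ (n ∸ m) (λ k _ → e-abs (m ℕ.+ k) h)))
    where
    tail : ∀ x → E n x - E m x ≈ ∑ (n ∸ m) (λ k → e (m ℕ.+ k) x)
    tail x = trans (+-cong (trans (reflexive (≡.cong (λ l → E l x) (≡.sym (ℕ.m+[n∸m]≡n m≤n))))
        (∑-split m (n ∸ m) (λ k → e k x))) refl)
      (solve 2 (λ a b → (a :+ b) :- a := b) refl (E m x) (∑ (n ∸ m) (λ k → e (m ℕ.+ k) x)))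

  conv : ℕ → Carrier → Carrier → Carrier
  conv k x y = ∑ (suc k) (λ i → e i x * e (k ∸ i) y)

  ∑-drop-last : ∀ n a → a n ≈ 0# → ∑ (suc n) a ≈ ∑ n a
  ∑-drop-last n a h = trans (+-cong refl h) (+-identityʳ (∑ n a))

  -- A Leibniz rule: the factor k + 1 = i + (k + 1 - i) splits each term in two, and `e-suc` lowers
  -- one index in each half. So `conv` obeys the recursion of `e` at x + y, and binomial
  -- coefficients are avoided.
  conv-suc : ∀ k x y → ♯ (suc k) * conv (suc k) x y ≈ (x + y) * conv k x y
  conv-suc k x y = begin
    ♯ (suc k) * ∑ (suc (suc k)) t                              ≈⟨ sym (∑-*ˡ (suc (suc k)) (♯ (suc k)) t) ⟩
    ∑ (suc (suc k)) (λ i → ♯ (suc k) * t i)                    ≈⟨ ∑-cong (suc (suc k)) (λ i i<2+k → split i (ℕ.≤-pred i<2+k)) ⟩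
    ∑ (suc (suc k)) (λ i → ♯ i * t i + ♯ (suc k ∸ i) * t i)    ≈⟨ ∑-+ (suc (suc k)) (λ i → ♯ i * t i) (λ i → ♯ (suc k ∸ i) * t i) ⟩
    ∑ (suc (suc k)) (λ i → ♯ i * t i) + ∑ (suc (suc k)) (λ i → ♯ (suc k ∸ i) * t i)
                                                               ≈⟨ +-cong left right ⟩
    x * conv k x y + y * conv k x y                            ≈⟨ solve 3 (λ x y c → x :* c :+ y :* c := (x :+ y) :* c) refl x y (conv k x y) ⟩
    (x + y) * conv k x y                                       ∎
    where
    open import Relation.Binary.Reasoning.Setoid setoid
    t : ℕ → Carrier
    t i = e i x * e (suc k ∸ i) y
    split : ∀ i → i ℕ.≤ suc k → ♯ (suc k) * t i ≈ ♯ i * t i + ♯ (suc k ∸ i) * t i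
    split i i≤ = trans (*-cong (trans (reflexive (≡.cong ♯ (≡.sym (ℕ.m+[n∸m]≡n i≤)))) (♯-+ i (suc k ∸ i))) refl)
      (solve 3 (λ a b c → (a :+ b) :* c := a :* c :+ b :* c) refl (♯ i) (♯ (suc k ∸ i)) (t i))
    left : ∑ (suc (suc k)) (λ i → ♯ i * t i) ≈ x * conv k x y
    left = trans (∑-head (suc k) (λ i → ♯ i * t i)) (trans (+-cong (zeroˡ (t 0)) refl) (trans (+-identityˡ _)
      (trans (∑-cong (suc k) (λ i _ → trans (sym (*-assoc (♯ (suc i)) (e (suc i) x) (e (k ∸ i) y)))
        (trans (*-cong (e-suc i x) refl) (*-assoc x (e i x) (e (k ∸ i) y))))) (∑-*ˡ (suc k) x (λ i → e i x * e (k ∸ i) y)))))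
    right : ∑ (suc (suc k)) (λ i → ♯ (suc k ∸ i) * t i) ≈ y * conv k x y
    right = trans (∑-drop-last (suc k) (λ i → ♯ (suc k ∸ i) * t i)
        (trans (*-cong (reflexive (≡.cong ♯ (ℕ.n∸n≡0 (suc k)))) refl) (zeroˡ (t (suc k)))))
      (trans (∑-cong (suc k) (λ i i≤k → term i (ℕ.≤-pred i≤k))) (∑-*ˡ (suc k) y (λ i → e i x * e (k ∸ i) y)))
      where
      term : ∀ i → i ℕ.≤ k → ♯ (suc k ∸ i) * t i ≈ y * (e i x * e (k ∸ i) y)
      term i i≤k = trans (reflexive (≡.cong (λ l → ♯ l * (e i x * e l y)) (ℕ.+-∸-assoc 1 i≤k)))
        (trans (solve 3 (λ a b c → a :* (b :* c) := b :* (a :* c)) refl (♯ (suc (k ∸ i))) (e i x) (e (suc (k ∸ i)) y))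
        (trans (*-cong refl (e-suc (k ∸ i) y))
          (solve 3 (λ a b c → a :* (b :* c) := b :* (a :* c)) refl (e i x) y (e (k ∸ i) y))))

  e-binomial : ∀ k x y → conv k x y ≈ e k (x + y)
  e-binomial zero x y = solve 0 (con 0ℚ :+ (con 1ℚ :* con 1ℚ) :* (con 1ℚ :* con 1ℚ) := con 1ℚ :* con 1ℚ) refl
  e-binomial (suc k) x y = *-cancel (♯-pos k) (trans (conv-suc k x y)
    (trans (*-cong refl (e-binomial k x y)) (sym (e-suc k (x + y)))))

  -- The triangle i + j < n, summed by rows on the left and by diagonals on the right.
  E-+ : ∀ n x y → ∑ n (λ i → e i x * E (n ∸ i) y) ≈ E n (x + y)
  E-+ zero x y = refl
  E-+ (suc n) x y = trans (+-cong (trans (∑-cong n (λ i i<n → term i (ℕ.<⇒≤ i<n)))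
        (∑-+ n (λ i → e i x * E (n ∸ i) y) (λ i → e i x * e (n ∸ i) y))) last)
      (trans (+-assoc _ _ _) (+-cong (E-+ n x y) (e-binomial n x y)))
    where
    term : ∀ i → i ℕ.≤ n → e i x * E (suc n ∸ i) y ≈ e i x * E (n ∸ i) y + e i x * e (n ∸ i) y
    term i i≤n = trans (reflexive (≡.cong (λ l → e i x * E l y) (ℕ.+-∸-assoc 1 i≤n)))
      (solve 3 (λ a b c → a :* (b :+ c) := a :* b :+ a :* c) refl (e i x) (E (n ∸ i) y) (e (n ∸ i) y))
    last : e n x * E (suc n ∸ n) y ≈ e n x * e (n ∸ n) y
    last = trans (reflexive (≡.cong (λ l → e n x * E l y) (ℕ.m+n∸n≡m 1 n)))
      (trans (*-cong refl (+-identityˡ _)) (reflexive (≡.cong (λ l → e n x * e l y) (≡.sym (ℕ.n∸n≡0 n)))))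

  -- The square i, j < n minus the triangle i + j < n, row by row.
  E-product : ∀ n x y → E n x * E n y - E n (x + y) ≈ ∑ n (λ i → e i x * (E n y - E (n ∸ i) y))
  E-product n x y = begin
    E n x * E n y - E n (x + y)
      ≈⟨ +-cong (trans (*-comm (E n x) (E n y)) (sym (∑-*ˡ n (E n y) (λ i → e i x)))) (-‿cong (sym (E-+ n x y))) ⟩
    ∑ n (λ i → E n y * e i x) - ∑ n (λ i → e i x * E (n ∸ i) y)
      ≈⟨ +-cong refl (trans (solve 1 (λ a → :- a := (:- con 1ℚ) :* a) refl (∑ n (λ i → e i x * E (n ∸ i) y)))
           (sym (∑-*ˡ n (- 1#) (λ i → e i x * E (n ∸ i) y)))) ⟩
    ∑ n (λ i → E n y * e i x) + ∑ n (λ i → - 1# * (e i x * E (n ∸ i) y))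
      ≈⟨ sym (∑-+ n (λ i → E n y * e i x) (λ i → - 1# * (e i x * E (n ∸ i) y))) ⟩
    ∑ n (λ i → E n y * e i x + - 1# * (e i x * E (n ∸ i) y))
      ≈⟨ ∑-cong n (λ i _ → solve 3 (λ a b c → a :* b :+ (:- con 1ℚ) :* (b :* c) := b :* (a :- c)) refl
           (E n y) (e i x) (E (n ∸ i) y)) ⟩
    ∑ n (λ i → e i x * (E n y - E (n ∸ i) y))   ∎
    where open import Relation.Binary.Reasoning.Setoid setoid

  -- The terms in the square outside the triangle are dominated by those for b and c. These are
  -- nonnegative, and the square fits into the triangle of side 2n.
  E-product-abs : ∀ n {x y b c} → ∣ x ∣≤ b → ∣ y ∣≤ c →
    ∣ E n x * E n y - E n (x + y) ∣≤ E (n ℕ.+ n) (b + c) - E n (b + c)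
  E-product-abs n {x} {y} {b} {c} p q = abs-cong (sym (E-product n x y))
    (abs-≤ (≤-trans (≤-reflexive (sym (E-product n b c))) (+-mono-≤ product≤ ≤-refl))
      (abs-∑ n (λ i _ → abs-* (e-abs i p) (E-diff-abs (ℕ.m∸n≤m n i) q))))
    where
    b≥0 = abs⇒nonNeg p
    c≥0 = abs⇒nonNeg q
    product≤ : E n b * E n c ≤ E (n ℕ.+ n) (b + c)
    product≤ = ≤-respˡ (*-comm (E n c) (E n b)) (≤-respˡ (∑-*ˡ n (E n c) (λ i → e i b)) (≤-respʳ (E-+ (n ℕ.+ n) b c)
      (≤-trans (∑-mono n (λ i i<n → ≤-respˡ (*-comm (e i b) (E n c)) (*-monoˡ-≤ (e-nonNeg i b≥0)
          (∑-extend (n≤ i (ℕ.<⇒≤ i<n)) (λ k → e-nonNeg k c≥0)))))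
        (∑-extend (ℕ.m≤m+n n n) (λ i → *-nonNeg (e-nonNeg i b≥0) (E-nonNeg (n ℕ.+ n ∸ i) c≥0))))))
      where
      n≤ : ∀ i → i ℕ.≤ n → n ℕ.≤ n ℕ.+ n ∸ i
      n≤ i i≤n = ℕ.≤-trans (ℕ.m≤m+n n (n ∸ i)) (ℕ.≤-reflexive (≡.sym (ℕ.+-∸-assoc n i≤n)))

  -- K is twice an integer bound for z, so from K on each term is at most half of its predecessor.
  module Tail (z : Carrier) (z≥0 : 0# ≤ z) where
    private
      c K : ℕ
      c = proj₁ (≤-nat (proj₁ (bounded z)))
      K = c ℕ.+ c

      z≤c : z ≤ ♯ c
      z≤c = ≤-trans (proj₂ (bounded z)) (ι-mono (proj₂ (≤-nat (proj₁ (bounded z)))))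

    e-halves : ∀ k → K ℕ.≤ k → e (suc k) z + e (suc k) z ≤ e k z
    e-halves k K≤k = *-cancel-≤ (♯-pos k) (≤-respˡ
        (sym (trans (solve 2 (λ a b → a :* (b :+ b) := a :* b :+ a :* b) refl (♯ (suc k)) (e (suc k) z))
          (trans (+-cong (e-suc k z) (e-suc k z)) (solve 2 (λ a b → a :* b :+ a :* b := b :* (a :+ a)) refl z (e k z)))))
        (≤-respʳ (*-comm (e k z) (♯ (suc k))) (*-monoˡ-≤ (e-nonNeg k z≥0)
          (≤-trans (+-mono-≤ z≤c z≤c) (≤-respˡ (♯-+ c c) (♯-≤ (ℕ.m≤n⇒m≤1+n K≤k)))))))

    -- The subtracted last term lets the induction close: `e-halves` pays for the next term out of
    -- it.
    tail : ∀ n → K ℕ.≤ n → ∀ j → E (n ℕ.+ j) z - E n z ≤ (e n z + e n z) - (e (n ℕ.+ j) z + e (n ℕ.+ j) z)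
    tail n K≤n zero = ≤-reflexive (trans
      (reflexive (≡.cong (λ m → E m z - E n z) (ℕ.+-identityʳ n)))
      (trans (solve 2 (λ a b → a :- a := (b :+ b) :- (b :+ b)) refl (E n z) (e n z))
        (reflexive (≡.cong (λ m → (e n z + e n z) - (e m z + e m z)) (≡.sym (ℕ.+-identityʳ n))))))
    tail n K≤n (suc j) = ≡.subst (λ m → E m z - E n z ≤ (e n z + e n z) - (e m z + e m z)) (≡.sym (ℕ.+-suc n j))
      (≤-by (+-mono-≤ (tail n K≤n j) (e-halves (n ℕ.+ j) (ℕ.≤-trans K≤n (ℕ.m≤m+n n j))))
        (solve 5 (λ a b p q r → (((p :+ p) :- (q :+ q)) :+ q) :- ((a :- b) :+ (r :+ r))
           := ((p :+ p) :- (r :+ r)) :- ((a :+ q) :- b)) refl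
          (E (n ℕ.+ j) z) (E n z) (e n z) (e (n ℕ.+ j) z) (e (suc (n ℕ.+ j)) z)))

    tail≤ : ∀ n → K ℕ.≤ n → ∀ j → E (n ℕ.+ j) z - E n z ≤ e n z + e n z
    tail≤ n K≤n j = ≤-trans (tail n K≤n j) (≤-byˡ (+-nonNeg h h)
        (solve 2 (λ a b → b :+ b := (a :+ a) :- ((a :+ a) :- (b :+ b))) refl (e n z) (e (n ℕ.+ j) z)))
      where h = e-nonNeg (n ℕ.+ j) z≥0

    -- Halving beats the factor 1 / (j + 1), because j + 2 ≤ 2 (j + 1). This crude rate already
    -- gives a null sequence.
    e-decay : ∀ j → ♯ (suc j) * e (j ℕ.+ K) z ≤ e K z
    e-decay zero = ≤-reflexive (trans (*-cong (trans (♯-suc 0) (+-identityˡ 1#)) refl) (*-identityˡ (e K z)))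
    e-decay (suc j) = ≤-trans (≤-respˡ (*-cong (sym (♯-suc (suc j))) refl) (≤-by
        (+-mono-≤ (*-monoˡ-≤ (♯-nonNeg (suc j)) (e-halves (j ℕ.+ K) (ℕ.m≤n+m K j)))
          (*-nonNeg (♯-nonNeg j) (e-nonNeg (suc (j ℕ.+ K)) z≥0)))
        (trans (+-cong refl (-‿cong (+-cong (*-cong (♯-suc j) refl) refl)))
          (trans (solve 4 (λ a s x y → (a :* x :+ s :* y) :- ((s :+ con 1ℚ) :* (y :+ y) :+ con 0ℚ)
            := a :* x :- ((s :+ con 1ℚ) :+ con 1ℚ) :* y) refl (♯ (suc j)) (♯ j) (e (j ℕ.+ K) z) (e (suc (j ℕ.+ K)) z))
            (+-cong refl (-‿cong (*-cong (+-cong (sym (♯-suc j)) refl) refl)))))))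
      (e-decay j)

    e-null : ∀ ε → 0ℚ ℚ.< ε → Eventually λ n → K ℕ.≤ n × e n z + e n z ≤ ι ε
    e-null ε ε>0 =
      let b , large = unbounded (ι-pos ε>0) (e K z + e K z)
          q , b≤q = bounded b
          J , q≤J = ≤-nat q
          close : ∀ j → J ℕ.≤ j → e (j ℕ.+ K) z + e (j ℕ.+ K) z ≤ ι ε
          close j J≤j = *-cancel-≤ (♯-pos j) (≤-trans (≤-by (+-mono-≤ (e-decay j) (e-decay j))
              (solve 3 (λ a x y → (y :+ y) :- (a :* x :+ a :* x) := (y :+ y) :- a :* (x :+ x)) refl
                (♯ (suc j)) (e (j ℕ.+ K) z) (e K z)))
            (≤-trans (<⇒≤ large) (≤-respʳ (*-comm (ι ε) (♯ (suc j))) (*-monoˡ-≤ (ι-mono (ℚ.<⇒≤ ε>0))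
              (≤-trans b≤q (≤-trans (ι-mono q≤J) (♯-≤ (ℕ.m≤n⇒m≤1+n J≤j))))))))
      in J ℕ.+ K , λ n J+K≤n → let K≤n = ℕ.≤-trans (ℕ.m≤n+m K J) J+K≤n in
        K≤n , ≡.subst (λ m → e m z + e m z ≤ ι ε) (ℕ.m∸n+n≡m K≤n)
          (close (n ∸ K) (ℕ.≤-trans (ℕ.≤-reflexive (≡.sym (ℕ.m+n∸n≡m J K))) (ℕ.∸-monoˡ-≤ K J+K≤n)))

    E-bounded : BoundedSeq (λ n → E n z)
    E-bounded =
      let b , b>0 , h = abs-bound (E K z + (e K z + e K z))
      in b , b>0 , K , λ n K≤n → abs-≤ (≤-trans (≤-by (tail≤ K ℕ.≤-refl (n ∸ K))
           (trans (+-cong refl (-‿cong (+-cong (reflexive (≡.cong (λ m → E m z) (ℕ.m+[n∸m]≡n K≤n))) refl)))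
             (solve 3 (λ a b c → (b :+ b) :- (c :- a) := (a :+ (b :+ b)) :- c) refl (E K z) (e K z) (E n z)))) (proj₁ h))
         (abs-nonNeg (E-nonNeg n z≥0))

  exp-product : ∀ x y → (λ n → E n x * E n y - E n (x + y)) ⟶ 0#
  exp-product x y ε ε>0 =
    let b , _ , x≤b = abs-bound x
        c , _ , y≤c = abs-bound y
        module T = Tail (ι b + ι c) (+-nonNeg (abs⇒nonNeg x≤b) (abs⇒nonNeg y≤c))
    in ev-map (λ n (K≤n , h) → abs-cong (solve 1 (λ a → a := a :- con 0ℚ) refl _)
         (abs-≤ (≤-trans (T.tail≤ n K≤n n) h) (E-product-abs n x≤b y≤c))) (T.e-null ε ε>0)

  IsExp : Carrier → Carrier → Set
  IsExp x z = (λ n → E n x) ⟶ z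

  exp-cong : ∀ {x y z w} → x ≈ y → z ≈ w → IsExp x z → IsExp y w
  exp-cong p q = ⟶-cong (λ n → E-cong n p) q

  exp-+ : ∀ {x y z w} → IsExp x z → IsExp y w → IsExp (x + y) (z * w)
  exp-+ {x} {y} {z} {w} p q = ⟶-cong (λ n → solve 2 (λ a b → a :- (a :- b) := b) refl (E n x * E n y) (E n (x + y)))
    (solve 1 (λ a → a :- con 0ℚ := a) refl (z * w)) (⟶-+ (⟶-* p q) (⟶-neg (exp-product x y)))

  exp-0 : IsExp 0# 1#
  exp-0 ε ε>0 = 1 , λ { (suc n) _ → abs-cong (sym (trans (+-cong (E0 n) refl) (solve 0 (con 1ℚ :- con 1ℚ := con 0ℚ) refl)))
      (abs-≤ (ι-mono (ℚ.<⇒≤ ε>0)) (abs-nonNeg ≤-refl)) }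
    where
    E0 : ∀ n → E (suc n) 0# ≈ 1#
    E0 n = trans (∑-head n (λ k → e k 0#)) (trans (+-cong (*-identityʳ 1#)
      (trans (∑-cong n {b = λ _ → 0# * 0#} (λ i _ → trans
        (solve 2 (λ a b → a :* (con 0ℚ :* b) := con 0ℚ :* con 0ℚ) refl (ι (1/ suc i !)) (0# ^ i)) refl)) (trans (∑-*ˡ n 0# (λ _ → 0#)) (zeroˡ _))))
      (+-identityʳ 1#))

  -- Convergence at - x is part of the conclusion. Since z w = 1, E(- x) equals ((z - E x) E(- x) +
  -- (E x E(- x) - 1)) w + w, and the bracket tends to 0 because E(- x) stays bounded.
  exp-neg : ∀ {x z w} → IsExp x z → z * w ≈ 1# → IsExp (- x) w
  exp-neg {x} {z} {w} p zw≈1 = ⟶-cong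
      (λ n → solve 4 (λ z w a b → (((z :- a) :* b :+ (a :* b :- con 1ℚ)) :* w) :+ w := (z :* w) :* b) refl z w (E n x) (E n (- x)))
      refl step
    |> ⟶-cong (λ n → trans (*-cong zw≈1 refl) (*-identityˡ (E n (- x)))) (+-identityˡ w)
    where
    infixl 0 _|>_
    _|>_ : {A B : Set} → A → (A → B) → B
    a |> f = f a
    b = proj₁ (abs-bound x)
    x≤b = proj₂ (proj₂ (abs-bound x))
    bdd : BoundedSeq (λ n → E n (- x))
    bdd = let c , c>0 , h = Tail.E-bounded (ι b) (abs⇒nonNeg x≤b)
          in c , c>0 , ev-map (λ n g → abs-≤ (proj₁ g) (E-abs n (abs-neg x≤b))) h
    product : (λ n → E n x * E n (- x) - 1#) ⟶ 0#
    product = ⟶-cong (λ n → solve 3 (λ p s o → (p :- s) :+ (s :- o) := p :- o) refl (E n x * E n (- x)) (E n (x + - x)) 1#)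
      (+-identityˡ 0#) (⟶-+ (exp-product x (- x)) (⟶-diff (exp-cong (solve 1 (λ x → con 0ℚ := x :- x) refl x) refl exp-0)))
    step : (λ n → (((z - E n x) * E n (- x)) + (E n x * E n (- x) - 1#)) * w + w) ⟶ 0# + w
    step = ⟶-+ (null-* (⟶-cong (λ _ → refl) (+-identityˡ 0#) (⟶-+ (null-* (⟶-cong
        (λ n → solve 2 (λ a z → :- (a :- z) := z :- a) refl (E n x) z) (solve 0 (:- con 0ℚ := con 0ℚ) refl) (⟶-neg (⟶-diff p))) bdd) product))
      (const-bounded w)) (⟶-const w)

  -- Suppose c = x - y > 0. The first two terms give E n c ≥ 1 + c for n ≥ 2, while E n c * E n y
  -- tends to z by `exp-product`. Hence (1 + c) z ≤ z, against z > 0.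
  exp-reflects-≤ : ∀ {x y z} → IsExp x z → IsExp y z → 0# < z → x ≤ y
  exp-reflects-≤ {x} {y} {z} p q z>0 = ≮⇒≥ λ y<x →
    let c>0 : 0# < x - y
        c>0 h = y<x (≤-by h (solve 2 (λ x y → con 0ℚ :- (x :- y) := y :- x) refl x y))
        limit : (λ n → E n (x - y) * E n y) ⟶ z
        limit = ⟶-cong (λ n → trans (+-cong refl (E-cong n (solve 2 (λ x y → x := (x :- y) :+ y) refl x y)))
              (solve 2 (λ a b → (a :- b) :+ b := a) refl (E n (x - y) * E n y) (E n ((x - y) + y))))
            (+-identityˡ z) (⟶-+ (exp-product (x - y) y) p)
        δ , δ>0 , δ≤z = positive-bound z>0
        Ey≥0 : Eventually λ n → 0# ≤ E n y
        Ey≥0 = ev-map (λ n h → ≤-by (+-mono-≤ (proj₂ h) δ≤z)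
            (solve 3 (λ d a z → (d :+ z) :- (:- (a :- z) :+ d) := a :- con 0ℚ) refl (ι δ) (E n y) z)) (q δ δ>0)
        E≥1+c : ∀ n → 2 ℕ.≤ n → 1# + (x - y) ≤ E n (x - y)
        E≥1+c n 2≤n = ≤-trans (≤-reflexive (solve 1 (λ c → con 1ℚ :+ c
            := (con 0ℚ :+ con 1ℚ :* con 1ℚ) :+ con 1ℚ :* (c :* con 1ℚ)) refl (x - y)))
          (∑-extend 2≤n (λ k → e-nonNeg k (<⇒≤ c>0)))
        below : Eventually λ n → (1# + (x - y)) * E n y ≤ E n (x - y) * E n y
        below = ev-map₂ (λ n a b → ≤-respˡ (*-comm (E n y) _) (≤-respʳ (*-comm (E n y) _) (*-monoˡ-≤ a (E≥1+c n b))))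
          Ey≥0 (2 , λ n h → h)
    in *-pos c>0 z>0 (≤-by (⟶-≤ below (⟶-* (⟶-const (1# + (x - y))) q) limit)
         (solve 2 (λ c z → z :- (con 1ℚ :+ c) :* z := con 0ℚ :- c :* z) refl (x - y) z))

  exp-injective : ∀ {x y z} → IsExp x z → IsExp y z → 0# < z → x ≈ y
  exp-injective p q z>0 = ≤-antisym (exp-reflects-≤ p q z>0) (exp-reflects-≤ q p z>0)

  exp-multiple : ∀ {x z} n → IsExp x z → IsExp (♯ n * x) (z ^ n)
  exp-multiple {x} zero p = exp-cong (sym (zeroˡ x)) refl exp-0
  exp-multiple {x} {z} (suc n) p = exp-cong (trans (solve 2 (λ a x → x :+ a :* x := (a :+ con 1ℚ) :* x) refl (♯ n) x)
    (*-cong (sym (♯-suc n)) refl)) refl (exp-+ p (exp-multiple n p))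

  -- t stands for the number 3.
  module LogRatio (γ l₂ l₃ t : Carrier) (t>0 : 0# < t)
      (exp₂ : IsExp l₂ 2#) (exp₃ : IsExp l₃ t) (ratio : γ * l₃ ≈ l₂) where

    -- The logarithm l is an arbitrary witness, so injectivity is needed to identify it with n l₃;
    -- then γ l = n l₂.
    pow-3 : ∀ n {l y p} → IsExp l (t ^ n) → y ≈ γ * l → IsExp y p → p ≈ 2# ^ n
    pow-3 n {l} log y≈ pow = ⟶-unique pow (exp-cong (sym (trans y≈ (trans (*-cong refl l≈)
        (trans (solve 3 (λ γ a b → γ :* (a :* b) := a :* (γ :* b)) refl γ (♯ n) l₃) (*-cong refl ratio))))) refl
        (exp-multiple n exp₂))
      where
      l≈ : l ≈ ♯ n * l₃
      l≈ = exp-injective log (exp-multiple n exp₃) (^-pos t>0 n)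

    -- Here w stands for 3⁻ⁿ. Together with `pow-3-neg` it exhibits (3⁻ⁿ)^(-γ) = 2ⁿ, which makes the
    -- monotonicity hypothesis applicable at these radii.
    log-3 : ∀ n {y w} → y ≈ - (♯ n * l₃) → t ^ n * w ≈ 1# → IsExp y w
    log-3 n y≈ h = exp-cong (sym y≈) refl (exp-neg (exp-multiple n exp₃) h)

    pow-3-neg : ∀ n {y} → y ≈ (- γ) * (- (♯ n * l₃)) → IsExp y (2# ^ n)
    pow-3-neg n y≈ = exp-cong (sym (trans y≈ (trans
      (solve 3 (λ γ a b → (:- γ) :* (:- (a :* b)) := a :* (γ :* b)) refl γ (♯ n) l₃)
      (*-cong refl ratio)))) refl (exp-multiple n exp₂)

-- The Cauchy reals as a complete ordered field

module RealLine where
  open import Defs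
  open ≡ using (refl; sym; trans; cong; subst)
  open ℚ-Solver using (solve; con; _:+_; _:*_; _:-_; :-_; _:=_)

  ℚ-shift : ∀ {a b p q} → q ℚ.- p ≡ b ℚ.- a → b ≡ q ℚ.+ (a ℚ.- p)
  ℚ-shift {a} {b} {p} {q} e = trans (solve 2 (λ a b → b := (b :- a) :+ a) refl a b)
    (trans (cong (ℚ._+ a) (sym e)) (solve 3 (λ a p q → (q :- p) :+ a := q :+ (a :- p)) refl a p q))

  ℚ-≤-by : ∀ {a b p q} → p ℚ.≤ q → q ℚ.- p ≡ b ℚ.- a → a ℚ.≤ b
  ℚ-≤-by {a} {b} {p} {q} h e = ≡.subst₂ ℚ._≤_ (solve 2 (λ a p → p :+ (a :- p) := a) refl a p)
    (sym (ℚ-shift {p = p} {q = q} e)) (ℚ.+-monoˡ-≤ (a ℚ.- p) h)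

  ℚ-<-by : ∀ {a b p q} → p ℚ.< q → q ℚ.- p ≡ b ℚ.- a → a ℚ.< b
  ℚ-<-by {a} {b} {p} {q} h e = ≡.subst₂ ℚ._<_ (solve 2 (λ a p → p :+ (a :- p) := a) refl a p)
    (sym (ℚ-shift {p = p} {q = q} e)) (ℚ.+-monoˡ-< (a ℚ.- p) h)

  half : ℚ → ℚ
  half ε = ½ ℚ.* ε

  half-pos : ∀ {ε} → 0ℚ ℚ.< ε → 0ℚ ℚ.< half ε
  half-pos = ½-pos

  ∣∣≤ : ∀ {a b} → a ℚ.≤ b → ℚ.- a ℚ.≤ b → ℚ.∣ a ∣ ℚ.≤ b
  ∣∣≤ {a} p q with ℚ.∣p∣≡p∨∣p∣≡-p a
  ... | inj₁ e = subst (ℚ._≤ _) (sym e) p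
  ... | inj₂ e = subst (ℚ._≤ _) (sym e) q

  ∣∣< : ∀ {a b} → a ℚ.< b → ℚ.- a ℚ.< b → ℚ.∣ a ∣ ℚ.< b
  ∣∣< {a} p q with ℚ.∣p∣≡p∨∣p∣≡-p a
  ... | inj₁ e = subst (ℚ._< _) (sym e) p
  ... | inj₂ e = subst (ℚ._< _) (sym e) q

  -p≤∣p∣ : ∀ p → ℚ.- p ℚ.≤ ℚ.∣ p ∣
  -p≤∣p∣ p = subst (ℚ.- p ℚ.≤_) (ℚ.∣-p∣≡∣p∣ p) (p≤∣p∣ (ℚ.- p))

  ≤-pointwise : ∀ {x y} → (∀ n → seq x n ℚ.≤ seq y n) → x ≤ y
  ≤-pointwise {x} {y} h ε ε>0 = 0 , λ n _ → ℚ.≤-trans (h n)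
    (ℚ-≤-by (ℚ.<⇒≤ ε>0) (solve 2 (λ e y → e :- con 0ℚ := (y :+ e) :- y) refl ε (seq y n)))

  ≈-pointwise : ∀ {x y} → (∀ n → seq x n ≡ seq y n) → x ≈ y
  ≈-pointwise {x} {y} h ε ε>0 = 0 , λ n _ → subst (ℚ._< ε)
    (sym (trans (cong (λ z → ℚ.∣ seq x n ℚ.- z ∣) (sym (h n))) (cong ℚ.∣_∣ (ℚ.+-inverseʳ (seq x n))))) ε>0

  ≈⇒≤ : ∀ {x y} → x ≈ y → x ≤ y
  ≈⇒≤ {x} {y} h ε ε>0 = ev-map (λ n p → ℚ-≤-by (ℚ.≤-trans (p≤∣p∣ _) (ℚ.<⇒≤ p))
    (solve 3 (λ e x y → e :- (x :- y) := (y :+ e) :- x) refl ε (seq x n) (seq y n))) (h ε ε>0)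

  ≤-antisym : ∀ {x y} → x ≤ y → y ≤ x → x ≈ y
  ≤-antisym {x} {y} p q ε ε>0 = ev-map₂ (λ n a b → ∣∣<
      (bound a)
      (subst (ℚ._< ε) (solve 2 (λ x y → y :- x := :- (x :- y)) refl (seq x n) (seq y n)) (bound b)))
      (p (half ε) (half-pos ε>0)) (q (half ε) (half-pos ε>0))
    where
    bound : ∀ {a b} → a ℚ.≤ b ℚ.+ half ε → a ℚ.- b ℚ.< ε
    bound {a} {b} h = ℚ-<-by (ℚ.+-mono-≤-< h (half-pos ε>0))
      (solve 3 (λ a b e → ((b :+ con ½ :* e) :+ con ½ :* e) :- (a :+ con 0ℚ) := e :- (a :- b)) refl a b ε)

  ≈-sym : ∀ {x y} → x ≈ y → y ≈ x
  ≈-sym {x} {y} h ε ε>0 = ev-map (λ n → subst (ℚ._< ε) (trans (sym (ℚ.∣-p∣≡∣p∣ (seq x n ℚ.- seq y n)))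
    (cong ℚ.∣_∣ (solve 2 (λ x y → :- (x :- y) := y :- x) refl (seq x n) (seq y n))))) (h ε ε>0)

  ≤-trans : ∀ {x y z} → x ≤ y → y ≤ z → x ≤ z
  ≤-trans {x} {y} {z} p q ε ε>0 = ev-map₂ (λ n a b → ℚ-≤-by (ℚ.+-mono-≤ a b)
      (solve 4 (λ x y z e → ((y :+ con ½ :* e) :+ (z :+ con ½ :* e)) :- (x :+ y) := (z :+ e) :- x) refl
        (seq x n) (seq y n) (seq z n) ε))
    (p (half ε) (half-pos ε>0)) (q (half ε) (half-pos ε>0))

  ≈-trans : ∀ {x y z} → x ≈ y → y ≈ z → x ≈ z
  ≈-trans {x} {y} {z} p q = ≤-antisym {x} {z} (≤-trans {x} {y} {z} (≈⇒≤ {x} {y} p) (≈⇒≤ {y} {z} q))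
    (≤-trans {z} {y} {x} (≈⇒≤ {z} {y} (≈-sym {y} {z} q)) (≈⇒≤ {y} {x} (≈-sym {x} {y} p)))

  +-mono-≤ : ∀ {x y z w} → x ≤ y → z ≤ w → x + z ≤ y + w
  +-mono-≤ {x} {y} {z} {w} p q ε ε>0 = ev-map₂ (λ n a b → ℚ-≤-by (ℚ.+-mono-≤ a b)
      (solve 5 (λ x y z w e → ((y :+ con ½ :* e) :+ (w :+ con ½ :* e)) :- (x :+ z)
        := ((y :+ w) :+ e) :- (x :+ z)) refl (seq x n) (seq y n) (seq z n) (seq w n) ε))
    (p (half ε) (half-pos ε>0)) (q (half ε) (half-pos ε>0))

  +-cong : ∀ {x y z w} → x ≈ y → z ≈ w → x + z ≈ y + w
  +-cong {x} {y} {z} {w} p q = ≤-antisym {x + z} {y + w}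
    (+-mono-≤ {x} {y} {z} {w} (≈⇒≤ {x} {y} p) (≈⇒≤ {z} {w} q))
    (+-mono-≤ {y} {x} {w} {z} (≈⇒≤ {y} {x} (≈-sym {x} {y} p)) (≈⇒≤ {w} {z} (≈-sym {z} {w} q)))

  -‿cong : ∀ {x y} → x ≈ y → - x ≈ - y
  -‿cong {x} {y} h ε ε>0 = ev-map (λ n → subst (ℚ._< ε) (trans (sym (ℚ.∣-p∣≡∣p∣ (seq x n ℚ.- seq y n)))
    (cong ℚ.∣_∣ (solve 2 (λ x y → :- (x :- y) := (:- x) :- (:- y)) refl (seq x n) (seq y n))))) (h ε ε>0)

  eventually-bounded : ∀ x → ∃[ b ] ℚ.Positive b × Eventually (λ n → ℚ.∣ seq x n ∣ ℚ.≤ b)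
  eventually-bounded x = b , ℚ.nonNeg+pos⇒pos ℚ.∣ a ∣ {{ℚ.∣-∣-nonNeg a}} 1ℚ , N , close
    where
    N = proj₁ (cauchy x 1ℚ (ℚ.positive⁻¹ 1ℚ))
    a b : ℚ
    a = seq x N
    b = ℚ.∣ a ∣ ℚ.+ 1ℚ
    close : ∀ n → N ℕ.≤ n → ℚ.∣ seq x n ∣ ℚ.≤ b
    close n n≥N = subst (λ t → ℚ.∣ t ∣ ℚ.≤ b) (solve 2 (λ a x → a :+ (x :- a) := x) refl a (seq x n))
      (ℚ.≤-trans (ℚ.∣p+q∣≤∣p∣+∣q∣ a (seq x n ℚ.- a))
        (ℚ.+-monoʳ-≤ ℚ.∣ a ∣ (ℚ.<⇒≤ (proj₂ (cauchy x 1ℚ (ℚ.positive⁻¹ 1ℚ)) n N n≥N ℕ.≤-refl))))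

  ι-bound : ∀ x → ∃[ q ] x ≤ ι q
  ι-bound x = let b , _ , N , p = eventually-bounded x in
    b , λ ε ε>0 → N , λ n n≥N → ℚ.≤-trans (p≤∣p∣ (seq x n)) (ℚ.≤-trans (p n n≥N)
      (ℚ-≤-by (ℚ.<⇒≤ ε>0) (solve 2 (λ e b → e :- con 0ℚ := (b :+ e) :- b) refl ε b)))

  ∣∣-*-< : ∀ {z y b δ} → ℚ.Positive b → ℚ.∣ z ∣ ℚ.< δ → ℚ.∣ y ∣ ℚ.≤ b → ℚ.∣ z ℚ.* y ∣ ℚ.< δ ℚ.* b
  ∣∣-*-< {z} {y} {b} b>0 p q = ℚ.≤-<-trans (ℚ.≤-reflexive (ℚ.∣p*q∣≡∣p∣*∣q∣ z y))
    (ℚ.≤-<-trans (ℚ.*-monoˡ-≤-nonNeg ℚ.∣ z ∣ {{ℚ.∣-∣-nonNeg z}} q) (ℚ.*-monoˡ-<-pos b {{b>0}} p))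

  null-* : ∀ {z} y → z ≈ 0ℝ → z * y ≈ 0ℝ
  null-* {z} y h ε ε>0 =
    let b , b>0 , bd = eventually-bounded y
        δ , δ>0 , δb≡ε = divide b (ℚ.positive⁻¹ b {{b>0}}) ε ε>0
    in ev-map₂ (λ n p q → subst (ℚ.∣ seq z n ℚ.* seq y n ℚ.- 0ℚ ∣ ℚ.<_) δb≡ε
         (subst (λ t → ℚ.∣ t ∣ ℚ.< δ ℚ.* b) (sym (ℚ.+-identityʳ (seq z n ℚ.* seq y n)))
           (∣∣-*-< b>0 (subst (λ t → ℚ.∣ t ∣ ℚ.< δ) (ℚ.+-identityʳ (seq z n)) p) q)))
       (h δ δ>0) bd

  -- x z - y w = (x - y) z + (z - w) y, and a null sequence times a bounded one is null.
  *-cong : ∀ {x y z w} → x ≈ y → z ≈ w → x * z ≈ y * w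
  *-cong {x} {y} {z} {w} p q = ≈-trans {x * z} {y * w + ((x - y) * z + (z - w) * y)} {y * w}
    (≈-pointwise {x * z} {y * w + ((x - y) * z + (z - w) * y)} λ n →
      solve 4 (λ x y z w → x :* z := y :* w :+ ((x :- y) :* z :+ (z :- w) :* y)) refl
      (seq x n) (seq y n) (seq z n) (seq w n))
    (≈-trans {y * w + ((x - y) * z + (z - w) * y)} {y * w + (0ℝ + 0ℝ)} {y * w}
      (+-cong {y * w} {y * w} {(x - y) * z + (z - w) * y} {0ℝ + 0ℝ} (≈-pointwise {y * w} {y * w} (λ _ → refl))
        (+-cong {(x - y) * z} {0ℝ} {(z - w) * y} {0ℝ} (null-* {x - y} z (diff x y p)) (null-* {z - w} y (diff z w q))))
      (≈-pointwise {y * w + (0ℝ + 0ℝ)} {y * w} λ n → ℚ.+-identityʳ (seq y n ℚ.* seq w n)))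
    where
    diff : ∀ x y → x ≈ y → x - y ≈ 0ℝ
    diff x y h ε ε>0 = ev-map (λ n → subst (λ t → ℚ.∣ t ∣ ℚ.< ε)
      (solve 2 (λ x y → x :- y := (x :- y) :- con 0ℚ) refl (seq x n) (seq y n))) (h ε ε>0)

  ≈∣∣ : ∀ {x} → 0ℝ ≤ x → x ≈ ∣ x ∣
  ≈∣∣ {x} h = ≤-antisym {x} {∣ x ∣} (≤-pointwise {x} {∣ x ∣} (λ n → p≤∣p∣ (seq x n))) λ ε ε>0 →
    ev-map (λ n p → ∣∣≤
      (ℚ-≤-by (ℚ.<⇒≤ ε>0) (solve 2 (λ e x → e :- con 0ℚ := (x :+ e) :- x) refl ε (seq x n)))
      (ℚ-≤-by (ℚ.+-mono-≤ p p) (solve 2 (λ e x → ((x :+ con ½ :* e) :+ (x :+ con ½ :* e)) :- (con 0ℚ :+ con 0ℚ)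
        := (x :+ e) :- (:- x)) refl ε (seq x n))))
    (h (half ε) (half-pos ε>0))

  -- A nonnegative real may have negative terms, so both factors are first replaced by their
  -- absolute values.
  *-nonNeg : ∀ {x y} → 0ℝ ≤ x → 0ℝ ≤ y → 0ℝ ≤ x * y
  *-nonNeg {x} {y} p q = ≤-trans {0ℝ} {∣ x ∣ * ∣ y ∣} {x * y}
    (≤-pointwise {0ℝ} {∣ x ∣ * ∣ y ∣} λ n → subst (0ℚ ℚ.≤_) (ℚ.∣p*q∣≡∣p∣*∣q∣ (seq x n) (seq y n))
      (ℚ.0≤∣p∣ (seq x n ℚ.* seq y n)))
    (≈⇒≤ {∣ x ∣ * ∣ y ∣} {x * y} (*-cong {∣ x ∣} {x} {∣ y ∣} {y}
      (≈-sym {x} {∣ x ∣} (≈∣∣ {x} p)) (≈-sym {y} {∣ y ∣} (≈∣∣ {y} q))))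

  <⇒≤ : ∀ {x y} → x < y → x ≤ y
  <⇒≤ {x} {y} (ε , ε>0 , N , p) δ δ>0 = N , λ n n≥N → ℚ-≤-by (ℚ.+-mono-≤ (p n n≥N) (ℚ.+-mono-≤ (ℚ.<⇒≤ ε>0) (ℚ.<⇒≤ δ>0)))
    (solve 4 (λ x y e d → (y :+ (e :+ d)) :- ((x :+ e) :+ (con 0ℚ :+ con 0ℚ)) := (y :+ d) :- x) refl (seq x n) (seq y n) ε δ)

  <⇒≱ : ∀ {x y} → x < y → ¬ (y ≤ x)
  <⇒≱ {x} {y} (ε , ε>0 , N , p) h with h (half ε) (half-pos ε>0)
  ... | M , q = ℚ-<⇒≱ (half-pos ε>0) (ℚ-≤-by (ℚ.+-mono-≤ (p n (ℕ.m≤m⊔n N M)) (q n (ℕ.m≤n⊔m N M)))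
      (solve 3 (λ x y e → (y :+ (x :+ con ½ :* e)) :- ((x :+ e) :+ y) := con 0ℚ :- con ½ :* e) refl (seq x n) (seq y n) ε))
    where n = N ℕ.⊔ M

  -- From k on both sequences vary by less than ε / 8, so a single comparison in ℚ at index k
  -- decides: either y stays below x + ε, or it exceeds x by ε / 4 throughout.
  ≮⇒≥ : ∀ {x y} → ¬ (x < y) → y ≤ x
  ≮⇒≥ {x} {y} ¬x<y ε ε>0 with cauchy x (half (half (half ε))) (half-pos (half-pos (half-pos ε>0)))
                            | cauchy y (half (half (half ε))) (half-pos (half-pos (half-pos ε>0)))
  ... | M , p | N , q = k , decide (ℚ.≤-total (seq y k) (seq x k ℚ.+ half ε))
    where
    k = M ℕ.⊔ N
    M≤k = ℕ.m≤m⊔n M N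
    N≤k = ℕ.m≤n⊔m M N
    r = half (half ε)
    r>0 = half-pos (half-pos ε>0)
    bound : ∀ {a} → ℚ.∣ a ∣ ℚ.< half r → a ℚ.≤ half r
    bound h = ℚ.≤-trans (p≤∣p∣ _) (ℚ.<⇒≤ h)
    decide : seq y k ℚ.≤ seq x k ℚ.+ half ε ⊎ seq x k ℚ.+ half ε ℚ.≤ seq y k →
      ∀ n → k ℕ.≤ n → seq y n ℚ.≤ seq x n ℚ.+ ε
    decide (inj₁ h) n n≥k = ℚ-≤-by
      (ℚ.+-mono-≤ h (ℚ.+-mono-≤ (ℚ.<⇒≤ r>0) (ℚ.+-mono-≤
          (bound (p k n M≤k (ℕ.≤-trans M≤k n≥k)))
          (bound (q n k (ℕ.≤-trans N≤k n≥k) N≤k)))))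
      (solve 5 (λ a b x y e →
         let r = con ½ :* (con ½ :* e) in
         ((a :+ con ½ :* e) :+ (r :+ (con ½ :* r :+ con ½ :* r)))
             :- (b :+ (con 0ℚ :+ ((a :- x) :+ (y :- b)))) := (x :+ e) :- y) refl (seq x k) (seq y k) (seq x n) (seq y n) ε)
    decide (inj₂ h) = ⊥-elim (¬x<y (r , r>0 , k , λ n n≥k → ℚ-≤-by (ℚ.+-mono-≤ h (ℚ.+-mono-≤
          (bound (p n k (ℕ.≤-trans M≤k n≥k) M≤k))
          (bound (q k n N≤k (ℕ.≤-trans N≤k n≥k)))))
        (solve 5 (λ a b x y e →
           let r = con ½ :* (con ½ :* e) in
           (b :+ (con ½ :* r :+ con ½ :* r)) :- ((a :+ con ½ :* e) :+ ((x :- a) :+ (b :- y)))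
             := y :- (x :+ r)) refl (seq x k) (seq y k) (seq x n) (seq y n) ε)))

  closed : ∀ {x y} → (∀ ε → 0ℚ ℚ.< ε → x ≤ y + ι ε) → x ≤ y
  closed {x} {y} h ε ε>0 = ev-map (λ n p → ℚ-≤-by p
      (solve 3 (λ x y e → ((y :+ con ½ :* e) :+ con ½ :* e) :- x := (y :+ e) :- x) refl (seq x n) (seq y n) ε))
    (h (half ε) (half-pos ε>0) (half ε) (half-pos ε>0))

  ι-cancel : ∀ {p q} → ι p ≤ ι q → p ℚ.≤ q
  ι-cancel {p} {q} h with p ℚ.≤? q
  ... | yes p≤q = p≤q
  ... | no p≰q = ⊥-elim (<⇒≱ {ι q} {ι p}
      (ε , ε>0 , 0 , λ n _ → ℚ.≤-reflexive (solve 2 (λ p q → q :+ (p :- q) := p) refl p q)) h)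
    where
    ε = p ℚ.- q
    ε>0 : 0ℚ ℚ.< ε
    ε>0 = ℚ-<-by (ℚ.≰⇒> p≰q) (solve 2 (λ p q → p :- q := (p :- q) :- con 0ℚ) refl p q)

  module _ (em : ExcludedMiddle 0ℓ) where

    ≤-total : ∀ x y → x ≤ y ⊎ y ≤ x
    ≤-total x y with em {x < y}
    ... | yes p = inj₁ (<⇒≤ {x} {y} p)
    ... | no ¬p = inj₂ (≮⇒≥ {x} {y} ¬p)

    ≱⇒< : ∀ {x y} → ¬ (y ≤ x) → x < y
    ≱⇒< {x} {y} h with em {x < y}
    ... | yes p = p
    ... | no ¬p = ⊥-elim (h (≮⇒≥ {x} {y} ¬p))

    ℝ-field : RealField
    ℝ-field = record
      { Carrier = ℝ ; _≈_ = _≈_ ; _≤_ = _≤_ ; _+_ = _+_ ; _*_ = _*_ ; -_ = -_ ; ι = ι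
      ; isCommutativeRing = record
        { isRing = record
          { +-isAbelianGroup = record
            { isGroup = record
              { isMonoid = record
                { isSemigroup = record
                  { isMagma = record
                    { isEquivalence = record
                      { refl = λ {x} → ≈-pointwise {x} {x} (λ _ → refl)
                      ; sym = λ {x} {y} → ≈-sym {x} {y}
                      ; trans = λ {x} {y} {z} → ≈-trans {x} {y} {z} }
                    ; ∙-cong = λ {x} {y} {z} {w} → +-cong {x} {y} {z} {w} }
                  ; assoc = λ x y z → ≈-pointwise {(x + y) + z} {x + (y + z)} λ n → ℚ.+-assoc (seq x n) (seq y n) (seq z n) }
                ; identity = (λ x → ≈-pointwise {0ℝ + x} {x} λ n → ℚ.+-identityˡ (seq x n))
                           , (λ x → ≈-pointwise {x + 0ℝ} {x} λ n → ℚ.+-identityʳ (seq x n)) }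
              ; inverse = (λ x → ≈-pointwise {(- x) + x} {0ℝ} λ n → ℚ.+-inverseˡ (seq x n))
                        , (λ x → ≈-pointwise {x + (- x)} {0ℝ} λ n → ℚ.+-inverseʳ (seq x n))
              ; ⁻¹-cong = λ {x} {y} → -‿cong {x} {y} }
            ; comm = λ x y → ≈-pointwise {x + y} {y + x} λ n → ℚ.+-comm (seq x n) (seq y n) }
          ; *-cong = λ {x} {y} {z} {w} → *-cong {x} {y} {z} {w}
          ; *-assoc = λ x y z → ≈-pointwise {(x * y) * z} {x * (y * z)} λ n → ℚ.*-assoc (seq x n) (seq y n) (seq z n)
          ; *-identity = (λ x → ≈-pointwise {1ℝ * x} {x} λ n → ℚ.*-identityˡ (seq x n))
                       , (λ x → ≈-pointwise {x * 1ℝ} {x} λ n → ℚ.*-identityʳ (seq x n))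
          ; distrib = (λ x y z → ≈-pointwise {x * (y + z)} {x * y + x * z} λ n → ℚ.*-distribˡ-+ (seq x n) (seq y n) (seq z n))
                    , (λ x y z → ≈-pointwise {(y + z) * x} {y * x + z * x} λ n → ℚ.*-distribʳ-+ (seq x n) (seq y n) (seq z n)) }
        ; *-comm = λ x y → ≈-pointwise {x * y} {y * x} λ n → ℚ.*-comm (seq x n) (seq y n) }
      ; ι-+ = λ p q → ≈-pointwise {ι (p ℚ.+ q)} {ι p + ι q} λ _ → refl
      ; ι-* = λ p q → ≈-pointwise {ι (p ℚ.* q)} {ι p * ι q} λ _ → refl
      ; ι-neg = λ p → ≈-pointwise {ι (ℚ.- p)} { - ι p} λ _ → refl
      ; ι-mono = λ {p} {q} h → ≤-pointwise {ι p} {ι q} λ _ → h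
      ; ι-cancel = ι-cancel
      ; ≤-reflexive = λ {x} {y} → ≈⇒≤ {x} {y}
      ; ≤-trans = λ {x} {y} {z} → ≤-trans {x} {y} {z}
      ; ≤-antisym = λ {x} {y} → ≤-antisym {x} {y}
      ; ≤-total = ≤-total
      ; +-mono-≤ = λ {x} {y} {z} {w} → +-mono-≤ {x} {y} {z} {w}
      ; *-nonNeg = λ {x} {y} → *-nonNeg {x} {y}
      ; bounded = ι-bound
      ; closed = λ {x} {y} → closed {x} {y}
      }

  open Numerals

  nat-nonNeg : ∀ n → 0ℚ ℚ.≤ nat n
  nat-nonNeg zero = ℚ.≤-refl
  nat-nonNeg (suc n) = ℚ.+-mono-≤ (nat-nonNeg n) (ℚ.nonNegative⁻¹ 1ℚ)

  module _ (em : ExcludedMiddle 0ℓ) where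

    -- Suprema by bisection

    module Bisect (x : ℕ → ℝ) (b : ℝ) (x≤b : ∀ n → x n ≤ b) where
      Upper : ℚ → Set
      Upper q = ∀ n → x n ≤ ι q

      record Bracket : Set where
        field
          lo hi    : ℚ
          lo-upper : ¬ Upper lo
          hi-upper : Upper hi
      open Bracket

      lo≤hi : ∀ B → lo B ℚ.≤ hi B
      lo≤hi B with ℚ.≤-total (lo B) (hi B)
      ... | inj₁ p = p
      ... | inj₂ p = ⊥-elim (lo-upper B λ n →
        ≤-trans {x n} {ι (hi B)} {ι (lo B)} (hi-upper B n) (≤-pointwise {ι (hi B)} {ι (lo B)} (λ _ → p)))

      first : Bracket
      first = record { lo = l ; hi = proj₁ (ι-bound b) ; lo-upper = not ; hi-upper = λ n →
          ≤-trans {x n} {b} {ι (proj₁ (ι-bound b))} (x≤b n) (proj₂ (ι-bound b)) }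
        where
        q = proj₁ (ι-bound (- x 0))
        -- As - x 0 ≤ q, this number lies at least 1 below x 0 and cannot be an upper bound.
        l = ℚ.- q ℚ.- 1ℚ
        not : ¬ Upper l
        not h = ℚ-<⇒≱ (ℚ.positive⁻¹ 1ℚ) (ℚ-≤-by (ι-cancel {0ℚ} {q ℚ.+ l}
            (≤-trans {0ℝ} { - x 0 + x 0} {ι (q ℚ.+ l)}
              (≤-pointwise {0ℝ} { - x 0 + x 0} (λ n → ℚ.≤-reflexive (sym (ℚ.+-inverseˡ (seq (x 0) n)))))
              (+-mono-≤ { - x 0} {ι q} {x 0} {ι l} (proj₂ (ι-bound (- x 0))) (h 0))))
          (solve 1 (λ q → (q :+ (:- q :- con 1ℚ)) :- con 0ℚ := con 0ℚ :- con 1ℚ) refl q))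

      mid : Bracket → ℚ
      mid B = ½ ℚ.* (lo B ℚ.+ hi B)

      halve : (B : Bracket) → Dec (Upper (mid B)) → Bracket
      halve B (yes u) = record { lo = lo B ; hi = mid B ; lo-upper = lo-upper B ; hi-upper = u }
      halve B (no ¬u) = record { lo = mid B ; hi = hi B ; lo-upper = ¬u ; hi-upper = hi-upper B }

      width : Bracket → ℚ
      width B = hi B ℚ.- lo B

      width-nonNeg : ∀ B → 0ℚ ℚ.≤ width B
      width-nonNeg B = ℚ-≤-by (lo≤hi B) (solve 2 (λ l h → h :- l := (h :- l) :- con 0ℚ) refl (lo B) (hi B))

      halve-width : ∀ B d → width (halve B d) ≡ ½ ℚ.* width B
      halve-width B (yes _) = solve 2 (λ l h → con ½ :* (l :+ h) :- l := con ½ :* (h :- l)) refl (lo B) (hi B)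
      halve-width B (no _)  = solve 2 (λ l h → h :- con ½ :* (l :+ h) := con ½ :* (h :- l)) refl (lo B) (hi B)

      ½width-nonNeg : ∀ B → 0ℚ ℚ.≤ ½ ℚ.* width B
      ½width-nonNeg B = subst (ℚ._≤ ½ ℚ.* width B) (ℚ.*-zeroʳ ½) (ℚ.*-monoˡ-≤-nonNeg ½ (width-nonNeg B))

      halve-lo : ∀ B d → lo B ℚ.≤ lo (halve B d)
      halve-lo B (yes _) = ℚ.≤-refl
      halve-lo B (no _)  = ℚ-≤-by (½width-nonNeg B)
        (solve 2 (λ l h → con ½ :* (h :- l) :- con 0ℚ := con ½ :* (l :+ h) :- l) refl (lo B) (hi B))

      halve-hi : ∀ B d → hi (halve B d) ℚ.≤ hi B
      halve-hi B (yes _) = ℚ-≤-by (½width-nonNeg B)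
        (solve 2 (λ l h → con ½ :* (h :- l) :- con 0ℚ := h :- con ½ :* (l :+ h)) refl (lo B) (hi B))
      halve-hi B (no _)  = ℚ.≤-refl

      bracket : ℕ → Bracket
      bracket zero    = first
      bracket (suc n) = halve (bracket n) em

      lo-mono : ∀ {m n} → m ℕ.≤ n → lo (bracket m) ℚ.≤ lo (bracket n)
      lo-mono {m} h = go (ℕ.≤⇒≤′ h)
        where
        go : ∀ {n} → m ℕ.≤′ n → lo (bracket m) ℚ.≤ lo (bracket n)
        go (ℕ.≤′-reflexive refl) = ℚ.≤-refl
        go {suc n} (ℕ.≤′-step p) = ℚ.≤-trans (go p) (halve-lo (bracket n) em)

      hi-anti : ∀ {m n} → m ℕ.≤ n → hi (bracket n) ℚ.≤ hi (bracket m)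
      hi-anti {m} h = go (ℕ.≤⇒≤′ h)
        where
        go : ∀ {n} → m ℕ.≤′ n → hi (bracket n) ℚ.≤ hi (bracket m)
        go (ℕ.≤′-reflexive refl) = ℚ.≤-refl
        go {suc n} (ℕ.≤′-step p) = ℚ.≤-trans (halve-hi (bracket n) em) (go p)

      -- (n + 2) / 2 ≤ n + 1
      width-decay : ∀ n → nat (suc n) ℚ.* width (bracket n) ℚ.≤ width first
      width-decay zero = ℚ.≤-reflexive (ℚ.*-identityˡ (width first))
      width-decay (suc n) = ℚ.≤-trans (ℚ.≤-reflexive (cong (nat (suc (suc n)) ℚ.*_) (halve-width (bracket n) em)))
        (ℚ.≤-trans (ℚ-≤-by (nonNeg* (nat-nonNeg n) (½width-nonNeg (bracket n)))
          (solve 2 (λ a w → a :* (con ½ :* w) :- con 0ℚ := (a :+ con 1ℚ) :* w :- ((a :+ con 1ℚ) :+ con 1ℚ) :* (con ½ :* w)) refl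
            (nat n) (width (bracket n)))) (width-decay n))
        where
        nonNeg* : ∀ {p q} → 0ℚ ℚ.≤ p → 0ℚ ℚ.≤ q → 0ℚ ℚ.≤ p ℚ.* q
        nonNeg* {p} {q} p≥0 q≥0 = subst (ℚ._≤ p ℚ.* q) (ℚ.*-zeroˡ q) (ℚ.*-monoʳ-≤-nonNeg q {{ℚ.nonNegative q≥0}} p≥0)

      narrow : ∀ ε → 0ℚ ℚ.< ε → ∃[ n ] width (bracket n) ℚ.< ε
      narrow ε ε>0 = N , ℚ.*-cancelˡ-<-nonNeg (nat (suc N)) {{ℚ.nonNegative (nat-nonNeg (suc N))}}
          (ℚ.≤-<-trans (width-decay N) w<Nε)
        where
        W = proj₁ (divide ε ε>0 (width first ℚ.+ 1ℚ) (ℚ.+-mono-≤-< (width-nonNeg first) (ℚ.positive⁻¹ 1ℚ)))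
        Wε≡ : W ℚ.* ε ≡ width first ℚ.+ 1ℚ
        Wε≡ = proj₂ (proj₂ (divide ε ε>0 (width first ℚ.+ 1ℚ) (ℚ.+-mono-≤-< (width-nonNeg first) (ℚ.positive⁻¹ 1ℚ))))
        N = proj₁ (≤-nat W)
        W≤ : W ℚ.≤ nat (suc N)
        W≤ = ℚ.≤-trans (proj₂ (≤-nat W)) (subst (ℚ._≤ nat (suc N)) (ℚ.+-identityʳ (nat N)) (ℚ.+-monoʳ-≤ (nat N) (ℚ.nonNegative⁻¹ 1ℚ)))
        w<Nε : width first ℚ.< nat (suc N) ℚ.* ε
        w<Nε = ℚ.<-≤-trans (subst (ℚ._< width first ℚ.+ 1ℚ) (ℚ.+-identityʳ (width first)) (ℚ.+-monoʳ-< (width first) (ℚ.positive⁻¹ 1ℚ)))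
          (subst (ℚ._≤ nat (suc N) ℚ.* ε) Wε≡ (ℚ.*-monoʳ-≤-nonNeg ε {{ℚ.nonNegative (ℚ.<⇒≤ ε>0)}} W≤))

      lo≤hi-cross : ∀ {N n} → N ℕ.≤ n → lo (bracket N) ℚ.≤ hi (bracket n)
      lo≤hi-cross {N} {n} h = ℚ.≤-trans (lo-mono h) (lo≤hi (bracket n))

      -- From stage N on the upper ends stay inside the N-th bracket, so its width bounds their
      -- oscillation.
      sup : ℝ
      sup = mkℝ (λ n → hi (bracket n)) λ ε ε>0 → proj₁ (narrow ε ε>0) , λ m n m≥N n≥N →
          ∣∣< (close m n m≥N n≥N (proj₂ (narrow ε ε>0)))
            (subst (ℚ._< ε) (solve 2 (λ x y → y :- x := :- (x :- y)) refl (hi (bracket m)) (hi (bracket n)))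
              (close n m n≥N m≥N (proj₂ (narrow ε ε>0))))
        where
        close : ∀ {ε N} m n → N ℕ.≤ m → N ℕ.≤ n → width (bracket N) ℚ.< ε → hi (bracket m) ℚ.- hi (bracket n) ℚ.< ε
        close {N = N} m n m≥N n≥N h = ℚ.≤-<-trans (ℚ-≤-by (ℚ.+-mono-≤ (hi-anti m≥N) (lo≤hi-cross n≥N))
          (solve 4 (λ a b c d → (b :+ d) :- (a :+ c) := (b :- c) :- (a :- d)) refl
            (hi (bracket m)) (hi (bracket N)) (lo (bracket N)) (hi (bracket n)))) h

      sup-upper : ∀ n → x n ≤ sup
      sup-upper n ε ε>0 = ev-map₂ (λ m a N≤m → ℚ-≤-by
          (ℚ.+-mono-≤ a (ℚ.+-mono-≤ (lo≤hi-cross {N} {m} N≤m) (ℚ.<⇒≤ (proj₂ (narrow (half ε) (half-pos ε>0))))))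
          (trans (solve 5 (λ s h l k e → ((h :+ e) :+ (k :+ e)) :- (s :+ (l :+ (h :- l))) := (k :+ (e :+ e)) :- s) refl
            (seq (x n) m) (hi (bracket N)) (lo (bracket N)) (hi (bracket m)) (half ε))
           (cong (λ t → hi (bracket m) ℚ.+ t ℚ.- seq (x n) m) (solve 1 (λ e → con ½ :* e :+ con ½ :* e := e) refl ε))))
        (hi-upper (bracket N) n (half ε) (half-pos ε>0)) (N , λ _ h → h)
        where
        N = proj₁ (narrow (half ε) (half-pos ε>0))

      sup-least : ∀ c → (∀ n → x n ≤ c) → sup ≤ c
      sup-least c x≤c ε ε>0 = ev-map₂ (λ m a N≤m → ℚ-≤-by
          (ℚ.+-mono-≤ a (ℚ.+-mono-≤ (hi-anti {N} {m} N≤m) (ℚ.<⇒≤ (proj₂ (narrow (half ε) (half-pos ε>0))))))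
          (trans (solve 5 (λ s h l k e → ((s :+ e) :+ (h :+ e)) :- (l :+ (k :+ (h :- l))) := (s :+ (e :+ e)) :- k) refl
            (seq c m) (hi (bracket N)) (lo (bracket N)) (hi (bracket m)) (half ε))
           (cong (λ t → seq c m ℚ.+ t ℚ.- hi (bracket m)) (solve 1 (λ e → con ½ :* e :+ con ½ :* e := e) refl ε))))
        (lo≤c (half ε) (half-pos ε>0)) (N , λ _ h → h)
        where
        N = proj₁ (narrow (half ε) (half-pos ε>0))
        lo≤c : ι (lo (bracket N)) ≤ c
        lo≤c with ≤-total em (ι (lo (bracket N))) c
        ... | inj₁ p = p
        ... | inj₂ p = ⊥-elim (lo-upper (bracket N) λ n → ≤-trans {x n} {c} {ι (lo (bracket N))} (x≤c n) p)

    ℝ-complete : Field.Complete (ℝ-field em) em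
    ℝ-complete x b x≤b = sup , sup-upper , sup-least
      where open Bisect x b x≤b

    private
      module ℝᶠ = Field (ℝ-field em) em

    ∑≡sumTo : ∀ n t → ℝᶠ.∑ n t ≡ sumTo n t
    ∑≡sumTo zero t = refl
    ∑≡sumTo (suc n) t = cong (_+ t n) (∑≡sumTo n t)

    HasSum⇒⟶ : ∀ {t s} → HasSum t (fin s) → (λ n → ℝᶠ.∑ n t) ℝᶠ.⟶ s
    HasSum⇒⟶ {t} {s} h ε ε>0 = ev-map (λ n p → subst (λ y → y - s ≤ ι ε × - (y - s) ≤ ι ε) (sym (∑≡sumTo n t))
        ( ≤-trans {sumTo n t - s} {∣ sumTo n t - s ∣} {ι ε}
            (≤-pointwise {sumTo n t - s} {∣ sumTo n t - s ∣} (λ k → p≤∣p∣ _)) (<⇒≤ {∣ sumTo n t - s ∣} {ι ε} p)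
        , ≤-trans { - (sumTo n t - s)} {∣ sumTo n t - s ∣} {ι ε}
            (≤-pointwise { - (sumTo n t - s)} {∣ sumTo n t - s ∣} (λ k → -p≤∣p∣ _)) (<⇒≤ {∣ sumTo n t - s ∣} {ι ε} p)))
      (h (ι ε , ε , ε>0 , 0 , λ _ _ → ℚ.≤-reflexive (ℚ.+-identityˡ ε)))

    ∣∣-least : ∀ {x b} → x ≤ b → - x ≤ b → ∣ x ∣ ≤ b
    ∣∣-least p q ε ε>0 = ev-map₂ (λ _ → ∣∣≤) (p ε ε>0) (q ε ε>0)

    -- Taking half of the rational gap below ε turns weak bounds into the strict one that `Near`
    -- demands.
    within : ∀ ε → 0ℝ < ε → ∃[ η ] 0ℚ ℚ.< η × (∀ x → x ≤ ι η → - x ≤ ι η → ∣ x ∣ < ε)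
    within ε (δ , δ>0 , N , δ≤ε) = half δ , half-pos δ>0 , λ x p q →
        ≱⇒< em {∣ x ∣} {ε} λ g → <⇒≱ {ι (half δ)} {ε} half<ε
          (≤-trans {ε} {∣ x ∣} {ι (half δ)} g (∣∣-least {x} {ι (half δ)} p q))
      where
      half<ε : ι (half δ) < ε
      half<ε = half δ , half-pos δ>0 , N , λ n n≥N → subst (ℚ._≤ seq ε n)
        (solve 1 (λ d → con 0ℚ :+ d := con ½ :* d :+ con ½ :* d) refl δ) (δ≤ε n n≥N)

    ⟶⇒HasSum : ∀ {t s} → (λ n → ℝᶠ.∑ n t) ℝᶠ.⟶ s → HasSum t (fin s)
    ⟶⇒HasSum {t} {s} h (ε , ε>0) = let η , η>0 , near = within ε ε>0 in
      ev-map (λ n (p , q) → subst (λ y → ∣ y - s ∣ < ε) (∑≡sumTo n t) (near (ℝᶠ.∑ n t - s) p q)) (h η η>0)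

-- Laurent series, their digits, and membership in the two sets

module Laurent where
  open import Defs
  open Numerals
  open RealLine
  open import Data.Fin.Patterns using (0F; 1F; 2F)
  import Data.Fin.Properties as Fin
  open import Data.Integer using (ℤ; +_; -[1+_])
  open import Data.Integer.Solver using () renaming (module +-*-Solver to ℤ-Solver)
  open ≡ using (refl; sym; trans; cong; subst)

  ℤ-≤-or-< : ∀ i j → i ℤ.≤ j ⊎ j ℤ.< i
  ℤ-≤-or-< i j with i ℤ.≤? j
  ... | yes p = inj₁ p
  ... | no ¬p = inj₂ (ℤ.≰⇒> ¬p)

  pow3 : ℤ → ℚ
  pow3 k = 3^ℤ⇒ℚ (3^ k)

  pow3-suc : ∀ k → pow3 (ℤ.suc k) ≡ 3ℚ ℚ.* pow3 k
  pow3-suc (+ n) = 3^-suc n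
  pow3-suc -[1+ zero ] = sym (3^-pred 0)
  pow3-suc -[1+ suc n ] = sym (3^-pred (suc n))

  pow3-pos : ∀ k → 0ℚ ℚ.< pow3 k
  pow3-pos (+ n) = ℚ.positive⁻¹ (pow3 (+ n)) {{ℚ.normalize-pos (3 ℕ.^ n) 1 {{_}} {{ℕ.m^n≢0 3 n}}}}
  pow3-pos -[1+ n ] = ℚ.positive⁻¹ (pow3 -[1+ n ]) {{ℚ.normalize-pos 1 (3 ℕ.^ suc n) {{ℕ.m^n≢0 3 (suc n)}}}}

  pow3-<-suc : ∀ k → pow3 k ℚ.< pow3 (ℤ.suc k)
  pow3-<-suc k = subst (pow3 k ℚ.<_) (sym (pow3-suc k))
    (subst (ℚ._< 3ℚ ℚ.* pow3 k) (ℚ.*-identityˡ (pow3 k))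
      (ℚ.*-monoˡ-<-pos (pow3 k) {{ℚ.positive (pow3-pos k)}} {1ℚ} {3ℚ} (ℚ.*<* (ℤ.+<+ (s≤s (s≤s z≤n))))))

  ℤ-≤-offset : ∀ {i j} → i ℤ.≤ j → ∃[ n ] j ≡ + n ℤ.+ i
  ℤ-≤-offset {i} {j} h = ℤ.∣ j ℤ.- i ∣ , sym (trans (cong (ℤ._+ i) (ℤ.0≤i⇒+∣i∣≡i (ℤ.i≤j⇒0≤j-i h)))
    (solve 2 (λ i j → (j :- i) :+ i := j) refl i j))
    where open ℤ-Solver using (solve; _:+_; _:-_; _:=_)

  pow3-≤ : ∀ {i j} → i ℤ.≤ j → pow3 i ℚ.≤ pow3 j
  pow3-≤ {i} h = let n , e = ℤ-≤-offset h in subst (λ k → pow3 i ℚ.≤ pow3 k) (sym e) (go n)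
    where
    go : ∀ n → pow3 i ℚ.≤ pow3 (+ n ℤ.+ i)
    go zero = ℚ.≤-reflexive (cong pow3 (sym (ℤ.+-identityˡ i)))
    go (suc n) = ℚ.≤-trans (go n) (subst (λ k → pow3 (+ n ℤ.+ i) ℚ.≤ pow3 k) (sym (ℤ.suc-+ n i))
      (ℚ.<⇒≤ (pow3-<-suc (+ n ℤ.+ i))))

  pow3-< : ∀ {i j} → i ℤ.< j → pow3 i ℚ.< pow3 j
  pow3-< {i} h = ℚ.<-≤-trans (pow3-<-suc i) (pow3-≤ (ℤ.i<j⇒suc[i]≤j h))

  ι-< : ∀ {p q} → p ℚ.< q → ι p < ι q
  ι-< {p} {q} h = q ℚ.- p , ℚ-<-by h (solve 2 (λ p q → q :- p := (q :- p) :- con 0ℚ) refl p q) , 0 ,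
    λ _ _ → ℚ.≤-reflexive (solve 2 (λ p q → p :+ (q :- p) := q) refl p q)
    where open ℚ-Solver using (solve; con; _:+_; _:-_; _:=_)

  -₃-self : ∀ a → a -₃ a ≡ 0F
  -₃-self 0F = refl
  -₃-self 1F = refl
  -₃-self 2F = refl

  -₃-zero : ∀ a b → a -₃ b ≡ 0F → a ≡ b
  -₃-zero 0F 0F _ = refl
  -₃-zero 1F 1F _ = refl
  -₃-zero 2F 2F _ = refl
  -₃-zero 0F 1F ()
  -₃-zero 0F 2F ()
  -₃-zero 1F 0F ()
  -₃-zero 1F 2F ()
  -₃-zero 2F 0F ()
  -₃-zero 2F 1F ()

  least : ∀ {P : ℕ → Set} → (∀ n → Dec (P n)) → ∀ n → P n → ∃[ m ] P m × (∀ j → j ℕ.< m → ¬ P j)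
  least {P} dec n p = go n 0 (ℕ.+-identityʳ n) (λ _ ())
    where
    go : ∀ d m → d ℕ.+ m ≡ n → (∀ j → j ℕ.< m → ¬ P j) → ∃[ m ] P m × (∀ j → j ℕ.< m → ¬ P j)
    go d m e below with dec m
    ... | yes q = m , q , below
    go zero m refl below | no ¬q = ⊥-elim (¬q p)
    go (suc d) m e below | no ¬q = go d (suc m) (trans (ℕ.+-suc d m) e) below'
      where
      below' : ∀ j → j ℕ.< suc m → ¬ P j
      below' j j<1+m with j ℕ.≟ m
      ... | yes refl = ¬q
      ... | no j≢m = below j (ℕ.≤∧≢⇒< (ℕ.≤-pred j<1+m) j≢m)

  -- The degree N of a nonzero h must lie below k, for otherwise 3^k ≤ 3^N = r.
  norm<⇒ : ∀ {h k} → ∥ h ∥< ⟦ 3^ k ⟧ → ∀ i → k ℤ.≤ i → coeff h i ≡ 0F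
  norm<⇒ (r , inj₁ (zeros , _) , _) i _ = zeros i
  norm<⇒ {h} {k} (r , inj₂ (N , _ , zeros , r≈) , r<) i k≤i with ℤ-≤-or-< k N
  ... | inj₁ k≤N = ⊥-elim (<⇒≱ {r} {⟦ 3^ k ⟧} r< (≤-trans {⟦ 3^ k ⟧} {⟦ 3^ N ⟧} {r}
          (≤-pointwise {⟦ 3^ k ⟧} {⟦ 3^ N ⟧} (λ _ → pow3-≤ k≤N)) (≈⇒≤ {⟦ 3^ N ⟧} {r} (≈-sym {r} {⟦ 3^ N ⟧} r≈))))
  ... | inj₂ N<k = zeros i (ℤ.<-≤-trans N<k k≤i)

  agreement : ∀ {x y k} → ∥ x ⊖ y ∥< ⟦ 3^ k ⟧ → ∀ i → k ℤ.≤ i → coeff x i ≡ coeff y i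
  agreement {x} {y} h i k≤i = -₃-zero (coeff x i) (coeff y i) (norm<⇒ {x ⊖ y} h i k≤i)

  digit : Bool → 𝔽₃
  digit false = 0F
  digit true  = 2F

  digit-injective : ∀ {a} → a ≡ digit true → a ≡ digit false → ⊥
  digit-injective refl ()

  cantorDigit : ∀ b → CantorDigit (digit b)
  cantorDigit false = inj₁ refl
  cantorDigit true  = inj₂ refl

  bit : ∀ {a} → CantorDigit a → Bool
  bit (inj₁ _) = false
  bit (inj₂ _) = true

  digit-bit : ∀ {a} (d : CantorDigit a) → a ≡ digit (bit d)
  digit-bit (inj₁ e) = e
  digit-bit (inj₂ e) = e

  expand : (ℕ → Bool) → ℤ → 𝔽₃
  expand σ (+ _)    = 0F
  expand σ -[1+ n ] = digit (σ n)

  -- σ lists the digits from X⁻¹ on, true standing for 2.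
  point : (ℕ → Bool) → 𝔽₃⟨⟨X⁻¹⟩⟩
  point σ = record { coeff = expand σ ; bounded = + 0 , λ { (+ _) _ → refl } }

  expand-cantor : ∀ σ i → CantorDigit (expand σ i)
  expand-cantor σ (+ _)    = inj₁ refl
  expand-cantor σ -[1+ n ] = cantorDigit (σ n)

  -- The number of digits after the point fixed by a ball of radius 3 ^ k.
  depth : ℤ → ℕ
  depth (+ _)    = 0
  depth -[1+ n ] = suc n

  below-depth : ∀ {k j} → k ℤ.≤ -[1+ j ] → j ℕ.< depth k
  below-depth {+ _} ()
  below-depth { -[1+ n ]} (ℤ.-≤- p) = s≤s p

  depth-≤ : ∀ {k j} → j ℕ.< depth k → k ℤ.≤ -[1+ j ]
  depth-≤ { -[1+ n ]} (s≤s p) = ℤ.-≤- p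

  -- Padded with zeros, a word of length N is the digit sequence of g / Xᴺ for some g in ℱ(N).
  wordDigits : List Bool → ℕ → Bool
  wordDigits [] _ = false
  wordDigits (b ∷ w) zero = b
  wordDigits (b ∷ w) (suc n) = wordDigits w n

  prefix : ℕ → (ℕ → Bool) → List Bool
  prefix zero σ = []
  prefix (suc n) σ = σ 0 ∷ prefix n (λ j → σ (suc j))

  length-prefix : ∀ n σ → length (prefix n σ) ≡ n
  length-prefix zero σ = refl
  length-prefix (suc n) σ = cong suc (length-prefix n (λ j → σ (suc j)))

  prefix-below : ∀ n σ {j} → j ℕ.< n → wordDigits (prefix n σ) j ≡ σ j
  prefix-below (suc n) σ {zero} _ = refl
  prefix-below (suc n) σ {suc j} (s≤s p) = prefix-below n (λ j → σ (suc j)) p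

  prefix-above : ∀ n σ {j} → n ℕ.≤ j → wordDigits (prefix n σ) j ≡ false
  prefix-above zero σ _ = refl
  prefix-above (suc n) σ {suc j} (s≤s p) = prefix-above n (λ j → σ (suc j)) p

  𝒞-point : ∀ {y} → 𝒞 y → Σ[ σ ∈ (ℕ → Bool) ] (∀ i → coeff y i ≡ expand σ i)
  𝒞-point {y} (y∈𝕀 , digits) = σ , same
    where
    σ : ℕ → Bool
    σ n = bit (digits (suc n) (s≤s z≤n))
    same : ∀ i → coeff y i ≡ expand σ i
    same (+ n) = norm<⇒ {y} {+ 0} y∈𝕀 (+ n) (ℤ.+≤+ z≤n)
    same -[1+ n ] = digit-bit (digits (suc n) (s≤s z≤n))

  -- The number r(N), cut off at 0 when ψ(3ᴺ) ≥ 1. The value at 0 is a filler, as N starts at 1.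
  depthAt : (3^ℕ → 3^ℤ) → ℕ → ℕ
  depthAt ψ zero    = 0
  depthAt ψ (suc n) = depth (3^ℤ.exponent (ψ (3^ suc n)))

  -- σ reads the coefficients of g and not those of y, since y agrees with g / Xᴺ only as far as
  -- ψ(3ᴺ) reaches. Places from N on are 0 because g has no negative powers.
  W-point : ∀ {ψ y} → W𝒞 ψ y → ∀ M → ∃[ n ] Σ[ σ ∈ (ℕ → Bool) ] M ℕ.≤ n ×
    (∀ i → 3^ℤ.exponent (ψ (3^ suc n)) ℤ.≤ i → coeff y i ≡ expand (wordDigits (prefix (suc n) σ)) i)
  W-point {ψ} {y} (_ , often) M with often M
  ... | n , M<N , g , (poly , digits , deg) , near = n , σ , ℕ.≤-pred M<N , λ i k≤i →
      trans (agreement {y} {g /X^ suc n} near i k≤i) (same i)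
    where
    σ : ℕ → Bool
    σ j = bit (digits (-[1+ j ] ℤ.+ + suc n))
    same : ∀ i → coeff g (i ℤ.+ + suc n) ≡ expand (wordDigits (prefix (suc n) σ)) i
    same (+ j) = deg (+ j ℤ.+ + suc n) (ℤ.+≤+ (ℕ.m≤n+m (suc n) j))
    same -[1+ j ] with j ℕ.<? suc n
    ... | yes j<N = trans (digit-bit (digits (-[1+ j ] ℤ.+ + suc n))) (cong digit (sym (prefix-below (suc n) σ j<N)))
    ... | no j≮N = trans (poly (-[1+ j ] ℤ.+ + suc n) (negative (ℕ.≮⇒≥ j≮N)))
                         (cong digit (sym (prefix-above (suc n) σ (ℕ.≮⇒≥ j≮N))))
      where
      negative : suc n ℕ.≤ j → -[1+ j ] ℤ.+ + suc n ℤ.< + 0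
      negative h = subst (-[1+ j ] ℤ.+ + suc n ℤ.<_) (ℤ.+-inverseˡ (+ suc n)) (ℤ.+-monoˡ-< (+ suc n) (ℤ.-<- h))

  module _ (em : ExcludedMiddle 0ℓ) where

    -- `IsAbs` asks for the degree: excluded middle decides whether a nonzero coefficient exists,
    -- and a search downwards from k - 1 finds the highest one.
    ⇒norm< : ∀ {h k} → (∀ i → k ℤ.≤ i → coeff h i ≡ 0F) → ∥ h ∥< ⟦ 3^ k ⟧
    ⇒norm< {h} {k} zeros = case em
      where
      case : Dec (∃[ i ] coeff h i ≢ 0F) → ∥ h ∥< ⟦ 3^ k ⟧
      case (no none) = 0ℝ , inj₁ ((λ i → all i (coeff h i Fin.≟ 0F)) , ≈-pointwise {0ℝ} {0ℝ} (λ _ → refl)) , ι-< (pow3-pos k)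
        where
        all : ∀ i → Dec (coeff h i ≡ 0F) → coeff h i ≡ 0F
        all i (yes e) = e
        all i (no ¬e) = ⊥-elim (none (i , ¬e))
      case (yes (i , nz)) = ⟦ 3^ idx m ⟧ ,
          inj₂ (idx m , nz-m , above , ≈-pointwise {⟦ 3^ idx m ⟧} {⟦ 3^ idx m ⟧} (λ _ → refl)) , ι-< (pow3-< idx<k)
        where
        idx : ℕ → ℤ
        idx j = k ℤ.- + suc j
        position : ∀ {i} → i ℤ.< k → ∃[ j ] i ≡ idx j
        position {i} i<k = let j , e = ℤ-≤-offset (ℤ.i<j⇒suc[i]≤j i<k) in
          j , trans (solve 2 (λ i j → i := (j :+ (con (+ 1) :+ i)) :- (con (+ 1) :+ j)) refl i (+ j)) (cong (ℤ._- + suc j) (sym e))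
          where open ℤ-Solver using (solve; con; _:+_; _:-_; _:=_)
        start : ∃[ j ] i ≡ idx j
        start with ℤ-≤-or-< k i
        ... | inj₁ k≤i = ⊥-elim (nz (zeros i k≤i))
        ... | inj₂ i<k = position i<k
        found = least {λ j → coeff h (idx j) ≢ 0F} (λ _ → em) (proj₁ start)
          (subst (λ l → coeff h l ≢ 0F) (proj₂ start) nz)
        m = proj₁ found
        nz-m = proj₁ (proj₂ found)
        idx<k : idx m ℤ.< k
        idx<k = subst (idx m ℤ.<_) (ℤ.+-identityʳ k) (ℤ.+-monoʳ-< k ℤ.-<+)
        above : ∀ i → idx m ℤ.< i → coeff h i ≡ 0F
        above i m<i with ℤ-≤-or-< k i
        ... | inj₁ k≤i = zeros i k≤i
        ... | inj₂ i<k = decide (coeff h i Fin.≟ 0F)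
          where
          j = proj₁ (position i<k)
          e = proj₂ (position i<k)
          j<m : j ℕ.< m
          j<m = ℕ.≰⇒> λ m≤j → ℤ.<⇒≱ (subst (idx m ℤ.<_) e m<i)
            (ℤ.+-monoʳ-≤ k (ℤ.neg-mono-≤ (ℤ.+≤+ (s≤s m≤j))))
          decide : Dec (coeff h i ≡ 0F) → coeff h i ≡ 0F
          decide (yes z) = z
          decide (no ¬z) = ⊥-elim (proj₂ (proj₂ found) j j<m (subst (λ l → coeff h l ≢ 0F) e ¬z))

    close : ∀ {x y k} → (∀ i → k ℤ.≤ i → coeff x i ≡ coeff y i) → ∥ x ⊖ y ∥< ⟦ 3^ k ⟧
    close {x} {y} {k} same = ⇒norm< {x ⊖ y} {k} λ i k≤i →
      trans (cong (_-₃ coeff y i) (same i k≤i)) (-₃-self (coeff y i))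

    point-𝒞 : ∀ σ → 𝒞 (point σ)
    point-𝒞 σ = ⇒norm< {point σ} {+ 0} (λ { (+ _) _ → refl }) , λ { (suc n) _ → cantorDigit (σ n) }

    -- g is Xᴺ times σ truncated after N digits. The zeros of σ from place N up to r(N) make the
    -- truncation agree with σ within the precision ψ(3ᴺ).
    point-W : ∀ {ψ σ} → (∀ M → ∃[ N ] M ℕ.< N × (∀ j → N ℕ.≤ j → j ℕ.< depthAt ψ N → σ j ≡ false)) → W𝒞 ψ (point σ)
    point-W {ψ} {σ} often = point-𝒞 σ , λ M → approximate M (often M)
      where
      approximate : ∀ M → (∃[ N ] M ℕ.< N × (∀ j → N ℕ.≤ j → j ℕ.< depthAt ψ N → σ j ≡ false)) →
        ∃[ n ] M ℕ.< suc n × ∃[ g ] ℱ (suc n) g × ∥ point σ ⊖ (g /X^ suc n) ∥< ⟦ ψ (3^ suc n) ⟧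
      approximate M (suc n , M<N , zeros) = n , M<N , g , (poly , (λ i → expand-cantor τ (i ℤ.- + N)) , deg) ,
          close {point σ} {g /X^ N} {k} same
        where
        N = suc n
        k = 3^ℤ.exponent (ψ (3^ suc n))
        τ : ℕ → Bool
        τ = wordDigits (prefix N σ)
        large : ∀ i → + N ℤ.≤ i → expand τ (i ℤ.- + N) ≡ 0F
        large i N≤i with i ℤ.- + N | ℤ.i≤j⇒0≤j-i N≤i
        ... | + _ | _ = refl
        g : 𝔽₃⟨⟨X⁻¹⟩⟩
        g = record { coeff = λ i → expand τ (i ℤ.- + N) ; bounded = + N , λ i N<i → large i (ℤ.<⇒≤ N<i) }
        deg : DegreeBelow N g
        deg = large
        poly : IsPolynomial g
        poly -[1+ m ] _ = cong digit (prefix-above N σ {suc (m ℕ.+ n)} (s≤s (ℕ.m≤n+m n m)))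
        poly (+ _) (ℤ.+<+ ())
        same : ∀ i → k ℤ.≤ i → expand σ i ≡ expand τ ((i ℤ.+ + N) ℤ.- + N)
        same i k≤i = trans (shifted i k≤i) (cong (expand τ)
            (sym (trans (ℤ.+-assoc i (+ N) (ℤ.- + N)) (trans (cong (λ z → i ℤ.+ z) (ℤ.+-inverseʳ (+ N))) (ℤ.+-identityʳ i)))))
          where
          shifted : ∀ i → k ℤ.≤ i → expand σ i ≡ expand τ i
          shifted (+ _) _ = refl
          shifted -[1+ j ] k≤ with j ℕ.<? N
          ... | yes j<N = cong digit (sym (prefix-below N σ j<N))
          ... | no j≮N = cong digit (trans (zeros j (ℕ.≮⇒≥ j≮N) (below-depth k≤)) (sym (prefix-above N σ (ℕ.≮⇒≥ j≮N))))

open import Defs using (3^ℕ; 3^ℤ; 3^_; 3^ℤ⇒ℚ; 𝔽₃⟨⟨X⁻¹⟩⟩; coeff; 𝒞; W𝒞; Ball; centre; radius; CountableFamily; Covers)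

-- Covers, their costs, and the infima over covers

module Coverings (R : RealField) (em : ExcludedMiddle 0ℓ) (complete : Field.Complete R em)
  (f : 3^ℤ → RealField.Carrier R)
  (f-nonNeg : ∀ r → RealField._≤_ R (Field.0# R em) (f r))
  (f-mono : ∀ {k l} → k ℤ.≤ l → RealField._≤_ R (f (3^ k)) (f (3^ l)))
  (ψ : 3^ℕ → 3^ℤ) where

  open Field R em
  open Exponential R em
  open Words
  open Numerals
  open Laurent
  open Avoidance R em complete
  open import Data.Integer using (ℤ; +_; -[1+_])
  import Data.Maybe as Maybe

  exponent : 3^ℤ → ℤ
  exponent = 3^ℤ.exponent

  value : 3^ℤ → Carrier
  value r = ι (3^ℤ⇒ℚ r)

  3^-_ : ℕ → 3^ℤ
  3^- n = 3^ (ℤ.- + n)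

  F : ℕ → Carrier
  F n = f (3^- n)

  -- r ^ (- γ) f(r) at r = 3 ^ (- n)
  φ : ℕ → Carrier
  φ n = 2# ^ n * F n

  F-anti : ∀ n → F (suc n) ≤ F n
  F-anti n = f-mono (ℤ.neg-mono-≤ (ℤ.+≤+ (ℕ.n≤1+n n)))

  φ-nonNeg : ∀ n → 0# ≤ φ n
  φ-nonNeg n = *-nonNeg (2^-nonNeg n) (f-nonNeg (3^- n))

  contribution : Maybe Ball → Carrier
  contribution = maybe′ (λ b → f (radius b)) 0#

  contribution-nonNeg : ∀ m → 0# ≤ contribution m
  contribution-nonNeg (just b) = f-nonNeg (radius b)
  contribution-nonNeg nothing  = ≤-refl

  IsCover : (𝔽₃⟨⟨X⁻¹⟩⟩ → Set) → Carrier → Carrier → Set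
  IsCover A ρ s = Σ[ B ∈ CountableFamily ]
      Covers B A
    × (∀ i b → B i ≡ just b → value (radius b) ≤ ρ)
    × (λ k → ∑ k (λ i → contribution (B i))) ⟶ s

  cover-W : ∀ {ρ s} → IsCover 𝒞 ρ s → IsCover (W𝒞 ψ) ρ s
  cover-W (B , covers , rest) = B , (λ y w → covers y (proj₁ w)) , rest

  cover-nonNeg : ∀ {A ρ s} → IsCover A ρ s → 0# ≤ s
  cover-nonNeg (B , _ , _ , lim) = ⟶-≤ (0 , λ k _ → ∑-nonNeg k (λ i _ → contribution-nonNeg (B i))) (⟶-const 0#) lim

  ballAt : List Bool → 3^ℤ → Ball
  ballAt w r = record { centre = point (wordDigits w) ; radius = r }

  -- A ball of radius r about each word of length n, when sel n = just r.
  word-cover : ∀ {A ρ s} (sel : ℕ → Maybe 3^ℤ) →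
    (∀ n r → sel n ≡ just r → value r ≤ ρ) →
    (∀ y → A y → ∃[ n ] ∃[ r ] Σ[ σ ∈ (ℕ → Bool) ] sel n ≡ just r ×
      (∀ i → exponent r ℤ.≤ i → coeff y i ≡ expand (wordDigits (prefix n σ)) i)) →
    (λ k → ∑ k (λ n → 2# ^ n * maybe′ f 0# (sel n))) ⟶ s → IsCover A ρ s
  word-cover {A} {ρ} {s} sel small covers lim = B , covers' , small' ,
      ⟶-cong (λ k → ∑-cong k (λ i _ → reflexive (≡.sym (contribution-map (word i) (sel (length (word i))))))) refl
        (∑-words-limit R em (λ n → maybe′ f 0# (sel n)) (λ n → nonNeg (sel n)) lim)
    where
    at : List Bool → Maybe 3^ℤ → Maybe Ball
    at w = Maybe.map (ballAt w)
    B : CountableFamily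
    B i = at (word i) (sel (length (word i)))
    contribution-map : ∀ w m → contribution (at w m) ≡ maybe′ f 0# m
    contribution-map w (just r) = ≡.refl
    contribution-map w nothing  = ≡.refl
    nonNeg : ∀ m → 0# ≤ maybe′ f 0# m
    nonNeg (just r) = f-nonNeg r
    nonNeg nothing  = ≤-refl
    covers' : Covers B A
    covers' y a =
      let n , r , σ , sel≡ , agree = covers y a
          i , w≡ = word-surjective (prefix n σ)
      in i , ballAt (prefix n σ) r ,
         ≡.trans (≡.cong (λ w → at w (sel (length w))) w≡)
           (≡.trans (≡.cong (λ m → at (prefix n σ) (sel m)) (length-prefix n σ)) (≡.cong (at (prefix n σ)) sel≡)) ,
         close em {y} {point (wordDigits (prefix n σ))} {exponent r} agree
    small' : ∀ i b → B i ≡ just b → value (radius b) ≤ ρ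
    small' i b = go (sel (length (word i))) ≡.refl
      where
      go : ∀ m → sel (length (word i)) ≡ m → at (word i) m ≡ just b → value (radius b) ≤ ρ
      go (just r) e ≡.refl = small _ r e
      go nothing  e ()

  ∑-single : ∀ {n b} → (∀ m → m ≢ n → b m ≈ 0#) → ∀ k → n ℕ.< k → ∑ k b ≈ b n
  ∑-single {n} {b} zeros (suc k) n<1+k with k ℕ.≟ n
  ... | yes ≡.refl = trans (+-cong (all-zero k ℕ.≤-refl) refl) (+-identityˡ (b k))
    where
    all-zero : ∀ l → l ℕ.≤ k → ∑ l b ≈ 0#
    all-zero zero _ = refl
    all-zero (suc l) l<k = trans (+-cong (all-zero l (ℕ.<⇒≤ l<k)) (zeros l (ℕ.<⇒≢ l<k))) (+-identityˡ 0#)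
  ... | no k≢n = trans (+-cong (∑-single zeros k (ℕ.≤∧≢⇒< (ℕ.≤-pred n<1+k) (λ e → k≢n (≡.sym e)))) (zeros k k≢n)) (+-identityʳ (b n))

  ⟶-eventually : ∀ {x l} → Eventually (λ n → x n ≈ l) → x ⟶ l
  ⟶-eventually {x} {l} h ε ε>0 = ev-map (λ n e → abs-cong (trans (solve 1 (λ l → con 0ℚ := l :- l) refl l) (+-cong (sym e) refl))
    (abs-≤ (ι-mono (ℚ.<⇒≤ ε>0)) (abs-nonNeg ≤-refl))) h

  -- Only the words of length n are selected, so the series of costs has the single nonzero term 2ⁿ
  -- f(3⁻ⁿ).
  level-cover : ∀ n {ρ} → value (3^- n) ≤ ρ → IsCover 𝒞 ρ (φ n)
  level-cover n {ρ} small = word-cover sel small' covers (⟶-eventually (suc n , λ k n<k →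
      trans (∑-single {n} zeros k n<k) (*-cong refl (reflexive (≡.cong (maybe′ f 0#) sel-n)))))
    where
    sel : ℕ → Maybe 3^ℤ
    sel m = select (m ℕ.≟ n) (just (3^- n)) nothing
    sel-n : sel n ≡ just (3^- n)
    sel-n = select-yes (n ℕ.≟ n) ≡.refl
    zeros : ∀ m → m ≢ n → 2# ^ m * maybe′ f 0# (sel m) ≈ 0#
    zeros m m≢n = trans (*-cong refl (reflexive (≡.cong (maybe′ f 0#) (select-no (m ℕ.≟ n) m≢n)))) (zeroʳ (2# ^ m))
    small' : ∀ m r → sel m ≡ just r → value r ≤ ρ
    small' m r = go (m ℕ.≟ n)
      where
      go : (d : Dec (m ≡ n)) → select d (just (3^- n)) nothing ≡ just r → value r ≤ ρ
      go (yes _) ≡.refl = small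
      go (no _) ()
    covers : ∀ y → 𝒞 y → ∃[ m ] ∃[ r ] Σ[ σ ∈ (ℕ → Bool) ] sel m ≡ just r ×
      (∀ i → exponent r ℤ.≤ i → coeff y i ≡ expand (wordDigits (prefix m σ)) i)
    covers y y∈𝒞 = let σ , same = 𝒞-point {y} y∈𝒞 in n , 3^- n , σ , sel-n , λ i -n≤i → ≡.trans (same i) (head σ i -n≤i)
      where
      head : ∀ σ i → ℤ.- + n ℤ.≤ i → expand σ i ≡ expand (wordDigits (prefix n σ)) i
      head σ (+ _) _ = ≡.refl
      head σ -[1+ j ] h = ≡.cong digit (≡.sym (prefix-below n σ (depth-bound n (below-depth h))))
        where
        depth-bound : ∀ n → j ℕ.< depth (ℤ.- + n) → j ℕ.< n
        depth-bound (suc n) p = p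

  -- The induction needs only n + 2 ≤ 3 (n + 1); this decay provides radii below every ρ.
  value-decay : ∀ n → ♯ (suc n) * value (3^- n) ≤ 1#
  value-decay zero = ≤-reflexive (trans (*-cong (trans (♯-suc 0) (+-identityˡ 1#)) refl) (*-identityˡ 1#))
  value-decay (suc n) = ≤-trans (≤-by (*-nonNeg (+-nonNeg (+-nonNeg (♯-nonNeg n) (♯-nonNeg n)) 0≤1) (ι-mono (ℚ.<⇒≤ (pow3-pos (ℤ.- + suc n)))))
      (trans (solve 2 (λ a x → ((a :+ a) :+ con 1ℚ) :* x :- con 0ℚ
          := (a :+ con 1ℚ) :* (con 3ℚ :* x) :- ((a :+ con 1ℚ) :+ con 1ℚ) :* x) refl (♯ n) (value (3^- suc n)))
        (+-cong (*-cong (sym (♯-suc n)) triple) (-‿cong (*-cong (trans (+-cong (sym (♯-suc n)) refl) (sym (♯-suc (suc n)))) refl)))))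
      (value-decay n)
    where
    triple : ι 3ℚ * value (3^- suc n) ≈ value (3^- n)
    triple = trans (sym (ι-* 3ℚ (pow3 (ℤ.- + suc n)))) (reflexive (≡.cong ι (3^-pred n)))

  small-value : ∀ {ρ} → 0# < ρ → ∃[ n ] value (3^- n) ≤ ρ
  small-value {ρ} ρ>0 =
    let b , large = unbounded ρ>0 1#
        q , b≤q = bounded b
        n , q≤n = ≤-nat q
    in n , *-cancel-≤ (♯-pos n) (≤-trans (value-decay n) (≤-trans (<⇒≤ large) (≤-respʳ (*-comm ρ (♯ (suc n)))
      (*-monoˡ-≤ (<⇒≤ ρ>0) (≤-trans b≤q (≤-trans (ι-mono q≤n) (♯-≤ (ℕ.n≤1+n n))))))))

  minDepth : ∀ {ρ} → 0# < ρ → ∃[ n ] value (3^- n) ≤ ρ × (∀ j → j ℕ.< n → ¬ (value (3^- j) ≤ ρ))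
  minDepth {ρ} ρ>0 = least (λ n → ≤-dec _ _) (proj₁ (small-value ρ>0)) (proj₂ (small-value ρ>0))

  -- A ball of depth d has radius at least 3⁻ᵈ, which exceeds ρ when d is below the minimal depth.
  minDepth≤depth : ∀ {ρ} (ρ>0 : 0# < ρ) r → value r ≤ ρ → proj₁ (minDepth ρ>0) ℕ.≤ depth (exponent r)
  minDepth≤depth {ρ} ρ>0 (3^ k) h = ℕ.≮⇒≥ λ d<n → proj₂ (proj₂ (minDepth ρ>0)) (depth k) d<n
      (≤-trans (ι-mono (pow3-≤ (below k))) h)
    where
    below : ∀ k → ℤ.- + depth k ℤ.≤ k
    below (+ n) = ℤ.+≤+ z≤n
    below -[1+ n ] = ℤ.≤-refl

  -- A ball of radius above 1 fixes no digit after the point and is treated as one of radius 1,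
  -- which costs no more.
  F≤f : ∀ r → F (depth (exponent r)) ≤ f r
  F≤f (3^ (+ n)) = f-mono (ℤ.+≤+ z≤n)
  F≤f (3^ -[1+ n ]) = ≤-refl

  approximant : ℕ → Carrier
  approximant m = 2# ^ suc m * f (ψ (3^ suc m))

  approximant-nonNeg : ∀ m → 0# ≤ approximant m
  approximant-nonNeg m = *-nonNeg (2^-nonNeg (suc m)) (f-nonNeg (ψ (3^ suc m)))

  -- The convergent case

  module Convergent {s} (lim : (λ k → ∑ k approximant) ⟶ s) where

    tail-cover : ∀ M {ρ} → (∀ m → M ℕ.≤ m → value (ψ (3^ suc m)) ≤ ρ) → IsCover (W𝒞 ψ) ρ (s - ∑ M approximant)
    tail-cover M {ρ} small = word-cover sel small' covers lim'
      where
      sel : ℕ → Maybe 3^ℤ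
      sel zero    = nothing
      sel (suc m) = select (M ℕ.≤? m) (just (ψ (3^ suc m))) nothing
      small' : ∀ n r → sel n ≡ just r → value r ≤ ρ
      small' (suc m) r = go (M ℕ.≤? m)
        where
        go : (d : Dec (M ℕ.≤ m)) → select d (just (ψ (3^ suc m))) nothing ≡ just r → value r ≤ ρ
        go (yes p) ≡.refl = small m p
        go (no _) ()
      covers : ∀ y → W𝒞 ψ y → ∃[ n ] ∃[ r ] Σ[ σ ∈ (ℕ → Bool) ] sel n ≡ just r ×
        (∀ i → exponent r ℤ.≤ i → coeff y i ≡ expand (wordDigits (prefix n σ)) i)
      covers y y∈W = let n , σ , M≤n , same = W-point {ψ} {y} y∈W M in
        suc n , ψ (3^ suc n) , σ , select-yes (M ℕ.≤? n) M≤n , same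
      term : ℕ → Carrier
      term n = 2# ^ n * maybe′ f 0# (sel n)
      low : ∀ m → m ℕ.< M → term (suc m) ≈ 0#
      low m m<M = trans (*-cong refl (reflexive (≡.cong (maybe′ f 0#) (select-no (M ℕ.≤? m) (ℕ.<⇒≱ m<M))))) (zeroʳ (2# ^ suc m))
      high : ∀ m → M ℕ.≤ m → term (suc m) ≈ approximant m
      high m M≤m = *-cong refl (reflexive (≡.cong (maybe′ f 0#) (select-yes (M ℕ.≤? m) M≤m)))
      low-sum : ∑ M (λ m → term (suc m)) ≈ 0#
      low-sum = trans (∑-cong M {b = λ _ → 0# * 0#} (λ m m<M → trans (low m m<M) (sym (zeroˡ 0#))))
        (trans (∑-*ˡ M 0# (λ _ → 0#)) (zeroˡ _))
      sums : ∀ k → M ℕ.≤ k → ∑ (suc k) term ≈ ∑ k approximant - ∑ M approximant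
      sums k M≤k = trans (∑-head k term) (trans (+-cong (zeroʳ 1#) refl) (trans (+-identityˡ _)
        (trans (split (λ m → term (suc m))) (trans (+-cong low-sum (∑-cong (k ℕ.∸ M) (λ i _ → high (M ℕ.+ i) (ℕ.m≤m+n M i))))
          (trans (solve 2 (λ a b → con 0ℚ :+ a := (b :+ a) :- b) refl (∑ (k ℕ.∸ M) (λ i → approximant (M ℕ.+ i))) (∑ M approximant))
            (+-cong (sym (split approximant)) refl))))))
        where
        split : ∀ a → ∑ k a ≈ ∑ M a + ∑ (k ℕ.∸ M) (λ i → a (M ℕ.+ i))
        split a = trans (reflexive (≡.cong (λ l → ∑ l a) (≡.sym (ℕ.m+[n∸m]≡n M≤k)))) (∑-split M (k ℕ.∸ M) a)
      lim' : (λ k → ∑ k term) ⟶ s - ∑ M approximant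
      lim' ε ε>0 =
        let N , h = ⟶-+ lim (⟶-const (- ∑ M approximant)) ε ε>0
        in suc (N ⊔ M) , λ { (suc k) (s≤s le) →
          abs-cong (+-cong (sym (sums k (ℕ.≤-trans (ℕ.m≤n⊔m N M) le))) refl) (h k (ℕ.≤-trans (ℕ.m≤m⊔n N M) le)) }

    tails-vanish : ∀ ε → 0ℚ ℚ.< ε → Eventually λ M → s - ∑ M approximant ≤ ι ε
    tails-vanish ε ε>0 = ev-map (λ M h → ≤-respˡ (solve 2 (λ a s → :- (a :- s) := s :- a) refl (∑ M approximant) s) (proj₂ h)) (lim ε ε>0)

    approximant≤tail : ∀ m → approximant m ≤ s - ∑ m approximant
    approximant≤tail m = ≤-by (⟶-≤ (suc m , λ k m<k → ∑-extend m<k approximant-nonNeg) (⟶-const (∑ (suc m) approximant)) lim)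
      (solve 3 (λ a b s → s :- (b :+ a) := (s :- b) :- a) refl (approximant m) (∑ m approximant) s)

    f≤approximant : ∀ m → f (ψ (3^ suc m)) ≤ approximant m
    f≤approximant m = ≤-respˡ (*-identityˡ _) (*-mono-≤ 0≤1 (f-nonNeg _) (2^-≤ {0} {suc m} z≤n) ≤-refl)

    -- The radii ψ(3ᴺ) have to fall below ρ. Take 3⁻ⁿ ≤ ρ. If f(3⁻ⁿ) > 0, convergence brings
    -- f(ψ(3ᴺ)) below this value, and monotonicity of f brings ψ(3ᴺ) below 3⁻ⁿ. Otherwise f(3⁻ⁿ) = 0
    -- and the cover by cylinders of level n costs nothing.
    small-covers : ∀ {ρ} → 0# < ρ → ∀ ε → 0ℚ ℚ.< ε → ∃[ c ] c ≤ ι ε × IsCover (W𝒞 ψ) ρ c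
    small-covers {ρ} ρ>0 ε ε>0 = case em
      where
      n₀ = proj₁ (small-value ρ>0)
      case : Dec (0# < F n₀) → ∃[ c ] c ≤ ι ε × IsCover (W𝒞 ψ) ρ c
      case (no ¬pos) = φ n₀ , ≤-trans (≤-respʳ (zeroʳ (2# ^ n₀)) (*-monoˡ-≤ (2^-nonNeg n₀) (≮⇒≥ ¬pos))) (ι-mono (ℚ.<⇒≤ ε>0)) ,
        cover-W (level-cover n₀ (proj₂ (small-value ρ>0)))
      case (yes pos) = s - ∑ M approximant , proj₂ vanish M (ℕ.m≤m⊔n (proj₁ vanish) _) , tail-cover M small
        where
        vanish = tails-vanish ε ε>0
        bound = positive-bound pos
        δ>0 = proj₁ (proj₂ bound)
        tiny = tails-vanish (½ ℚ.* proj₁ bound) (½-pos δ>0)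
        M = proj₁ vanish ⊔ proj₁ tiny
        δ/2<F : ι (½ ℚ.* proj₁ bound) < F n₀
        δ/2<F h = ι-pos (½-pos δ>0) (≤-by (≤-trans (proj₂ (proj₂ bound)) h)
          (trans (+-cong refl (-‿cong (sym (ι-½ (proj₁ bound))))) (solve 1 (λ d → d :- (d :+ d) := con 0ℚ :- d) refl (ι (½ ℚ.* proj₁ bound)))))
        small : ∀ m → M ℕ.≤ m → value (ψ (3^ suc m)) ≤ ρ
        small m M≤m = decide (ℤ-≤-or-< (ℤ.- + n₀) (exponent (ψ (3^ suc m))))
          where
          f-small : f (ψ (3^ suc m)) ≤ ι (½ ℚ.* proj₁ bound)
          f-small = ≤-trans (f≤approximant m) (≤-trans (approximant≤tail m)
            (proj₂ tiny m (ℕ.≤-trans (ℕ.m≤n⊔m (proj₁ vanish) (proj₁ tiny)) M≤m)))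
          decide : ℤ.- + n₀ ℤ.≤ exponent (ψ (3^ suc m)) ⊎ exponent (ψ (3^ suc m)) ℤ.< ℤ.- + n₀ → value (ψ (3^ suc m)) ≤ ρ
          decide (inj₁ h) = ⊥-elim (δ/2<F (≤-trans (f-mono h) f-small))
          decide (inj₂ h) = ≤-trans (ι-mono (pow3-≤ (ℤ.<⇒≤ h))) (proj₂ (small-value ρ>0))

  module _ (F̃ : ℕ → Carrier) (F̃-nonNeg : ∀ n → 0# ≤ F̃ n) (F̃-anti : ∀ n → F̃ (suc n) ≤ F̃ n)
           (F̃-mono : ∀ n → 2# ^ n * F̃ n ≤ 2# ^ suc n * F̃ (suc n)) (F̃≤F : ∀ n → F̃ n ≤ F n)
           (diverges : ∀ n → (∀ N → n ℕ.< N → N ℕ.< depthAt ψ N) → ∀ b →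
              ∃[ k ] b ≤ ∑ k (λ i → 2# ^ suc (i ℕ.+ n) * F̃ (depthAt ψ (suc (i ℕ.+ n))))) where

    -- A cheaper cover would miss a point, by `uncovered`. The costs are those of f while F̃ only
    -- lies below F, which lets the nonincreasing case substitute a gauge with monotone rescaling.
    lower-bound : ∀ n {ρ s} → (∀ r → value r ≤ ρ → n ℕ.≤ depth (exponent r)) →
      IsCover (W𝒞 ψ) ρ s → 2# ^ n * F̃ n ≤ s
    lower-bound n {ρ} {s} deep (B , covers , small , lim) = ≮⇒≥ λ s<φ →
        let σ , often , unhit = uncovered n s<φ (λ i (b , e) → ≡.subst (λ m → n ℕ.≤ size m) (≡.sym e) (deep (radius b) (small i b e)))
            i , b , e , inBall = covers (point σ) (point-W em {ψ} {σ} often)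
        in unhit i ((b , e) , ≡.subst (λ m → ∀ j → j ℕ.< size m → fits m j (σ j)) (≡.sym e)
             (λ j j<d → ≡.sym (agreement {point σ} {centre b} inBall -[1+ j ] (depth-≤ j<d))))
      where
      size : Maybe Ball → ℕ
      size = maybe′ (λ b → depth (exponent (radius b))) 0
      fits : Maybe Ball → ℕ → Bool → Set
      fits m j c = maybe′ (λ b → coeff (centre b) -[1+ j ] ≡ digit c) ⊥ m
      fits-unique : ∀ m j → fits m j true → fits m j false → ⊥
      fits-unique (just b) j p q = digit-injective p q
      cost-bound : ∀ k → ∑ k (λ i → contribution (B i)) ≤ s
      cost-bound k = ⟶-≤ (k , λ l k≤l → ∑-extend k≤l (λ i → contribution-nonNeg (B i))) (⟶-const _) lim
      open Uncovered F̃ F̃-nonNeg F̃-anti F̃-mono (depthAt ψ) diverges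
        (λ i → Σ[ b ∈ Ball ] B i ≡ just b) (λ i → size (B i)) (λ i → fits (B i)) (λ i → fits-unique (B i))
        (λ i → contribution (B i)) (λ i → contribution-nonNeg (B i))
        (λ i (b , e) → ≡.subst (λ m → F̃ (size m) ≤ contribution m) (≡.sym e) (≤-trans (F̃≤F _) (F≤f (radius b))))
        s cost-bound

  -- The divergent case

  module Divergent (diverges : ∀ b → ∃[ k ] b ≤ ∑ k approximant) where

    -- Dropping the first n terms changes the sum by a constant. Under the premise all depths are
    -- positive, so no radius is cut off and f(ψ(3ᴺ)) is exactly F at its depth.
    divergesF : ∀ n → (∀ N → n ℕ.< N → N ℕ.< depthAt ψ N) → ∀ b →
      ∃[ k ] b ≤ ∑ k (λ i → 2# ^ suc (i ℕ.+ n) * F (depthAt ψ (suc (i ℕ.+ n))))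
    divergesF n deep b =
      let k , h = diverges (b + ∑ n approximant)
      in k , ≤-by (≤-trans h (≤-respʳ (∑-split n k approximant) (∑-extend (ℕ.m≤n+m k n) approximant-nonNeg)))
        (trans (+-cong (+-cong refl (∑-cong k (λ i _ → term i))) refl)
          (solve 3 (λ a b c → (a :+ c) :- (b :+ a) := c :- b) refl (∑ n approximant) b _))
      where
      F-depth : ∀ r → 0 ℕ.< depth (exponent r) → f r ≡ F (depth (exponent r))
      F-depth (3^ -[1+ j ]) _ = ≡.refl
      term : ∀ i → approximant (n ℕ.+ i) ≈ 2# ^ suc (i ℕ.+ n) * F (depthAt ψ (suc (i ℕ.+ n)))
      term i = trans (reflexive (≡.cong approximant (ℕ.+-comm n i))) (*-cong refl (reflexive
        (F-depth (ψ (3^ suc (i ℕ.+ n))) (ℕ.≤-<-trans z≤n (deep (suc (i ℕ.+ n)) (s≤s (ℕ.m≤n+m n i)))))))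

    -- Every cover of 𝒞 covers its subset W, so these two halves fix the infimum for both sets at
    -- once.
    BothMeasures : (∀ ρ → 0# < ρ → Carrier) → Set
    BothMeasures g = ∀ ρ (ρ>0 : 0# < ρ) →
        (∀ s → IsCover (W𝒞 ψ) ρ s → g ρ ρ>0 ≤ s)
      × (∀ x → (∀ s → IsCover 𝒞 ρ s → x ≤ s) → x ≤ g ρ ρ>0)

    TendsTo : (∀ ρ → 0# < ρ → Carrier) → Carrier → Set
    TendsTo g l = ∀ ε → 0ℚ ℚ.< ε → ∃[ n ] (∀ ρ ρ>0 → ρ < value (3^- n) → ∣ g ρ ρ>0 - l ∣≤ ι ε)

    TendsTo∞ : (∀ ρ → 0# < ρ → Carrier) → Set
    TendsTo∞ g = ∀ b → ∃[ n ] (∀ ρ ρ>0 → ρ < value (3^- n) → b ≤ g ρ ρ>0)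

    CommonMeasure : Set
    CommonMeasure = Σ[ g ∈ (∀ ρ → 0# < ρ → Carrier) ] BothMeasures g × ((∃[ l ] TendsTo g l) ⊎ TendsTo∞ g)

    module Nondecreasing (φ-mono : ∀ n → φ n ≤ φ (suc n)) where
      -- Since φ increases with the level, the coarsest level with radius at most ρ is the cheapest.
      g : ∀ ρ → 0# < ρ → Carrier
      g ρ ρ>0 = φ (proj₁ (minDepth ρ>0))

      φ-≤ : ∀ {m n} → m ℕ.≤ n → φ m ≤ φ n
      φ-≤ = ascending φ-mono

      φ≤g : ∀ n ρ ρ>0 → ρ < value (3^- n) → φ n ≤ g ρ ρ>0
      φ≤g n ρ ρ>0 ρ< = φ-≤ (ℕ.≮⇒≥ λ d<n → ρ< (≤-trans
        (ι-mono (pow3-≤ (ℤ.neg-mono-≤ (ℤ.+≤+ (ℕ.<⇒≤ d<n))))) (proj₁ (proj₂ (minDepth ρ>0)))))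

      measures : BothMeasures g
      measures ρ ρ>0 =
          (λ s → lower-bound F (λ n → f-nonNeg (3^- n)) F-anti φ-mono (λ _ → ≤-refl) divergesF
                   (proj₁ (minDepth ρ>0)) (minDepth≤depth ρ>0))
        , λ x h → h _ (level-cover (proj₁ (minDepth ρ>0)) (proj₁ (proj₂ (minDepth ρ>0))))

      common : CommonMeasure
      common = g , measures , case em
        where
        case : Dec (∃[ b ] (∀ n → φ n ≤ b)) → (∃[ l ] TendsTo g l) ⊎ TendsTo∞ g
        case (no unb) = inj₂ λ b → exceed b em
          where
          exceed : ∀ b → Dec (∃[ n ] b ≤ φ n) → ∃[ n ] (∀ ρ ρ>0 → ρ < value (3^- n) → b ≤ g ρ ρ>0)
          exceed b (yes (n , p)) = n , λ ρ ρ>0 ρ< → ≤-trans p (φ≤g n ρ ρ>0 ρ<)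
          exceed b (no ¬p) = ⊥-elim (unb (b , λ n → <⇒≤ (λ q → ¬p (n , q))))
        case (yes (b , φ≤b)) = inj₁ (l , λ ε ε>0 → approach ε ε>0 em)
          where
          l = proj₁ (complete φ b φ≤b)
          φ≤l = proj₁ (proj₂ (complete φ b φ≤b))
          approach : ∀ ε → 0ℚ ℚ.< ε → Dec (∃[ n ] l - ι ε ≤ φ n) →
            ∃[ n ] (∀ ρ ρ>0 → ρ < value (3^- n) → ∣ g ρ ρ>0 - l ∣≤ ι ε)
          approach ε ε>0 (yes (n , p)) = n , λ ρ ρ>0 ρ< →
              ≤-by (+-mono-≤ (φ≤l (proj₁ (minDepth ρ>0))) (ι-mono (ℚ.<⇒≤ ε>0)))
                (solve 3 (λ g l e → (l :+ e) :- (g :+ con 0ℚ) := e :- (g :- l)) refl (g ρ ρ>0) l (ι ε))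
            , ≤-by (≤-trans p (φ≤g n ρ ρ>0 ρ<)) (solve 3 (λ g l e → g :- (l :- e) := e :- (:- (g :- l))) refl (g ρ ρ>0) l (ι ε))
          approach ε ε>0 (no ¬p) = ⊥-elim (ι-pos ε>0 (≤-by
            (proj₂ (proj₂ (complete φ b φ≤b)) (l - ι ε) (λ n → <⇒≤ (λ q → ¬p (n , q))))
            (solve 2 (λ l e → (l :- e) :- l := con 0ℚ :- e) refl l (ι ε))))

    module Nonincreasing (φ-anti : ∀ n → φ (suc n) ≤ φ n) where
      private
        sup = complete (λ n → - φ n) 0# (λ n → ≤-respʳ (solve 0 (:- con 0ℚ := con 0ℚ) refl) (neg-mono-≤ (φ-nonNeg n)))

      l : Carrier
      l = - proj₁ sup

      l≤φ : ∀ n → l ≤ φ n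
      l≤φ n = ≤-by (proj₁ (proj₂ sup) n) (solve 2 (λ x s → s :- (:- x) := x :- (:- s)) refl (φ n) (proj₁ sup))

      l-greatest : ∀ x → (∀ n → x ≤ φ n) → x ≤ l
      l-greatest x h = ≤-by (proj₂ (proj₂ sup) (- x) (λ n → neg-mono-≤ (h n)))
        (solve 2 (λ x s → (:- x) :- s := (:- s) :- x) refl x (proj₁ sup))

      φ-≤ : ∀ {m n} → m ℕ.≤ n → φ n ≤ φ m
      φ-≤ = descending φ-anti

      module Positive (l>0 : 0# < l) where
        -- The function l r ^ γ, whose rescaling is the constant l.
        F̃ : ℕ → Carrier
        F̃ n = l * ½# ^ n

        ½^-nonNeg : ∀ n → 0# ≤ ½# ^ n
        ½^-nonNeg = ^-nonNeg 0≤½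

        φ̃≈l : ∀ n → 2# ^ n * F̃ n ≈ l
        φ̃≈l zero = solve 1 (λ l → con 1ℚ :* (l :* con 1ℚ) := l) refl l
        φ̃≈l (suc n) = trans (solve 3 (λ l t h → ((con 1ℚ :+ con 1ℚ) :* t) :* (l :* (con ½ :* h)) := t :* (l :* h)) refl
          l (2# ^ n) (½# ^ n)) (φ̃≈l n)

        F̃-anti : ∀ n → F̃ (suc n) ≤ F̃ n
        F̃-anti n = *-monoˡ-≤ (<⇒≤ l>0) (≤-byˡ (*-nonNeg 0≤½ (½^-nonNeg n))
          (solve 1 (λ h → con ½ :* h := h :- con ½ :* h) refl (½# ^ n)))

        F̃≤F : ∀ n → F̃ n ≤ F n
        F̃≤F n = *-cancel-≤ (2^-pos n) (≤-respˡ (sym (φ̃≈l n)) (l≤φ n))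

        φ0>0 : 0# < φ 0
        φ0>0 = <-≤-trans l>0 (l≤φ 0)

        -- Multiplied by 2ᵈ this is l φ(d) ≤ φ(0) l. It passes the divergence from F to F̃, up to
        -- the constants l and φ(0).
        compare : ∀ d → l * F d ≤ φ 0 * F̃ d
        compare d = *-cancel-≤ (2^-pos d) (≤-respˡ (solve 3 (λ t l f → l :* (t :* f) := t :* (l :* f)) refl (2# ^ d) l (F d))
          (≤-respʳ (solve 3 (λ t p f → p :* (t :* f) := t :* (p :* f)) refl (2# ^ d) (φ 0) (F̃ d))
            (≤-trans (*-monoˡ-≤ (<⇒≤ l>0) (φ-≤ {0} {d} z≤n)) (≤-respˡ (*-comm (φ 0) l) (*-monoˡ-≤ (φ-nonNeg 0)
              (≤-reflexive (sym (φ̃≈l d))))))))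

        divergesF̃ : ∀ n → (∀ N → n ℕ.< N → N ℕ.< depthAt ψ N) → ∀ b →
          ∃[ k ] b ≤ ∑ k (λ i → 2# ^ suc (i ℕ.+ n) * F̃ (depthAt ψ (suc (i ℕ.+ n))))
        divergesF̃ n deep b =
          let c , large = unbounded l>0 (φ 0 * b)
              k , h = divergesF n deep c
              a : ℕ → Carrier
              a i = 2# ^ suc (i ℕ.+ n)
              d : ℕ → ℕ
              d i = depthAt ψ (suc (i ℕ.+ n))
          in k , *-cancel-≤ φ0>0 (≤-trans (<⇒≤ large) (≤-trans (*-monoˡ-≤ (<⇒≤ l>0) h)
            (≤-respˡ (∑-*ˡ k l (λ i → a i * F (d i))) (≤-respʳ (∑-*ˡ k (φ 0) (λ i → a i * F̃ (d i))) (∑-mono k λ i _ →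
              ≤-respˡ (solve 3 (λ t l f → t :* (l :* f) := l :* (t :* f)) refl (a i) l (F (d i)))
                (≤-respʳ (solve 3 (λ t l f → t :* (l :* f) := l :* (t :* f)) refl (a i) (φ 0) (F̃ (d i)))
                  (*-monoˡ-≤ (2^-nonNeg (suc (i ℕ.+ n))) (compare (d i)))))))))

        bound : ∀ {ρ s} → IsCover (W𝒞 ψ) ρ s → l ≤ s
        bound c = ≤-respˡ (φ̃≈l 0) (lower-bound F̃ (λ n → *-nonNeg (<⇒≤ l>0) (½^-nonNeg n)) F̃-anti
          (λ n → ≤-reflexive (trans (φ̃≈l n) (sym (φ̃≈l (suc n))))) F̃≤F divergesF̃ 0 (λ _ _ → z≤n) c)

      common : CommonMeasure
      common = (λ _ _ → l) , measures , inj₁ (l , λ ε ε>0 → 0 , λ _ _ _ →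
          abs-cong (solve 1 (λ l → con 0ℚ := l :- l) refl l) (abs-≤ (ι-mono (ℚ.<⇒≤ ε>0)) (abs-nonNeg ≤-refl)))
        where
        measures : BothMeasures (λ _ _ → l)
        measures ρ ρ>0 = lower em , λ x h → l-greatest x λ n → ≤-trans
            -- Level n₀ ⊔ n is fine enough for ρ and, being at least n, costs at most φ n.
            (h _ (level-cover (n₀ ⊔ n) (≤-trans (ι-mono (pow3-≤ (ℤ.neg-mono-≤ (ℤ.+≤+ (ℕ.m≤m⊔n n₀ n))))) (proj₂ (small-value ρ>0)))))
            (φ-≤ (ℕ.m≤n⊔m n₀ n))
          where
          n₀ = proj₁ (small-value ρ>0)
          lower : Dec (0# < l) → ∀ s → IsCover (W𝒞 ψ) ρ s → l ≤ s
          lower (yes l>0) s c = Positive.bound l>0 c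
          lower (no l≯0) s c = ≤-trans (≮⇒≥ l≯0) (cover-nonNeg c)

open import Defs

-- Back to the series and measures of the statement

module Transfer (em : ExcludedMiddle 0ℓ) where
  open Numerals
  open RealLine
  open Laurent
  open import Data.Integer using (+_)
  open import Data.Unit using (tt)
  open ≡ using (refl; sym; trans; cong; subst)

  open Field (ℝ-field em) em using (2#; ∑; _⟶_; ∑-cong; ∣_∣≤_) renaming (_^_ to _^ᶠ_)
  module Ex = Exponential (ℝ-field em) em

  ≈-refl : ∀ {x} → x ≈ x
  ≈-refl {x} = ≈-pointwise {x} {x} (λ _ → refl)

  ^ᶠ≡^ : ∀ x n → x ^ᶠ n ≡ x ^ n
  ^ᶠ≡^ x zero = refl
  ^ᶠ≡^ x (suc n) = cong (x *_) {x ^ᶠ n} {x ^ n} (^ᶠ≡^ x n)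

  private
    term-≈ : ∀ y k → ι (1/ k !) * y ^ k ≈ Ex.e k y
    term-≈ y k = subst (λ z → ι (1/ k !) * z ≈ Ex.e k y) (^ᶠ≡^ y k) (≈-refl {Ex.e k y})

  IsExp⇒ : ∀ {y z} → IsExp y z → Ex.IsExp y z
  IsExp⇒ {y} {z} h = Ex.⟶-cong {λ n → ∑ n (λ k → ι (1/ k !) * y ^ k)} {λ n → Ex.E n y} {z} {z}
    (λ n → ∑-cong n {λ k → ι (1/ k !) * y ^ k} {λ k → Ex.e k y} (λ k _ → term-≈ y k)) (≈-refl {z})
    (HasSum⇒⟶ em {λ k → ι (1/ k !) * y ^ k} {z} h)

  ⇒IsExp : ∀ {y z} → Ex.IsExp y z → IsExp y z
  ⇒IsExp {y} {z} h = ⟶⇒HasSum em {λ k → ι (1/ k !) * y ^ k} {z}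
    (Ex.⟶-cong {λ n → Ex.E n y} {λ n → ∑ n (λ k → ι (1/ k !) * y ^ k)} {z} {z}
      (λ n → ∑-cong n {λ k → Ex.e k y} {λ k → ι (1/ k !) * y ^ k}
        (λ k _ → ≈-sym {ι (1/ k !) * y ^ k} {Ex.e k y} (term-≈ y k))) (≈-refl {z}) h)

  3^ᶠ : ∀ n → 3ℝ ^ᶠ n ≈ ⟦ 3^ (+ n) ⟧
  3^ᶠ n = ≈-pointwise {3ℝ ^ᶠ n} {⟦ 3^ (+ n) ⟧} (λ m → go n m)
    where
    go : ∀ n m → seq (3ℝ ^ᶠ n) m ≡ pow3 (+ n)
    go zero m = refl
    go (suc n) m = trans (cong (3ℚ ℚ.*_) (go n m)) (sym (3^-suc n))

  3^ᶠ-inverse : ∀ n → 3ℝ ^ᶠ n * ⟦ 3^ (ℤ.- + n) ⟧ ≈ 1ℝ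
  3^ᶠ-inverse n = ≈-pointwise {3ℝ ^ᶠ n * ⟦ 3^ (ℤ.- + n) ⟧} {1ℝ} (λ m → go n m)
    where
    go : ∀ n m → seq (3ℝ ^ᶠ n) m ℚ.* pow3 (ℤ.- + n) ≡ 1ℚ
    go zero m = refl
    go (suc n) m = trans (solve 3 (λ a b c → (a :* b) :* c := b :* (a :* c)) refl 3ℚ (seq (3ℝ ^ᶠ n) m) (pow3 (ℤ.- + suc n)))
      (trans (cong (seq (3ℝ ^ᶠ n) m ℚ.*_) (3^-pred n)) (go n m))
      where open ℚ-Solver using (solve; _:*_; _:=_)

  0<3 : ¬ (3ℝ ≤ 0ℝ)
  0<3 = <⇒≱ {0ℝ} {3ℝ} (ι-< {0ℚ} {3ℚ} (ℚ.positive⁻¹ 3ℚ))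

  module _ (γ : ℝ) (l₂ l₃ : ℝ) (log2 : IsLog 2ℝ l₂) (log3 : IsLog 3ℝ l₃) (ratio : γ * l₃ ≈ l₂)
           (ψ : 3^ℕ → 3^ℤ) (f : ℝ≥0 → ℝ≥0) (dim : IsDimensionFunction f) where

    open IsDimensionFunction dim

    private
      f-mono : ∀ {k l} → k ℤ.≤ l → proj₁ (f ⟦ 3^ k ⟧≥0) ≤ proj₁ (f ⟦ 3^ l ⟧≥0)
      f-mono {k} {l} k≤l = nondecreasing ⟦ 3^ k ⟧≥0 ⟦ 3^ l ⟧≥0 (≤-pointwise {⟦ 3^ k ⟧} {⟦ 3^ l ⟧} (λ _ → pow3-≤ k≤l))

      module LR = Ex.LogRatio γ l₂ l₃ 3ℝ 0<3
        (Ex.⟶-cong {λ n → Ex.E n l₂} {λ n → Ex.E n l₂} {2ℝ} {2#} (λ n → ≈-refl {Ex.E n l₂})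
          (≈-pointwise {2ℝ} {2#} (λ _ → refl)) (IsExp⇒ {l₂} {2ℝ} log2))
        (IsExp⇒ {l₃} {3ℝ} log3) ratio

      module M = Coverings (ℝ-field em) em (ℝ-complete em) (λ r → proj₁ (f ⟦ r ⟧≥0)) (λ r → proj₂ (f ⟦ r ⟧≥0))
        f-mono ψ

    pow-≈ : ∀ n {p} → IsPow ⟦ 3^ (+ n) ⟧ γ p → p ≈ 2# ^ᶠ n
    pow-≈ n {p} (l , log , pow) = LR.pow-3 n {l} {γ * l} {p}
      (Ex.⟶-cong {λ n → Ex.E n l} {λ n → Ex.E n l} {⟦ 3^ (+ n) ⟧} {3ℝ ^ᶠ n} (λ n → ≈-refl {Ex.E n l})
        (≈-sym {3ℝ ^ᶠ n} {⟦ 3^ (+ n) ⟧} (3^ᶠ n)) (IsExp⇒ {l} {⟦ 3^ (+ n) ⟧} log))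
      (≈-refl {γ * l}) (IsExp⇒ {γ * l} {p} pow)

    -- The witnesses are - n l₃ for the logarithm of 3⁻ⁿ and 2ⁿ for the power with exponent - γ.
    rescaling : ∀ n → IsRescaling γ f ⟦ 3^ (ℤ.- + n) ⟧≥0 (M.φ n)
    rescaling n = ι-< (pow3-pos (ℤ.- + n)) , 2# ^ᶠ n ,
        (l , ⇒IsExp {l} {⟦ 3^ (ℤ.- + n) ⟧} (LR.log-3 n {l} {⟦ 3^ (ℤ.- + n) ⟧} (≈-refl {l}) (3^ᶠ-inverse n)) ,
          ⇒IsExp {(- γ) * l} {2# ^ᶠ n} (LR.pow-3-neg n {(- γ) * l} (≈-refl {(- γ) * l}))) ,
        ≈-refl {M.φ n}
      where
      l : ℝ
      l = - (ι (nat n) * l₃)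

    term-≈-approximant : ∀ {m x} → (let r = 3^ suc m in ∃[ p ] IsPow (3^ℕ⇒ℝ r) γ p × x ≈ proj₁ (f ⟦ ψ r ⟧≥0) * p) →
      x ≈ M.approximant m
    term-≈-approximant {m} {x} (p , pow , x≈) = ≈-trans {x} {c * p} {M.approximant m} x≈
        (≈-trans {c * p} {c * 2# ^ᶠ suc m} {M.approximant m}
          (*-cong {c} {c} {p} {2# ^ᶠ suc m} (≈-refl {c}) (pow-≈ (suc m) {p} pow))
          (≈-pointwise {c * 2# ^ᶠ suc m} {M.approximant m} (λ n → ℚ.*-comm (seq c n) (seq (2# ^ᶠ suc m) n))))
      where c = proj₁ (f ⟦ ψ (3^ suc m) ⟧≥0)

    toCover : ∀ {A} (ρ : ℝ>0) {s} → IsCoverSum f A ρ (fin s) → M.IsCover A (proj₁ ρ) s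
    toCover ρ {s} (B , covers , small , sum) = B , covers , small , HasSum⇒⟶ em {λ i → M.contribution (B i)} {s} sum

    fromCover : ∀ {A} (ρ : ℝ>0) {s} → M.IsCover A (proj₁ ρ) s → IsCoverSum f A ρ (fin s)
    fromCover ρ {s} (B , covers , small , sum) = B , covers , small , ⟶⇒HasSum em {λ i → M.contribution (B i)} {s} sum

    positive : (ρ : ℝ>0) → ¬ (proj₁ ρ ≤ 0ℝ)
    positive (ρ , ρ>0) = <⇒≱ {0ℝ} {ρ} ρ>0

    -- For each single ρ the infimum is already 0, so the limit is that of a constant.
    convergent : (∃[ s ] IsSeriesSum γ ψ f (fin s)) → IsHausdorffMeasure f (W𝒞 ψ) (fin 0ℝ)
    convergent (s , t , terms , sum) = (λ _ → fin 0ℝ) , (λ ρ → lower ρ , greatest ρ) , limit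
      where
      lim : (λ k → ∑ k M.approximant) ⟶ s
      lim = Ex.⟶-cong {λ k → ∑ k t} {λ k → ∑ k M.approximant} {s} {s}
        (λ k → ∑-cong k {t} {M.approximant} (λ m _ → term-≈-approximant {m} {t m} (terms m))) (≈-refl {s})
        (HasSum⇒⟶ em {t} {s} sum)
      small : ∀ (ρ : ℝ>0) ε → 0ℚ ℚ.< ε → ∃[ c ] c ≤ ι ε × M.IsCover (W𝒞 ψ) (proj₁ ρ) c
      small ρ = M.Convergent.small-covers {s} lim {proj₁ ρ} (positive ρ)
      lower : ∀ ρ x → IsCoverSum f (W𝒞 ψ) ρ x → fin 0ℝ ≤∞ x
      lower ρ (fin x) c = M.cover-nonNeg {W𝒞 ψ} {proj₁ ρ} {x} (toCover {W𝒞 ψ} ρ {x} c)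
      lower ρ ∞ c = tt
      greatest : ∀ ρ l → (∀ x → IsCoverSum f (W𝒞 ψ) ρ x → l ≤∞ x) → l ≤∞ fin 0ℝ
      greatest ρ (fin l) h = closed {l} {0ℝ} λ ε ε>0 →
        let c , c≤ε , cover = small ρ ε ε>0
        in ≤-trans {l} {c} {0ℝ + ι ε} (h (fin c) (fromCover {W𝒞 ψ} ρ {c} cover))
             (≤-trans {c} {ι ε} {0ℝ + ι ε} c≤ε (≤-pointwise {ι ε} {0ℝ + ι ε} (λ _ → ℚ.≤-reflexive (sym (ℚ.+-identityˡ ε)))))
      -- One cover of finite cost refutes the lower bound ∞; the choice ε = 1 is arbitrary.
      greatest ρ ∞ h = let c , _ , cover = small ρ 1ℚ (ℚ.positive⁻¹ 1ℚ) in h (fin c) (fromCover {W𝒞 ψ} ρ {c} cover)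
      limit : LimitAt0⁺ (λ _ → fin 0ℝ) (fin 0ℝ)
      limit (ε , ε>0) = (ε , ε>0) , λ _ _ → let η , η>0 , near = within em ε ε>0 in
        near (0ℝ - 0ℝ) (≤-pointwise {0ℝ - 0ℝ} {ι η} (λ _ → ℚ.<⇒≤ η>0)) (≤-pointwise { - (0ℝ - 0ℝ)} {ι η} (λ _ → ℚ.<⇒≤ η>0))

    module _ (g : ∀ ρ → ¬ (ρ ≤ 0ℝ) → ℝ) where

      value∞ : ℝ>0 → ℝ∞
      value∞ ρ = fin (g (proj₁ ρ) (positive ρ))

      module _ (diverges : ∀ b → ∃[ k ] b ≤ ∑ k M.approximant) (both : M.Divergent.BothMeasures diverges g) where

        infimum-W : ∀ ρ → IsInfimum (IsCoverSum f (W𝒞 ψ) ρ) (value∞ ρ)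
        infimum-W ρ = lower , greatest
          where
          lower : ∀ x → IsCoverSum f (W𝒞 ψ) ρ x → value∞ ρ ≤∞ x
          lower (fin x) c = proj₁ (both (proj₁ ρ) (positive ρ)) x (toCover {W𝒞 ψ} ρ {x} c)
          lower ∞ c = tt
          greatest : ∀ l → (∀ x → IsCoverSum f (W𝒞 ψ) ρ x → l ≤∞ x) → l ≤∞ value∞ ρ
          greatest (fin l) h = proj₂ (both (proj₁ ρ) (positive ρ)) l (λ s c → h (fin s) (fromCover {W𝒞 ψ} ρ {s} (M.cover-W {proj₁ ρ} {s} c)))
          greatest ∞ h = let n , n-small = M.small-value {proj₁ ρ} (positive ρ) in
            h (fin (M.φ n)) (fromCover {W𝒞 ψ} ρ {M.φ n} (M.cover-W {proj₁ ρ} {M.φ n} (M.level-cover n {proj₁ ρ} n-small)))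

        infimum-𝒞 : ∀ ρ → IsInfimum (IsCoverSum f 𝒞 ρ) (value∞ ρ)
        infimum-𝒞 ρ = lower , greatest
          where
          lower : ∀ x → IsCoverSum f 𝒞 ρ x → value∞ ρ ≤∞ x
          lower (fin x) c = proj₁ (both (proj₁ ρ) (positive ρ)) x (M.cover-W {proj₁ ρ} {x} (toCover {𝒞} ρ {x} c))
          lower ∞ c = tt
          greatest : ∀ l → (∀ x → IsCoverSum f 𝒞 ρ x → l ≤∞ x) → l ≤∞ value∞ ρ
          greatest (fin l) h = proj₂ (both (proj₁ ρ) (positive ρ)) l (λ s c → h (fin s) (fromCover {𝒞} ρ {s} c))
          greatest ∞ h = let n , n-small = M.small-value {proj₁ ρ} (positive ρ) in
            h (fin (M.φ n)) (fromCover {𝒞} ρ {M.φ n} (M.level-cover n {proj₁ ρ} n-small))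

        limit-fin : ∀ {l} → M.Divergent.TendsTo diverges g l → LimitAt0⁺ value∞ (fin l)
        limit-fin {l} tends (ε , ε>0) =
          let η , η>0 , near = within em ε ε>0
              n , close-to = tends η η>0
          in (⟦ 3^ (ℤ.- + n) ⟧ , ι-< (pow3-pos (ℤ.- + n))) , λ ρ ρ< →
            let p , q = close-to (proj₁ ρ) (positive ρ) (<⇒≱ {proj₁ ρ} {⟦ 3^ (ℤ.- + n) ⟧} ρ<)
            in near (g (proj₁ ρ) (positive ρ) - l) p q

        limit-∞ : M.Divergent.TendsTo∞ diverges g → LimitAt0⁺ value∞ ∞
        limit-∞ tends (ε , ε>0) =
          -- The added 1 turns the weak bound into the strict one that `Near` demands at ∞.
          let n , large = tends (ε + 1ℝ)
          in (⟦ 3^ (ℤ.- + n) ⟧ , ι-< (pow3-pos (ℤ.- + n))) , λ ρ ρ< →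
            exceeds {g (proj₁ ρ) (positive ρ)} (large (proj₁ ρ) (positive ρ) (<⇒≱ {proj₁ ρ} {⟦ 3^ (ℤ.- + n) ⟧} ρ<))
          where
          exceeds : ∀ {x} → ε + 1ℝ ≤ x → ε < x
          exceeds {x} h = ≱⇒< em {ε} {x} λ x≤ε → <⇒≱ {ε} {ε + 1ℝ}
            (1ℚ , ℚ.positive⁻¹ 1ℚ , 0 , λ _ _ → ℚ.≤-refl) (≤-trans {ε + 1ℝ} {x} {ε} h x≤ε)

    divergent : RescalingMonotonic γ f → IsSeriesSum γ ψ f ∞ →
      ∃[ v ] IsHausdorffMeasure f (W𝒞 ψ) v × IsHausdorffMeasure f 𝒞 v
    divergent monotonic (t , terms , sum) = conclude (common monotonic)
      where
      diverges : ∀ b → ∃[ k ] b ≤ ∑ k M.approximant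
      diverges b =
        let q , b≤q = ι-bound b
            -- Neighbourhoods of ∞ have positive parameters, so the bound q is raised to a positive
            -- rational.
            e = ℚ.∣ q ∣ ℚ.+ 1ℚ
            e>0 = ℚ.+-mono-≤-< (ℚ.0≤∣p∣ q) (ℚ.positive⁻¹ 1ℚ)
            k , large = sum (ι e , ι-< {0ℚ} {e} e>0)
            q≤e = ℚ.≤-trans (p≤∣p∣ q) (ℚ-≤-by (ℚ.nonNegative⁻¹ 1ℚ)
              (solve 1 (λ a → con 1ℚ :- con 0ℚ := (a :+ con 1ℚ) :- a) refl ℚ.∣ q ∣))
        in k , ≤-trans {b} {ι q} {∑ k M.approximant} b≤q (≤-trans {ι q} {ι e} {∑ k M.approximant}
             (≤-pointwise {ι q} {ι e} (λ _ → q≤e)) (≤-trans {ι e} {sumTo k t} {∑ k M.approximant}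
               (<⇒≤ {ι e} {sumTo k t} (large k ℕ.≤-refl))
               (subst (_≤ ∑ k M.approximant) (∑≡sumTo em k t) (≈⇒≤ {∑ k t} {∑ k M.approximant}
                 (∑-cong k {t} {M.approximant} (λ m _ → term-≈-approximant {m} {t m} (terms m)))))))
        where open ℚ-Solver using (solve; con; _:+_; _:-_; _:=_)
      radius-≤ : ∀ n → ⟦ 3^ (ℤ.- + suc n) ⟧ ≤ ⟦ 3^ (ℤ.- + n) ⟧
      radius-≤ n = ≤-pointwise {⟦ 3^ (ℤ.- + suc n) ⟧} {⟦ 3^ (ℤ.- + n) ⟧}
        (λ _ → pow3-≤ (ℤ.neg-mono-≤ (ℤ.+≤+ (ℕ.n≤1+n n))))
      common : RescalingMonotonic γ f → M.Divergent.CommonMeasure diverges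
      -- The radius 3⁻ⁿ falls as n grows, so a rescaling that increases in r makes φ nonincreasing
      -- in n.
      common (inj₁ increasing) = M.Divergent.Nonincreasing.common diverges λ n →
        increasing _ _ (M.φ (suc n)) (M.φ n) (rescaling (suc n)) (rescaling n) (radius-≤ n)
      common (inj₂ decreasing) = M.Divergent.Nondecreasing.common diverges λ n →
        decreasing _ _ (M.φ (suc n)) (M.φ n) (rescaling (suc n)) (rescaling n) (radius-≤ n)
      conclude : M.Divergent.CommonMeasure diverges → ∃[ v ] IsHausdorffMeasure f (W𝒞 ψ) v × IsHausdorffMeasure f 𝒞 v
      conclude (g , both , inj₁ (l , tends)) = fin l ,
        (value∞ g , infimum-W g diverges both , limit-fin g diverges both {l} tends) ,
        (value∞ g , infimum-𝒞 g diverges both , limit-fin g diverges both {l} tends)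
      conclude (g , both , inj₂ tends) = ∞ ,
        (value∞ g , infimum-W g diverges both , limit-∞ g diverges both tends) ,
        (value∞ g , infimum-𝒞 g diverges both , limit-∞ g diverges both tends)

theorem2 : ExcludedMiddle 0ℓ →
    (γ : ℝ) → IsLogRatio 2ℝ 3ℝ γ →
    (ψ : 3^ℕ → 3^ℤ) →
    (f : ℝ≥0 → ℝ≥0) → IsDimensionFunction f → RescalingMonotonic γ f →
    ((∃[ s ] IsSeriesSum γ ψ f (fin s)) → IsHausdorffMeasure f (W𝒞 ψ) (fin 0ℝ))
    × (IsSeriesSum γ ψ f ∞ →
    ∃[ v ] IsHausdorffMeasure f (W𝒞 ψ) v × IsHausdorffMeasure f 𝒞 v)
theorem2 em γ (l₂ , l₃ , log2 , log3 , ratio) ψ f dim monotonic =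
    T.convergent γ l₂ l₃ log2 log3 ratio ψ f dim
  , T.divergent γ l₂ l₃ log2 log3 ratio ψ f dim monotonic
  where module T = Transfer em
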